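{- Let $G$ be a $4$-regular graph with $\chi'(G)=4$. Then every proper $5$-edge coloring of $G$ can be transformed into any proper $4$-edge coloring of $G$ by a sequence of interchanges.
   Context: Graphs are finite, without loops and multiple edges. A proper $t$-edge coloring is a map $f:E(G)\to\{1,\dots,t\}$ assigning distinct colors to adjacent edges; a proper $4$-edge coloring is also regarded as a proper $5$-edge coloring. $\chi'(G)$ is the chromatic index. For colors $a,b$, $G_f(a,b)$ is the subgraph induced by the edges colored $a$ or $b$; an interchange switches colors $a$ and $b$ on one connected component of $G_f(a,b)$. -}

module Defs where

open import Data.Nat using (ℕ)
open import Data.Bool using (Bool; true; false)
open import Data.Fin using (Fin; _<_; inject₁; _≟_)
open import Data.List using (length; filterᵇ; allFin)
open import Data.Product using (Σ; Σ-syntax; ∃; ∃-syntax; _×_; proj₁; proj₂; _,_)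
open import Data.Sum using (_⊎_)
open import Relation.Nullary using (¬_; yes; no)
open import Relation.Binary.PropositionalEquality using (_≡_; _≢_)
open import Relation.Binary.Construct.Closure.ReflexiveTransitive using (Star)

record Graph (n : ℕ) : Set where
  field
    adj    : Fin n → Fin n → Bool
    sym    : ∀ u v → adj u v ≡ adj v u
    irrefl : ∀ u → adj u u ≡ false
open Graph public

-- Edges: unordered pairs {u,v}, represented with u < v.
record Edge {n : ℕ} (G : Graph n) : Set where
  constructor edge
  field
    tail   : Fin n
    head   : Fin n
    lt     : tail < head
    isEdge : adj G tail head ≡ true
open Edge public

Incident : ∀ {n} {G : Graph n} → Edge G → Fin n → Set
Incident e w = tail e ≡ w ⊎ head e ≡ w

ShareEnd : ∀ {n} {G : Graph n} → Edge G → Edge G → Set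
ShareEnd {n} e e' = Σ[ w ∈ Fin n ] (Incident e w × Incident e' w)

SameEdge : ∀ {n} {G : Graph n} → Edge G → Edge G → Set
SameEdge e e' = tail e ≡ tail e' × head e ≡ head e'

AdjEdges : ∀ {n} {G : Graph n} → Edge G → Edge G → Set
AdjEdges e e' = ShareEnd e e' × ¬ SameEdge e e'

degree : ∀ {n} → Graph n → Fin n → ℕ
degree {n} G v = length (filterᵇ (adj G v) (allFin n))

Regular : ∀ {n} → ℕ → Graph n → Set
Regular {n} k G = ∀ (v : Fin n) → degree G v ≡ k

EdgeColoring : ∀ {n} → Graph n → ℕ → Set
EdgeColoring G t = Edge G → Fin t

Proper : ∀ {n} {G : Graph n} {t} → EdgeColoring G t → Set
Proper {G = G} f = ∀ (e e' : Edge G) → AdjEdges e e' → f e ≢ f e'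

Colorable : ∀ {n} → Graph n → ℕ → Set
Colorable G t = Σ[ f ∈ EdgeColoring G t ] Proper f

-- chromatic index equals k: k-colorable but not (k-1)-colorable
-- (edge colorability is monotone in the number of colors)
ChromaticIndexIs : ∀ {n} → Graph n → ℕ → Set
ChromaticIndexIs G ℕ.zero = Colorable G ℕ.zero
ChromaticIndexIs G (ℕ.suc k) = Colorable G (ℕ.suc k) × ¬ Colorable G k

as5 : ∀ {n} {G : Graph n} → EdgeColoring G 4 → EdgeColoring G 5
as5 g e = inject₁ (g e)

swap : ∀ {t} → Fin t → Fin t → Fin t → Fin t
swap a b c with c ≟ a
... | yes _ = b
... | no _ with c ≟ b
...   | yes _ = a
...   | no _ = c

InAB : ∀ {n} {G : Graph n} {t} → EdgeColoring G t → Fin t → Fin t → Edge G → Set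
InAB f a b e = f e ≡ a ⊎ f e ≡ b

LinkAB : ∀ {n} {G : Graph n} {t} → EdgeColoring G t → Fin t → Fin t →
         Edge G → Edge G → Set
LinkAB f a b e e' = InAB f a b e × InAB f a b e' × ShareEnd e e'

SameComp : ∀ {n} {G : Graph n} {t} → EdgeColoring G t → Fin t → Fin t →
           Edge G → Edge G → Set
SameComp f a b = Star (LinkAB f a b)

-- f' is obtained from f by one interchange: switch a and b on the
-- connected component of G_f(a,b) containing edge e0.
-- (Components of G_f(a,b) without edges are isolated vertices, on which an
-- interchange changes nothing.)
Interchange : ∀ {n} {G : Graph n} {t} → EdgeColoring G t → EdgeColoring G t → Set
Interchange {G = G} {t} f f' =
  Σ[ a ∈ Fin t ] Σ[ b ∈ Fin t ] Σ[ e0 ∈ Edge G ]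
    (InAB f a b e0 ×
     (∀ (e : Edge G) →
        (SameComp f a b e0 e → f' e ≡ swap a b (f e)) ×
        (¬ SameComp f a b e0 e → f' e ≡ f e)))

Transformable : ∀ {n} {G : Graph n} {t} → EdgeColoring G t → EdgeColoring G t → Set
Transformable {G = G} f g =
  Σ[ h ∈ EdgeColoring G _ ] (Star Interchange f h × (∀ (e : Edge G) → h e ≡ g e))

{-# OPTIONS --safe #-}
-- Since G is 4-regular, each vertex misses exactly one of the five colours, and a proper colouring is a family of
-- involutions ν c of the vertices: ν c v is the neighbour of v along colour c, or v itself if v misses c. An exchange of
-- two colours on any set closed under both involutions is a product of interchanges.
--
-- The colour classes of g are produced one after the other; a class that has been produced is not touched any more, so
-- each time fewer colours are active. Let M be the next class and 0 the colour that it should get. As long as the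
-- 0-coloured edges are not M, their symmetric difference with M can be made smaller:
--  * If no vertex misses 0, then Vizing's fan argument never gets stuck, and it recolours some 0-edge outside M.
--  * If M matches z and x, and z misses 0, then either x misses 0 too and zx can be recoloured, or x has a 0-edge xy
--    outside M. Let c be the colour of zx. If x and y miss the same colour or y misses c, a path of at most two
--    edges is exchanged. Otherwise let t be the neighbour of y along c. Unless t misses the only colour other than
--    0, c and those missing at x and y, the chains at t lead back to the previous cases. This settles the
--    case of four active colours; for five, it severely restricts the neighbourhoods of x, y and z.
-- The remaining case analysis is recorded as certificates for a game in which local pictures of the colouring are
-- explored and changed; run checks a certificate and turns it into a proof.
module Submission where

open import Defs
open import Axiom.UniquenessOfIdentityProofs using (module Decidable⇒UIP)
open import Data.Bool using (Bool; true; false; if_then_else_; T; T?; _∧_; _∨_; not)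
import Data.Bool.Properties as Boolₚ
open import Data.Empty using (⊥; ⊥-elim)
open import Data.Fin using (Fin; zero; suc; toℕ)
import Data.Fin as Fin
open import Data.Fin.Patterns
import Data.Fin.Properties as Finₚ
open import Data.List using (List; []; _∷_; _++_; map; lookup; allFin; filterᵇ)
import Data.List.Membership.DecPropositional as DecMem
open import Data.List.Membership.Propositional using (_∈_; _∉_)
import Data.List.Membership.Propositional.Properties as Memₚ
open import Data.List.Relation.Unary.All as All using (All; []; _∷_)
import Data.List.Relation.Unary.All.Properties as Allₚ
open import Data.List.Relation.Unary.AllPairs as AllPairs using (AllPairs; []; _∷_)
import Data.List.Relation.Unary.AllPairs.Properties as AllPairsₚ
open import Data.List.Relation.Unary.Any as Any using (Any; here; there)
open import Data.List.Relation.Unary.Unique.Propositional using (Unique)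
import Data.List.Relation.Unary.Unique.Propositional.Properties as Uniqueₚ
open import Data.Maybe using (Maybe; just; nothing; _>>=_; _<∣>_; is-just)
open import Data.Nat using (ℕ; zero; suc; _+_; _∸_; _≤_; _<_; z≤n; s≤s; _≤?_; _<?_)
import Data.Nat as Nat
open import Data.Nat.ListAction using () renaming (sum to total)
import Data.Nat.Properties as ℕₚ
open import Data.Product using (Σ; Σ-syntax; ∃-syntax; _×_; proj₁; proj₂; _,_)
open import Data.Product.Properties using (≡-dec)
open import Data.Sum using (_⊎_; inj₁; inj₂; [_,_]′) renaming (swap to ⊎-swap)
open import Data.Unit using (⊤; tt)
open import Function using (_∘_; case_of_)
open import Relation.Binary.Construct.Closure.ReflexiveTransitive as Star using (Star; ε; _◅_; _◅◅_)
open import Relation.Binary.Definitions using (tri<; tri≈; tri>)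
open import Relation.Binary.PropositionalEquality using (_≡_; _≢_; _≗_; refl; trans; cong; cong₂; subst; module ≡-Reasoning)
  renaming (sym to ≡-sym)
open import Relation.Nullary using (¬_; Dec; yes; no; contradiction; ¬?)
open import Relation.Nullary.Decidable using (⌊_⌋; _×-dec_; _⊎-dec_; _→-dec_; dec⇒maybe)

-- The potential `Φ` sees only colour 0 and `M`. Exchanging two other colours is therefore free,
-- even on a Kempe chain of unknown extent, while exchanging 0 with `b` may change `Φ` along the
-- whole chain. So 0 is exchanged for good only on sets whose vertices are all named, where the
-- change of `Φ` is a finite sum. Where an unknown chain in 0 and `b` cannot be avoided, its
-- exchange is undone after a local repair, and only named vertices end up with a different colour-0
-- edge. Chains are traced only from a vertex that misses one of the two colours. Such a chain is a
-- path, so of three vertices that each miss one of the colours it contains at most two. This is the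
-- only global information that the local case analysis receives. A strategy need not lower `Φ` by
-- itself: many hand the role of `y`, or those of `x` and `z`, to other vertices without raising `Φ`
-- and then invoke a strategy established before.

-- Transpositions and renamings of colours.

swap-l : ∀ {t} (a b : Fin t) → swap a b a ≡ b
swap-l a b with a Fin.≟ a
... | yes _ = refl
... | no a≢a = contradiction refl a≢a

swap-r : ∀ {t} (a b : Fin t) → swap a b b ≡ a
swap-r a b with b Fin.≟ a
... | yes b≡a = b≡a
... | no _ with b Fin.≟ b
...   | yes _ = refl
...   | no b≢b = contradiction refl b≢b

swap-other : ∀ {t} (a b c : Fin t) → c ≢ a → c ≢ b → swap a b c ≡ c
swap-other a b c c≢a c≢b with c Fin.≟ a
... | yes c≡a = contradiction c≡a c≢a
... | no _ with c Fin.≟ b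
...   | yes c≡b = contradiction c≡b c≢b
...   | no _ = refl

data Among {t} (a b : Fin t) : Fin t → Set where
  isˡ : Among a b a
  isʳ : Among a b b
  isₒ : ∀ {c} → c ≢ a → c ≢ b → Among a b c

among : ∀ {t} (a b c : Fin t) → Among a b c
among a b c with c Fin.≟ a
... | yes refl = isˡ
... | no c≢a with c Fin.≟ b
...   | yes refl = isʳ
...   | no c≢b = isₒ c≢a c≢b

swap-swap : ∀ {t} (a b c : Fin t) → swap a b (swap a b c) ≡ c
swap-swap a b c with among a b c
... | isˡ rewrite swap-l a b = swap-r a b
... | isʳ rewrite swap-r a b = swap-l a b
... | isₒ c≢a c≢b rewrite swap-other a b c c≢a c≢b = swap-other a b c c≢a c≢b

Color : Set
Color = Fin 5

pick : Bool → Color → Color → Color → Color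
pick k a b c = if k then swap a b c else c

pick-pick : ∀ k a b c → pick k a b (pick k a b c) ≡ c
pick-pick true a b c = swap-swap a b c
pick-pick false a b c = refl

pick-other : ∀ k {a b c} → c ≢ a → c ≢ b → pick k a b c ≡ c
pick-other true {a} {b} {c} p q = swap-other a b c p q
pick-other false p q = refl

-- Transpositions, outermost first; a list of them is a bijection for free.
Renaming : Set
Renaming = List (Color × Color)

ren : Renaming → Color → Color
ren [] c = c
ren ((a , b) ∷ ρ) c = swap a b (ren ρ c)

unren : Renaming → Color → Color
unren [] c = c
unren ((a , b) ∷ ρ) c = unren ρ (swap a b c)

ren-unren : ∀ ρ c → ren ρ (unren ρ c) ≡ c
ren-unren [] c = refl
ren-unren ((a , b) ∷ ρ) c = trans (cong (swap a b) (ren-unren ρ (swap a b c))) (swap-swap a b c)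

unren-ren : ∀ ρ c → unren ρ (ren ρ c) ≡ c
unren-ren [] c = refl
unren-ren ((a , b) ∷ ρ) c = trans (cong (unren ρ) (swap-swap a b (ren ρ c))) (unren-ren ρ c)

ren-injective : ∀ ρ {c d} → ren ρ c ≡ ren ρ d → c ≡ d
ren-injective ρ {c} {d} eq = trans (≡-sym (unren-ren ρ c)) (trans (cong (unren ρ) eq) (unren-ren ρ d))

swap-natural : ∀ (φ : Color → Color) → (∀ {c d} → φ c ≡ φ d → c ≡ d) →
               ∀ a b c → φ (swap a b c) ≡ swap (φ a) (φ b) (φ c)
swap-natural φ inj a b c with among a b c
... | isˡ = trans (cong φ (swap-l a b)) (≡-sym (swap-l (φ a) (φ b)))
... | isʳ = trans (cong φ (swap-r a b)) (≡-sym (swap-r (φ a) (φ b)))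
... | isₒ p q = trans (cong φ (swap-other a b c p q)) (≡-sym (swap-other (φ a) (φ b) (φ c) (p ∘ inj) (q ∘ inj)))

-- Finite sums whose terms change in few places.

∑ : ∀ {n} → (Fin n → ℕ) → ℕ
∑ {zero} f = 0
∑ {suc n} f = f 0F + ∑ (f ∘ suc)

∑-cong : ∀ {n} {f g : Fin n → ℕ} → f ≗ g → ∑ f ≡ ∑ g
∑-cong {zero} eq = refl
∑-cong {suc n} eq = cong₂ _+_ (eq 0F) (∑-cong (eq ∘ suc))

∑-update : ∀ {n} {f g : Fin n → ℕ} x → (∀ v → v ≢ x → f v ≡ g v) → ∑ f + g x ≡ ∑ g + f x
∑-update {suc n} {f} {g} zero eq =
  trans (cong (λ k → f 0F + k + g 0F) (∑-cong (λ v → eq (suc v) λ ())))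
        (trans (ℕₚ.+-comm (f 0F + _) (g 0F)) (trans (cong (g 0F +_) (ℕₚ.+-comm (f 0F) _)) (≡-sym (ℕₚ.+-assoc (g 0F) _ _))))
∑-update {suc n} {f} {g} (suc x) eq =
  trans (ℕₚ.+-assoc (f 0F) _ _)
        (trans (cong₂ _+_ (eq 0F λ ()) (∑-update x λ v v≢x → eq (suc v) (v≢x ∘ Finₚ.suc-injective)))
               (≡-sym (ℕₚ.+-assoc (g 0F) _ _)))

-- The totals stand on opposite sides because subtraction of natural numbers truncates. With `L` the
-- vertices whose colour-0 edge may have changed, this reduces the change of the potential to named
-- vertices. The induction passes through `h`, which has the new value at `x` and the old ones
-- elsewhere.
∑-change : ∀ {n} {f g : Fin n → ℕ} (L : List (Fin n)) → AllPairs _≢_ L →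
           (∀ v → All (_≢ v) L → f v ≡ g v) → ∑ f + total (map g L) ≡ ∑ g + total (map f L)
∑-change [] [] eq = cong (_+ 0) (∑-cong λ v → eq v [])
∑-change {n} {f} {g} (x ∷ L) (x∉L ∷ uniq) eq = begin
  ∑ f + (g x + total (map g L))   ≡⟨ ℕₚ.+-assoc (∑ f) _ _ ⟨
  ∑ f + g x + total (map g L)     ≡⟨ cong (λ k → ∑ f + k + total (map g L)) (h-x) ⟨
  ∑ f + h x + total (map g L)     ≡⟨ cong (_+ total (map g L)) (∑-update x λ v v≢x → ≡-sym (h-other v v≢x)) ⟩
  ∑ h + f x + total (map g L)     ≡⟨ cong (_+ total (map g L)) (ℕₚ.+-comm (∑ h) (f x)) ⟩
  f x + ∑ h + total (map g L)     ≡⟨ ℕₚ.+-assoc (f x) _ _ ⟩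
  f x + (∑ h + total (map g L))   ≡⟨ cong (f x +_) (∑-change L uniq h-g) ⟩
  f x + (∑ g + total (map h L))   ≡⟨ cong (λ k → f x + (∑ g + k)) (map-h L x∉L) ⟩
  f x + (∑ g + total (map f L))   ≡⟨ ℕₚ.+-assoc (f x) _ _ ⟨
  f x + ∑ g + total (map f L)     ≡⟨ cong (_+ total (map f L)) (ℕₚ.+-comm (f x) (∑ g)) ⟩
  ∑ g + f x + total (map f L)     ≡⟨ ℕₚ.+-assoc (∑ g) _ _ ⟩
  ∑ g + (f x + total (map f L))   ∎
  where
  open ≡-Reasoning
  h : Fin n → ℕ
  h v with v Fin.≟ x
  ... | yes _ = g v
  ... | no _ = f v
  h-x : h x ≡ g x
  h-x with x Fin.≟ x
  ... | yes _ = refl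
  ... | no x≢x = contradiction refl x≢x
  h-other : ∀ v → v ≢ x → h v ≡ f v
  h-other v v≢x with v Fin.≟ x
  ... | yes v≡x = contradiction v≡x v≢x
  ... | no _ = refl
  h-g : ∀ v → All (_≢ v) L → h v ≡ g v
  h-g v v∉L with v Fin.≟ x
  ... | yes _ = refl
  ... | no v≢x = eq v ((v≢x ∘ ≡-sym) ∷ v∉L)
  map-h : ∀ L → All (x ≢_) L → total (map h L) ≡ total (map f L)
  map-h [] [] = refl
  map-h (y ∷ L) (x≢y ∷ p) = cong₂ _+_ (h-other y (x≢y ∘ ≡-sym)) (map-h L p)

-- First witnesses, and orbits of injections of a finite set.

least : ∀ {P : ℕ → Set} → (∀ i → Dec (P i)) → ∀ m → P m → ∃[ k ] (P k × (∀ j → j < k → ¬ P j))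
least {P} P? m pm with P? 0
... | yes p0 = 0 , p0 , λ _ ()
least {P} P? zero pm | no ¬p0 = contradiction pm ¬p0
least {P} P? (suc m) pm | no ¬p0 with least {P ∘ suc} (P? ∘ suc) m pm
... | k , pk , min = suc k , pk , λ { zero _ → ¬p0 ; (suc j) (s≤s j<k) → min j j<k }

iterate : ∀ {A : Set} → (A → A) → A → ℕ → A
iterate g x zero = x
iterate g x (suc i) = g (iterate g x i)

module _ {n : ℕ} (g : Fin n → Fin n) (g-inj : ∀ {u v} → g u ≡ g v → u ≡ v) where

  iterate-cancel : ∀ x i k → iterate g x i ≡ iterate g x (i + k) → x ≡ iterate g x k
  iterate-cancel x zero k eq = eq
  iterate-cancel x (suc i) k eq = iterate-cancel x i k (g-inj eq)

  -- Two early iterates coincide by the pigeonhole principle, and injectivity cancels their common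
  -- part. So every orbit is a cycle: forward iteration also reaches predecessors, and a bounded
  -- search decides membership.
  period : ∀ x → ∃[ m ] iterate g x (suc m) ≡ x
  period x with Finₚ.pigeonhole (ℕₚ.n<1+n n) (iterate g x ∘ toℕ)
  ... | i , j , i<j , eq = toℕ j ∸ suc (toℕ i) ,
    ≡-sym (iterate-cancel x (toℕ i) _ (trans eq (cong (iterate g x) j≡)))
    where
    j≡ : toℕ j ≡ toℕ i + suc (toℕ j ∸ suc (toℕ i))
    j≡ = trans (≡-sym (ℕₚ.m+[n∸m]≡n i<j)) (≡-sym (ℕₚ.+-suc (toℕ i) _))

-- Kempe chains as orbits of two involutions.

Colouring : ℕ → Set
Colouring n = Color → Fin n → Fin n

flip : ∀ {n} → Color → Color → (Fin n → Bool) → Colouring n → Colouring n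
flip a b K ν c v = ν (pick (K v) a b c) v

Closed : ∀ {n} → Color → Color → (Fin n → Bool) → Colouring n → Set
Closed a b K ν = ∀ v → K (ν a v) ≡ K v × K (ν b v) ≡ K v

module Chains {n : ℕ} (ν : Colouring n) (invol : ∀ c v → ν c (ν c v) ≡ v) (a b : Color) where

  private V = Fin n

  ν-injective : ∀ c {u v} → ν c u ≡ ν c v → u ≡ v
  ν-injective c {u} {v} eq = trans (≡-sym (invol c u)) (trans (cong (ν c) eq) (invol c v))

  turn : V → V
  turn v = ν a (ν b v)

  turn-injective : ∀ {u v} → turn u ≡ turn v → u ≡ v
  turn-injective = ν-injective b ∘ ν-injective a

  -- This is the orbit of `v` under the dihedral group generated by `ν a` and `ν b`: powers of the
  -- rotation `turn`, and one reflection of each. Negative powers are covered because `turn` is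
  -- periodic.
  OnChain : V → V → Set
  OnChain v u = ∃[ i ] (iterate turn v i ≡ u ⊎ ν b (iterate turn v i) ≡ u)

  onChain-step : ∀ {v u} → OnChain v u → OnChain v (ν a u) × OnChain v (ν b u)
  onChain-step {v} (i , inj₁ refl) = back i , (i , inj₂ refl)
    where
    back : ∀ i → OnChain v (ν a (iterate turn v i))
    back (suc i) = i , inj₂ (≡-sym (invol a _))
    back zero with period turn turn-injective v
    ... | m , eq = m , inj₂ (trans (≡-sym (invol a _)) (cong (ν a) eq))
  onChain-step {v} (i , inj₂ refl) = (suc i , inj₁ refl) , (i , inj₁ (≡-sym (invol b _)))

  onChain-reduce : ∀ {v u} m → iterate turn v (suc m) ≡ v → OnChain v u →
                   ∃[ i ] (i < suc m × (iterate turn v i ≡ u ⊎ ν b (iterate turn v i) ≡ u))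
  onChain-reduce {v} {u} m eq (i , p) =
    let j , j<m , e = small i in j , j<m , subst (λ w → w ≡ u ⊎ ν b w ≡ u) (≡-sym e) p
    where
    small : ∀ i → ∃[ j ] (j < suc m × iterate turn v j ≡ iterate turn v i)
    small zero = 0 , s≤s z≤n , refl
    small (suc i) with small i
    ... | j , j<m , e with suc j <? suc m
    ...   | yes p = suc j , p , cong turn e
    ...   | no ¬p with ℕₚ.≤-antisym j<m (ℕₚ.≮⇒≥ ¬p)
    ...     | refl = 0 , s≤s z≤n , trans (≡-sym eq) (cong turn e)

  onChain? : ∀ v u → Dec (OnChain v u)
  onChain? v u with ℕₚ.anyUpTo? (λ i → (iterate turn v i Fin.≟ u) ⊎-dec (ν b (iterate turn v i) Fin.≟ u))
                                 (suc (proj₁ (period turn turn-injective v)))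
  ... | yes (i , _ , p) = yes (i , p)
  ... | no ¬p = no (¬p ∘ onChain-reduce _ (proj₂ (period turn turn-injective v)))

  onChain-minimal : ∀ {v} (S : V → Set) → S v → (∀ {u} → S u → S (ν a u)) → (∀ {u} → S u → S (ν b u)) →
                    ∀ {u} → OnChain v u → S u
  onChain-minimal {v} S Sv Sa Sb (i , inj₁ refl) = go i
    where
    go : ∀ i → S (iterate turn v i)
    go zero = Sv
    go (suc i) = Sa (Sb (go i))
  onChain-minimal S Sv Sa Sb (i , inj₂ refl) = Sb (onChain-minimal S Sv Sa Sb (i , inj₁ refl))

  chain : V → V → Bool
  chain v u = ⌊ onChain? v u ⌋

  chain-sound : ∀ {v u} → chain v u ≡ true → OnChain v u
  chain-sound {v} {u} eq with onChain? v u
  ... | yes p = p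

  chain-complete : ∀ {v u} → OnChain v u → chain v u ≡ true
  chain-complete {v} {u} p with onChain? v u
  ... | yes _ = refl
  ... | no ¬p = contradiction p ¬p

  chain-start : ∀ v → chain v v ≡ true
  chain-start v = chain-complete (0 , inj₁ refl)

  ⇔→≡ : ∀ {x y : Bool} → (x ≡ true → y ≡ true) → (y ≡ true → x ≡ true) → x ≡ y
  ⇔→≡ {true} {y} f g = ≡-sym (f refl)
  ⇔→≡ {false} {true} f g = g refl
  ⇔→≡ {false} {false} f g = refl

  chain-closed : ∀ v → Closed a b (chain v) ν
  chain-closed v u =
    ⇔→≡ (λ p → chain-complete (subst (OnChain v) (invol a u) (proj₁ (onChain-step (chain-sound p)))))
        (λ p → chain-complete (proj₁ (onChain-step (chain-sound p)))) ,
    ⇔→≡ (λ p → chain-complete (subst (OnChain v) (invol b u) (proj₂ (onChain-step (chain-sound p)))))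
        (λ p → chain-complete (proj₂ (onChain-step (chain-sound p))))

  End : V → Set
  End u = ν a u ≡ u ⊎ ν b u ≡ u

  -- The chain of an end v is traversed by the walk p from v; the walk turns back at its first
  -- fixed vertex, which is therefore the only other end.
  module _ (v : V) (v-end : ν a v ≡ v) where

    hue : Bool → Color
    hue true = b
    hue false = a

    parity : ℕ → Bool
    parity zero = true
    parity (suc i) = not (parity i)

    walk : ℕ → V
    walk zero = v
    walk (suc i) = ν (hue (parity i)) (walk i)

    walk-turn : ∀ i → ∃[ j ] (parity j ≡ true × walk j ≡ iterate turn v i)
    walk-turn zero = 0 , refl , refl
    walk-turn (suc i) with walk-turn i
    ... | j , even , eq = suc (suc j) , (trans (cong (not ∘ not) even) refl) ,
      trans (cong (λ k → ν (hue (not k)) (ν (hue k) (walk j))) even) (cong turn eq)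

    onWalk : ∀ {u} → OnChain v u → ∃[ j ] walk j ≡ u
    onWalk (i , inj₁ eq) with walk-turn i
    ... | j , _ , e = j , trans e eq
    onWalk (i , inj₂ eq) with walk-turn i
    ... | j , even , e = suc j , trans (cong₂ (λ k → ν (hue k)) even e) eq

    walk-back : ∀ i → ν (hue (not (parity (suc i)))) (walk (suc i)) ≡ walk i
    walk-back i with parity i
    ... | true = invol b _
    ... | false = invol a _

    Stop : ℕ → Set
    Stop i = walk (suc i) ≡ walk i

    -- A vertex fixed by the colour along which the walk would leave makes it stand still there. If
    -- the vertex is fixed by the colour along which it was entered, the walk stood still one step
    -- earlier.
    end-stop : ∀ i → End (walk i) → walk i ≢ v → ∃[ k ] Stop k
    end-stop zero _ w≢v = contradiction refl w≢v
    end-stop (suc i) end _ = pickStop (parity (suc i)) refl end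
      where
      pickStop : ∀ p → parity (suc i) ≡ p → End (walk (suc i)) → ∃[ k ] Stop k
      pickStop true eq (inj₂ e) = suc i , trans (cong (λ p → ν (hue p) (walk (suc i))) eq) e
      pickStop false eq (inj₁ e) = suc i , trans (cong (λ p → ν (hue p) (walk (suc i))) eq) e
      pickStop true eq (inj₁ e) = i , trans (≡-sym e) (trans (cong (λ p → ν (hue (not p)) (walk (suc i))) (≡-sym eq)) (walk-back i))
      pickStop false eq (inj₂ e) = i , trans (≡-sym e) (trans (cong (λ p → ν (hue (not p)) (walk (suc i))) (≡-sym eq)) (walk-back i))

    module _ (k : ℕ) (stop : Stop k) (first : ∀ j → j < k → ¬ Stop j) where

      Before : V → Set
      Before u = ∃[ j ] (j ≤ k × walk j ≡ u)

      forth : ∀ j → j ≤ k → Before (walk (suc j))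
      forth j j≤k with ℕₚ.m≤n⇒m<n∨m≡n j≤k
      ... | inj₁ j<k = suc j , j<k , refl
      ... | inj₂ refl = k , ℕₚ.≤-refl , ≡-sym stop

      back : ∀ j → j ≤ k → Before (ν (hue (not (parity j))) (walk j))
      back zero _ = 0 , z≤n , ≡-sym v-end
      back (suc j) j<k = j , ℕₚ.<⇒≤ j<k , ≡-sym (walk-back j)

      before-hue : ∀ c {u} → Before u → Before (ν (hue c) u)
      before-hue c (j , j≤k , refl) with parity j | forth j j≤k | back j j≤k
      before-hue true  (j , j≤k , refl) | true  | f | _ = f
      before-hue false (j , j≤k , refl) | true  | _ | g = g
      before-hue true  (j , j≤k , refl) | false | _ | g = g
      before-hue false (j , j≤k , refl) | false | f | _ = f

      -- Up to the first stop both neighbours of a visited vertex are visited: inside the walk they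
      -- are its successor and predecessor, `v` is fixed by `a`, and the walk stands still at `k`.
      -- Minimality of the chain puts all of it on this segment.
      before : ∀ {u} → OnChain v u → Before u
      before = onChain-minimal Before (0 , z≤n , refl) (before-hue false) (before-hue true)

      -- An end other than `v` that is met before step `k` would have caused an earlier stop.
      last : ∀ {u} → OnChain v u → End u → u ≢ v → u ≡ walk k
      last onu end u≢v with before onu
      ... | j , j≤k , refl with ℕₚ.m≤n⇒m<n∨m≡n j≤k
      ...   | inj₂ refl = refl
      ...   | inj₁ j<k = ⊥-elim (no-stop j j<k end u≢v)
        where
        no-stop : ∀ j → j < k → End (walk j) → walk j ≢ v → ⊥
        no-stop zero _ _ w≢v = w≢v refl
        no-stop (suc j) j<k end _ = go (parity (suc j)) refl end
          where
          go : ∀ p → parity (suc j) ≡ p → End (walk (suc j)) → ⊥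
          go true eq (inj₂ e) = first (suc j) j<k (trans (cong (λ p → ν (hue p) (walk (suc j))) eq) e)
          go false eq (inj₁ e) = first (suc j) j<k (trans (cong (λ p → ν (hue p) (walk (suc j))) eq) e)
          go true eq (inj₁ e) = first j (ℕₚ.<⇒≤ j<k) (trans (≡-sym e) (trans (cong (λ p → ν (hue (not p)) (walk (suc j))) (≡-sym eq)) (walk-back j)))
          go false eq (inj₂ e) = first j (ℕₚ.<⇒≤ j<k) (trans (≡-sym e) (trans (cong (λ p → ν (hue (not p)) (walk (suc j))) (≡-sym eq)) (walk-back j)))

    other-end-unique : ∀ {u w} → OnChain v u → OnChain v w → End u → End w → u ≢ v → w ≢ v → u ≡ w
    other-end-unique onu onw endu endw u≢v w≢v with onWalk onu
    ... | i , refl with end-stop i endu u≢v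
    ...   | m , stop with least (λ j → walk (suc j) Fin.≟ walk j) m stop
    ...     | k , stopk , first = trans (last k stopk first onu endu u≢v) (≡-sym (last k stopk first onw endw w≢v))

record Component {n} (ν : Colouring n) (a b : Color) (v : Fin n) : Set where
  field
    member : Fin n → Bool
    closed : Closed a b member ν
    start : member v ≡ true
    unique : ∀ u w → member u ≡ true → member w ≡ true → ν a u ≡ u ⊎ ν b u ≡ u → ν a w ≡ w ⊎ ν b w ≡ w →
             u ≢ v → w ≢ v → u ≡ w

component : ∀ {n} (ν : Colouring n) → (∀ c v → ν c (ν c v) ≡ v) → ∀ a b v →
            ν a v ≡ v ⊎ ν b v ≡ v → Component ν a b v
component ν invol a b v (inj₁ end) = record
  { member = chain v ; closed = chain-closed v ; start = chain-start v
  ; unique = λ u w p q eu ew → other-end-unique v end (chain-sound p) (chain-sound q) eu ew }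
  where open Chains ν invol a b
component ν invol a b v (inj₂ end) = record
  { member = chain v ; closed = λ u → let p , q = chain-closed v u in q , p ; start = chain-start v
  ; unique = λ u w p q eu ew → other-end-unique v end (chain-sound p) (chain-sound q) (⊎-swap eu) (⊎-swap ew) }
  where open Chains ν invol b a

-- Regular families of involutions and exchanges on closed sets.

-- At each vertex the five colours are in bijection with the closed neighbourhood `R v`; the colour
-- that goes to `v` itself is the missing one.
record Regular5 {n : ℕ} (R : Fin n → Fin n → Set) (ν : Colouring n) : Set where
  field
    invol : ∀ c v → ν c (ν c v) ≡ v
    inject : ∀ {c d} v → ν c v ≡ ν d v → c ≡ d
    near : ∀ c v → R v (ν c v)
    full : ∀ {v u} → R v u → ∃[ c ] ν c v ≡ u
open Regular5 public

module _ {n : ℕ} {R : Fin n → Fin n → Set} where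

  -- An edge of colour `a` or `b` never crosses the border of `K`, and the other colours do not
  -- depend on the side. So both ends agree on the new colour of an edge, which keeps `flip`
  -- involutive.
  pick-along : ∀ a b (K : Fin n → Bool) {ν : Colouring n} → Closed a b K ν → ∀ c v →
               pick (K (ν (pick (K v) a b c) v)) a b c ≡ pick (K v) a b c
  pick-along a b K {ν} closed c v with among a b c
  ... | isₒ p q = trans (pick-other (K (ν (pick (K v) a b c) v)) p q) (≡-sym (pick-other (K v) p q))
  ... | isˡ = cong (λ k → pick k a b a) (aux (K v) refl)
    where
    aux : ∀ k → K v ≡ k → K (ν (pick k a b a) v) ≡ k
    aux true eq rewrite swap-l a b = trans (proj₂ (closed v)) eq
    aux false eq = trans (proj₁ (closed v)) eq
  ... | isʳ = cong (λ k → pick k a b b) (aux (K v) refl)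
    where
    aux : ∀ k → K v ≡ k → K (ν (pick k a b b) v) ≡ k
    aux true eq rewrite swap-r a b = trans (proj₁ (closed v)) eq
    aux false eq = trans (proj₂ (closed v)) eq

  flip-regular : ∀ a b K {ν : Colouring n} → Closed a b K ν → Regular5 R ν → Regular5 R (flip a b K ν)
  flip-regular a b K {ν} closed reg = record
    { invol = λ c v → trans (cong (λ d → ν d (ν (pick (K v) a b c) v)) (pick-along a b K closed c v)) (invol reg _ v)
    ; inject = λ {c} {d} v eq → trans (≡-sym (pick-pick (K v) a b c)) (trans (cong (pick (K v) a b) (inject reg v eq)) (pick-pick (K v) a b d))
    ; near = λ c v → near reg _ v
    ; full = λ {v} r → let c , eq = full reg r in
        pick (K v) a b c , trans (cong (λ d → ν d v) (pick-pick (K v) a b c)) eq }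

  regular-≗ : ∀ {ν ν' : Colouring n} → (∀ c v → ν' c v ≡ ν c v) → Regular5 R ν → Regular5 R ν'
  regular-≗ {ν} {ν'} eq reg = record
    { invol = λ c v → trans (eq c _) (trans (cong (ν c) (eq c v)) (invol reg c v))
    ; inject = λ {c} {d} v e → inject reg v (trans (≡-sym (eq c v)) (trans e (eq d v)))
    ; near = λ c v → subst (R v) (≡-sym (eq c v)) (near reg c v)
    ; full = λ {v} r → let c , e = full reg r in c , trans (eq c v) e }

  rename-regular : ∀ ρ {ν : Colouring n} → Regular5 R ν → Regular5 R (ν ∘ ren ρ)
  rename-regular ρ {ν} reg = record
    { invol = λ c v → invol reg (ren ρ c) v
    ; inject = λ v e → ren-injective ρ (inject reg v e)
    ; near = λ c v → near reg (ren ρ c) v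
    ; full = λ {v} r → let c , e = full reg r in unren ρ c , trans (cong (λ d → ν d v) (ren-unren ρ c)) e }

-- An upper bound rather than the exact set: if `a` or `b` may be missing somewhere, then after an
-- exchange of the two either of them may be.
widen : Color → Color → (Color → Bool) → Color → Bool
widen a b mis c = mis c ∨ ((⌊ c Fin.≟ a ⌋ ∨ ⌊ c Fin.≟ b ⌋) ∧ (mis a ∨ mis b))

Missing : ∀ {n} → (Color → Bool) → Colouring n → Set
Missing {n} mis ν = ∀ c (v : Fin n) → ν c v ≡ v → T (mis c)

T-∨ˡ : ∀ {x y} → T x → T (x ∨ y)
T-∨ˡ {true} _ = tt

T-∨ʳ : ∀ x {y} → T y → T (x ∨ y)
T-∨ʳ true _ = tt
T-∨ʳ false p = p

T-∧ : ∀ {x y} → T x → T y → T (x ∧ y)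
T-∧ {true} _ q = q

widen-pick : ∀ k a b mis c → T (mis (pick k a b c)) → T (widen a b mis c)
widen-pick false a b mis c p = T-∨ˡ p
widen-pick true a b mis c p with among a b c
... | isₒ q r rewrite swap-other a b c q r = T-∨ˡ p
... | isˡ rewrite swap-l a b = T-∨ʳ (mis a) (T-∧ {⌊ a Fin.≟ a ⌋ ∨ _} aux (T-∨ʳ (mis a) p))
  where
  aux : T (⌊ a Fin.≟ a ⌋ ∨ ⌊ a Fin.≟ b ⌋)
  aux with a Fin.≟ a
  ... | yes _ = tt
  ... | no a≢a = contradiction refl a≢a
... | isʳ rewrite swap-r a b = T-∨ʳ (mis b) (T-∧ {⌊ b Fin.≟ a ⌋ ∨ ⌊ b Fin.≟ b ⌋} aux (T-∨ˡ p))
  where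
  aux : T (⌊ b Fin.≟ a ⌋ ∨ ⌊ b Fin.≟ b ⌋)
  aux with b Fin.≟ b
  ... | yes _ = T-∨ʳ ⌊ b Fin.≟ a ⌋ tt
  ... | no b≢b = contradiction refl b≢b

flip-missing : ∀ {n} a b (K : Fin n → Bool) {ν : Colouring n} {mis} → Missing mis ν → Missing (widen a b mis) (flip a b K ν)
flip-missing a b K {mis = mis} miss c v eq = widen-pick (K v) a b mis c (miss _ v eq)

-- Agreement is pointwise, which spares function extensionality; `act` confines the step to the
-- classes that are not yet settled.
Step : ∀ {n} → (Color → Bool) → Colouring n → Colouring n → Set
Step {n} act ν ν' = Σ[ a ∈ Color ] Σ[ b ∈ Color ] Σ[ K ∈ (Fin n → Bool) ]
  (T (act a) × T (act b) × Closed a b K ν × (∀ c v → ν' c v ≡ flip a b K ν c v))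

flip-step : ∀ {n act a b} {K : Fin n → Bool} {ν : Colouring n} → T (act a) → T (act b) → Closed a b K ν → Step act ν (flip a b K ν)
flip-step {a = a} {b} {K} p q closed = a , b , K , p , q , closed , λ _ _ → refl

step-≗ : ∀ {n act} {ν ξ ν' : Colouring n} → (∀ c v → ξ c v ≡ ν c v) → Step act ν ν' → Step act ξ ν'
step-≗ {ξ = ξ} eq (a , b , K , p , q , closed , e) = a , b , K , p , q ,
  (λ v → trans (cong K (eq a v)) (proj₁ (closed v)) , trans (cong K (eq b v)) (proj₂ (closed v))) ,
  λ c v → trans (e c v) (≡-sym (eq _ v))

steps-≗ : ∀ {n act} {ν ξ ν' : Colouring n} → (∀ c v → ξ c v ≡ ν c v) → Star (Step act) ν ν' →
          ∃[ ξ' ] (Star (Step act) ξ ξ' × (∀ c v → ξ' c v ≡ ν' c v))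
steps-≗ {ξ = ξ} eq ε = ξ , ε , eq
steps-≗ {ν' = ν'} eq (s ◅ ss) = ν' , step-≗ eq s ◅ ss , λ _ _ → refl

module _ {n : ℕ} (ρ : Renaming) {act act' : Color → Bool} (lift : ∀ c → T (act c) → T (act' (ren ρ c))) where

  step-rename : ∀ {ν ν' : Colouring n} → Step act ν ν' → Step act' (ν ∘ unren ρ) (ν' ∘ unren ρ)
  step-rename {ν} {ν'} (a , b , K , p , q , closed , e) = ren ρ a , ren ρ b , K , lift a p , lift b q ,
    (λ v → trans (cong (λ c → K (ν c v)) (unren-ren ρ a)) (proj₁ (closed v)) ,
           trans (cong (λ c → K (ν c v)) (unren-ren ρ b)) (proj₂ (closed v))) ,
    λ c v → trans (e (unren ρ c) v) (cong (λ d → ν d v) (pick-rename (K v) c))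
    where
    pick-rename : ∀ k c → pick k a b (unren ρ c) ≡ unren ρ (pick k (ren ρ a) (ren ρ b) c)
    pick-rename false c = refl
    pick-rename true c = trans (≡-sym (unren-ren ρ _))
      (cong (unren ρ) (trans (swap-natural (ren ρ) (ren-injective ρ) a b (unren ρ c))
                              (cong (swap (ren ρ a) (ren ρ b)) (ren-unren ρ c))))

  steps-rename : ∀ {ν ν' : Colouring n} → Star (Step act) ν ν' → Star (Step act') (ν ∘ unren ρ) (ν' ∘ unren ρ)
  steps-rename ε = ε
  steps-rename (s ◅ ss) = step-rename s ◅ steps-rename ss

-- Local pictures, marked regions and certificates.

-- In `(i , c , j)` the vertex `j` is the neighbour of `i` along `c`; with `j` equal to `i` the fact
-- says that `i` misses `c`.
Fact : Set
Fact = ℕ × Color × ℕ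

Pairs : Set
Pairs = List (ℕ × ℕ)

-- A set of vertices closed under two colours, of which only some members and non-members are known. Among its
-- vertices missing one of the two colours, at most one is different from the tip.
record Region : Set where
  constructor region
  field
    hue₁ hue₂ : Color
    known : List (ℕ × Bool)
    tip : Maybe ℕ
open Region

record Pattern : Set where
  constructor mkPattern
  field
    size : ℕ
    facts : List Fact
    mates uglies : Pairs
    mis : Color → Bool
open Pattern

-- `moved` pairs each vertex whose colour-0 edge may have changed with its colour-0 neighbour at the
-- start of the play, so that the potential can be compared later.
record State : Set where
  constructor state
  field
    base : Pattern
    moved : Pairs
    zone : Maybe Region
open State

-- A certificate is a strategy in a game with partial information. Its moves are: look up the neighbour of a named
-- vertex (the branches: it is vertex size - 1, ..., 0; it is new and misses colour 0, ..., 4), mark the Kempe chain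
-- ending at a vertex, ask whether a vertex lies in the marked region, exchange colours on that region or on a set
-- of named vertices, exchange temporarily, and ask which neighbour M assigns to a vertex. Branches that contradict
-- known facts are closed automatically; skip stands for them.
data Cert : Set where
  skip win : Cert
  lem : ℕ → List ℕ → Renaming → Cert
  name : ℕ → Color → List Cert → List Cert → Cert
  trace : Color → Color → ℕ → Cert → Cert
  ask : ℕ → Cert → Cert → Cert
  swapZone : Cert → Cert
  exchange : Color → Color → List ℕ → Cert → Cert
  detour : List (Color × Color × List ℕ) → List (ℕ × Bool) → Cert → Cert
  mate : ℕ → List Cert → Cert

_∈ℕ?_ : (i : ℕ) (L : List ℕ) → Dec (i ∈ L)
_∈ℕ?_ = DecMem._∈?_ Nat._≟_

_∈²?_ : (p : ℕ × ℕ) (L : Pairs) → Dec (p ∈ L)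
_∈²?_ = DecMem._∈?_ (≡-dec Nat._≟_ Nat._≟_)

search : ∀ {A : Set} {P : A → Set} → (∀ x → Maybe (P x)) → (L : List A) → Maybe (∃[ x ] (x ∈ L × P x))
search P? [] = nothing
search P? (x ∷ L) = (P? x >>= λ p → just (x , here refl , p)) <∣>
                    (search P? L >>= λ { (y , y∈L , p) → just (y , there y∈L , p) })

traverse : ∀ {A : Set} {P : A → Set} → (∀ x → Maybe (P x)) → (L : List A) → Maybe (All P L)
traverse P? [] = just []
traverse P? (x ∷ L) = P? x >>= λ p → traverse P? L >>= λ ps → just (p ∷ ps)

find : (F : List Fact) (i : ℕ) (c : Color) → Maybe (∃[ j ] (i , c , j) ∈ F)
find [] i c = nothing
find ((i' , c' , j) ∷ F) i c with i Nat.≟ i' | c Fin.≟ c'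
... | yes refl | yes refl = just (j , here refl)
... | no _ | _ = find F i c >>= λ { (j , m) → just (j , there m) }
... | yes _ | no _ = find F i c >>= λ { (j , m) → just (j , there m) }

side : (B : List (ℕ × Bool)) (i : ℕ) → Maybe (∃[ b ] (i , b) ∈ B)
side [] i = nothing
side ((i' , b) ∷ B) i with i Nat.≟ i'
... | yes refl = just (b , here refl)
... | no _ = side B i >>= λ { (b , m) → just (b , there m) }

either : (c a b : Color) → Dec (c ≡ a ⊎ c ≡ b)
either c a b = (c Fin.≟ a) ⊎-dec (c Fin.≟ b)

nth : List ℕ → ℕ → ℕ
nth [] _ = 0
nth (x ∷ L) zero = x
nth (x ∷ L) (suc i) = nth L i

-- A fact in one of the exchanged colours is forgotten if the side of its vertex is unknown.
recolour : (ℕ → Maybe Bool) → Color → Color → List Fact → List Fact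
recolour mem a b [] = []
recolour mem a b ((i , c , j) ∷ F) with either c a b | mem i
... | no _ | _ = (i , c , j) ∷ recolour mem a b F
... | yes _ | nothing = recolour mem a b F
... | yes _ | just k = (i , pick k a b c , j) ∷ recolour mem a b F

open Region
open Pattern
open State

step-regular : ∀ {n} {R : Fin n → Fin n → Set} {act ν ν'} → Step act ν ν' → Regular5 R ν → Regular5 R ν'
step-regular (a , b , K , _ , _ , closed , e) reg = regular-≗ e (flip-regular a b K closed reg)

pick-act : ∀ k {act : Color → Bool} {a b} c → T (act a) → T (act b) → T (act (pick k a b c)) → T (act c)
pick-act k {act} {a} {b} c p q r with among a b c
... | isˡ = p
... | isʳ = q
... | isₒ ne ne' = subst (T ∘ act) (pick-other k ne ne') r

step-missing : ∀ {n act} {ν ν' : Colouring n} → Step act ν ν' → Missing act ν → Missing act ν'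
step-missing {act = act} (a , b , K , p , q , _ , e) miss c v eq = pick-act (K v) {act} {a} {b} c p q (miss _ v (trans (≡-sym (e c v)) eq))

step-fix : ∀ {n act} {ν ν' : Colouring n} → Step act ν ν' → ∀ c v → ¬ T (act c) → ν' c v ≡ ν c v
step-fix {ν = ν} (a , b , K , p , q , _ , e) c v ¬act =
  trans (e c v) (cong (λ d → ν d v) (pick-other (K v) (λ { refl → ¬act p }) (λ { refl → ¬act q })))

steps-regular : ∀ {n} {R : Fin n → Fin n → Set} {act ν ν'} → Star (Step act) ν ν' → Regular5 R ν → Regular5 R ν'
steps-regular ε reg = reg
steps-regular (s ◅ ss) reg = steps-regular ss (step-regular s reg)

steps-missing : ∀ {n act} {ν ν' : Colouring n} → Star (Step act) ν ν' → Missing act ν → Missing act ν'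
steps-missing ε miss = miss
steps-missing (s ◅ ss) miss = steps-missing ss (step-missing s miss)

steps-fix : ∀ {n act} {ν ν' : Colouring n} → Star (Step act) ν ν' → ∀ c v → ¬ T (act c) → ν' c v ≡ ν c v
steps-fix ε c v _ = refl
steps-fix (s ◅ ss) c v ¬act = trans (steps-fix ss c v ¬act) (step-fix s c v ¬act)

-- The potential, and the meaning of local pictures.

module Recolouring {n : ℕ} (R : Fin n → Fin n → Set) (R-refl : ∀ v → R v v)
  (M : Fin n → Fin n) (M-invol : ∀ v → M (M v) ≡ v) (M-free : ∀ v → M v ≢ v) (M-near : ∀ v → R v (M v)) where

  V : Set
  V = Fin n

  -- Φ is twice the size of the symmetric difference of M and a colour class.
  weight : V → V → ℕ
  weight v u with u Fin.≟ M v | u Fin.≟ v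
  ... | yes _ | _ = 0
  ... | no _ | yes _ = 1
  ... | no _ | no _ = 2

  weight-mate : ∀ v → weight v (M v) ≡ 0
  weight-mate v with M v Fin.≟ M v
  ... | yes _ = refl
  ... | no p = contradiction refl p

  weight-free : ∀ v → weight v v ≡ 1
  weight-free v with v Fin.≟ M v | v Fin.≟ v
  ... | yes p | _ = contradiction (≡-sym p) (M-free v)
  ... | no _ | yes _ = refl
  ... | no _ | no p = contradiction refl p

  weight-ugly : ∀ {v u} → M v ≢ u → u ≢ v → weight v u ≡ 2
  weight-ugly {v} {u} p q with u Fin.≟ M v | u Fin.≟ v
  ... | yes e | _ = contradiction (≡-sym e) p
  ... | no _ | yes e = contradiction e q
  ... | no _ | no _ = refl

  weight≤2 : ∀ v u → weight v u ≤ 2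
  weight≤2 v u with u Fin.≟ M v | u Fin.≟ v
  ... | yes _ | _ = z≤n
  ... | no _ | yes _ = s≤s z≤n
  ... | no _ | no _ = ℕₚ.≤-refl

  Φ : (V → V) → ℕ
  Φ φ = ∑ λ v → weight v (φ v)

  Φ-cong : ∀ {φ ψ} → φ ≗ ψ → Φ φ ≡ Φ ψ
  Φ-cong eq = ∑-cong λ v → cong (weight v) (eq v)

  record Win (act : Color → Bool) (o : Color) (ν : Colouring n) : Set where
    constructor wins
    field
      {result} : Colouring n
      reach : Star (Step act) ν result
      less : Φ (result o) < Φ (ν o)

  -- Strategies are stated for one fixed choice of colours; this carries their success back to the
  -- colours actually present.
  win-unrename : ∀ ρ {act act' : Color → Bool} → (∀ c → T (act c) → T (act' (ren ρ c))) → ∀ {ν} →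
                 Win act 0F (ν ∘ ren ρ) → Win act' (ren ρ 0F) ν
  win-unrename ρ lift {ν} (wins {ξ} reach less)
    with steps-≗ {ξ = ν} (λ c v → cong (λ d → ν d v) (≡-sym (ren-unren ρ c))) (steps-rename ρ lift reach)
  ... | ξ' , reach' , eq = wins reach' (subst (_< Φ (ν (ren ρ 0F)))
          (Φ-cong λ v → trans (cong (λ d → ξ d v) (≡-sym (unren-ren ρ 0F))) (≡-sym (eq (ren ρ 0F) v))) less)

  Holds : Colouring n → (ℕ → V) → Fact → Set
  Holds ν σ (i , c , j) = ν c (σ i) ≡ σ j

  Distinct : ℕ → (ℕ → V) → Set
  Distinct k σ = ∀ {i j} → i < k → j < k → σ i ≡ σ j → i ≡ j

  Mates Uglies : (ℕ → V) → ℕ × ℕ → Set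
  Mates σ (i , j) = M (σ i) ≡ σ j
  Uglies σ (i , j) = M (σ i) ≢ σ j

  record Matches (P : Pattern) (ν : Colouring n) (σ : ℕ → V) : Set where
    field
      regular : Regular5 R ν
      missing : Missing (mis P) ν
      distinct : Distinct (size P) σ
      holds : All (Holds ν σ) (facts P)
      mated : All (Mates σ) (mates P)
      unmated : All (Uglies σ) (uglies P)
  open Matches

  Tip : Color → Color → Colouring n → (ℕ → V) → (V → Bool) → Maybe ℕ → Set
  Tip a b ν σ K nothing = ⊤
  Tip a b ν σ K (just e) = ∀ u w → K u ≡ true → K w ≡ true →
    ν a u ≡ u ⊎ ν b u ≡ u → ν a w ≡ w ⊎ ν b w ≡ w → u ≢ σ e → w ≢ σ e → u ≡ w

  record Occupies (Z : Region) (ν : Colouring n) (σ : ℕ → V) : Set where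
    constructor occupies
    field
      member : V → Bool
      closed : Closed (hue₁ Z) (hue₂ Z) member ν
      sides : All (λ { (i , b) → member (σ i) ≡ b }) (known Z)
      unique : Tip (hue₁ Z) (hue₂ Z) ν σ member (tip Z)

  Zoned : Maybe Region → Colouring n → (ℕ → V) → Set
  Zoned nothing ν σ = ⊤
  Zoned (just Z) ν σ = Occupies Z ν σ

  -- The play started at ν₀; σ lists the vertices named so far.
  record Sem (act : Color → Bool) (s : State) (ν₀ : Colouring n) : Set where
    field
      {current} : Colouring n
      {σ} : ℕ → V
      matches : Matches (base s) current σ
      reached : Star (Step act) ν₀ current
      before : All (λ { (i , j) → ν₀ 0F (σ i) ≡ σ j }) (moved s)
      still : ∀ v → All (λ { (i , _) → σ i ≢ v }) (moved s) → current 0F v ≡ ν₀ 0F v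
      zoned : Zoned (zone s) current σ
  open Sem

  record Strategy : Set where
    field
      plan : Pattern
      act : Color → Bool
      winning : ∀ {ν σ} → Matches plan ν σ → Win act 0F ν
  open Strategy

  module _ {ν : Colouring n} (σ : ℕ → V) (a b : Color) (K : V → Bool) where

    recolour-holds : ∀ mem → (∀ {i k} → mem i ≡ just k → K (σ i) ≡ k) → ∀ {F} →
                     All (Holds ν σ) F → All (Holds (flip a b K ν) σ) (recolour mem a b F)
    recolour-holds mem sound {[]} [] = []
    recolour-holds mem sound {(i , c , j) ∷ F} (h ∷ hs) with either c a b | mem i in eq
    ... | no ¬p | _ = trans (cong (λ d → ν d (σ i)) (pick-other (K (σ i)) (¬p ∘ inj₁) (¬p ∘ inj₂))) h ∷ recolour-holds mem sound hs
    ... | yes _ | nothing = recolour-holds mem sound hs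
    ... | yes _ | just k = trans (cong (λ d → ν d (σ i)) (trans (cong (λ x → pick x a b (pick k a b c)) (sound eq)) (pick-pick k a b c))) h
                           ∷ recolour-holds mem sound hs

  sideOf : List (ℕ × Bool) → ℕ → Maybe Bool
  sideOf B i = side B i >>= λ p → just (proj₁ p)

  sideOf-sound : ∀ {K : V → Bool} {σ : ℕ → V} {B} → All (λ { (i , b) → K (σ i) ≡ b }) B → ∀ {i k} → sideOf B i ≡ just k → K (σ i) ≡ k
  sideOf-sound {B = B} all {i} eq with side B i
  sideOf-sound all refl | just (k , m) = All.lookup all m

  -- Indices from `k` on get no answer: only the names below `k` are known to denote distinct
  -- vertices, so such an index might denote a member of `L`.
  among? : ℕ → List ℕ → ℕ → Maybe Bool
  among? k L i with i ∈ℕ? L | i <? k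
  ... | yes _ | yes _ = just true
  ... | no _ | yes _ = just false
  ... | _ | no _ = nothing

  within : (σ : ℕ → V) → List ℕ → V → Bool
  within σ L v = ⌊ Any.any? (λ i → σ i Fin.≟ v) L ⌋

  within-yes : ∀ {σ L i} → i ∈ L → within σ L (σ i) ≡ true
  within-yes {σ} {L} {i} i∈L with Any.any? (λ j → σ j Fin.≟ σ i) L
  ... | yes _ = refl
  ... | no ¬p = contradiction (Any.map (λ { refl → refl }) i∈L) ¬p

  within-split : ∀ σ L v → (∃[ i ] (i ∈ L × σ i ≡ v)) ⊎ (within σ L v ≡ false × All (λ i → σ i ≢ v) L)
  within-split σ L v with Any.any? (λ i → σ i Fin.≟ v) L
  ... | no ¬p = inj₂ (refl , Allₚ.¬Any⇒All¬ L ¬p)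
  ... | yes p = inj₁ (aux p)
    where
    aux : ∀ {L} → Any (λ i → σ i ≡ v) L → ∃[ i ] (i ∈ L × σ i ≡ v)
    aux (here e) = _ , here refl , e
    aux (there p) = let i , m , e = aux p in i , there m , e

  among?-sound : ∀ {k σ L} → Distinct k σ → All (_< k) L → ∀ {i b} → among? k L i ≡ just b → within σ L (σ i) ≡ b
  among?-sound {k} {σ} {L} dist bound {i} eq with i ∈ℕ? L | i <? k
  among?-sound dist bound refl | yes m | yes _ = within-yes m
  among?-sound {k} {σ} {L} dist bound {i} refl | no ¬m | yes i<k with within-split σ L (σ i)
  ... | inj₂ (e , _) = e
  ... | inj₁ (j , j∈L , e) = contradiction (subst (_∈ L) (dist (All.lookup bound j∈L) i<k e) j∈L) ¬m

  -- One direction suffices, because an involution applied to the image leads back.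
  closed-from : ∀ {a b : Color} {K : V → Bool} {ν : Colouring n} → Regular5 R ν →
                (∀ v → K v ≡ true → K (ν a v) ≡ true × K (ν b v) ≡ true) → Closed a b K ν
  closed-from {a} {b} {K} {ν} reg f v = half a (λ u → proj₁ ∘ f u) , half b (λ u → proj₂ ∘ f u)
    where
    half : ∀ c → (∀ u → K u ≡ true → K (ν c u) ≡ true) → K (ν c v) ≡ K v
    half c g with K v in eq
    ... | true = g v eq
    ... | false with K (ν c v) in eq'
    ...   | false = refl
    ...   | true = trans (≡-sym (g _ eq')) (trans (cong K (invol reg c v)) eq)

  Shut : List Fact → Color → Color → List ℕ → Set
  Shut F a b L = All (λ i → (∃[ j ] ((i , a , j) ∈ F × j ∈ L)) × (∃[ j ] ((i , b , j) ∈ F × j ∈ L))) L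

  shut? : ∀ F a b L → Maybe (Shut F a b L)
  shut? F a b L = traverse (λ i → leads i a >>= λ p → leads i b >>= λ q → just (p , q)) L
    where
    leads : ∀ i c → Maybe (∃[ j ] ((i , c , j) ∈ F × j ∈ L))
    leads i c = find F i c >>= λ { (j , m) → dec⇒maybe (j ∈ℕ? L) >>= λ q → just (j , m , q) }

  shut-closed : ∀ {ν σ F a b L} → Regular5 R ν → All (Holds ν σ) F → Shut F a b L → Closed a b (within σ L) ν
  shut-closed {ν} {σ} {F} {a} {b} {L} reg hs shut = closed-from {K = within σ L} reg go
    where
    go : ∀ v → within σ L v ≡ true → within σ L (ν a v) ≡ true × within σ L (ν b v) ≡ true
    go v e with within-split σ L v
    ... | inj₂ (e' , _) = contradiction (trans (≡-sym e) e') λ ()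
    ... | inj₁ (i , m , refl) with All.lookup shut m
    ...   | (j , p , q) , (j' , p' , q') =
      trans (cong (within σ L) (All.lookup hs p)) (within-yes q) , trans (cong (within σ L) (All.lookup hs p')) (within-yes q')

  withFacts : Pattern → List Fact → (Color → Bool) → Pattern
  withFacts P F m = record P { facts = F ; mis = m }

  flip-matches : ∀ {P ν σ a b K} → Matches P ν σ → Closed a b K ν → ∀ mem → (∀ {i k} → mem i ≡ just k → K (σ i) ≡ k) →
                 Matches (withFacts P (recolour mem a b (facts P)) (widen a b (mis P))) (flip a b K ν) σ
  flip-matches {P} {ν} {σ} {a} {b} {K} m closed mem sound = record
    { regular = flip-regular a b K closed (regular m) ; missing = flip-missing a b K {mis = mis P} (missing m)
    ; distinct = distinct m ; holds = recolour-holds {ν} σ a b K mem sound (holds m)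
    ; mated = mated m ; unmated = unmated m }

  -- Soundness of the moves of the game.

  module Play (act : Color → Bool) (library : List Strategy) where

    Sound : State → Set
    Sound s = ∀ {ν₀} → Sem act s ν₀ → Win act 0F ν₀

    Absurd : State → Set
    Absurd s = ∀ {ν₀} → Sem act s ν₀ → ⊥

    acts? : ∀ a b → Maybe (T (act a) × T (act b))
    acts? a b = dec⇒maybe (T? (act a) ×-dec T? (act b))

    Clash : ℕ → Fact → Fact → Set
    Clash k (i , c , j) (i' , c' , j') = i ≡ i' × ((c ≡ c' × j ≢ j' × j < k × j' < k) ⊎ (j ≡ j' × c ≢ c'))

    clash? : ∀ k f g → Dec (Clash k f g)
    clash? k (i , c , j) (i' , c' , j') = (i Nat.≟ i') ×-dec
      (((c Fin.≟ c') ×-dec (¬? (j Nat.≟ j') ×-dec ((j <? k) ×-dec (j' <? k)))) ⊎-dec ((j Nat.≟ j') ×-dec ¬? (c Fin.≟ c')))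

    clash-absurd : ∀ {P ν σ f g} → Matches P ν σ → Holds ν σ f → Holds ν σ g → ¬ Clash (size P) f g
    clash-absurd m h h' (refl , inj₁ (refl , j≢j' , p , q)) = j≢j' (distinct m p q (trans (≡-sym h) h'))
    clash-absurd m h h' (refl , inj₂ (refl , c≢c')) = c≢c' (inject (regular m) _ (trans h (≡-sym h')))

    -- The first argument says how many leading facts are compared with all later ones; a naming
    -- prepends at most three facts.
    clashes : ℕ → ∀ k (F : List Fact) → Maybe (∃[ f ] ∃[ g ] (f ∈ F × g ∈ F × Clash k f g))
    clashes zero k F = nothing
    clashes (suc d) k [] = nothing
    clashes (suc d) k (f ∷ F) =
      (search (λ g → dec⇒maybe (clash? k f g)) F >>= λ { (g , m , p) → just (f , g , here refl , there m , p) }) <∣>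
      (clashes d k F >>= λ { (g , h , m , m' , p) → just (g , h , there m , there m' , p) })

    -- Only the most recent facts are compared with the others.
    factAbsurd : ∀ s → Maybe (Absurd s)
    factAbsurd s = clashes 3 (size (base s)) (facts (base s)) >>= λ { (f , g , m , m' , p) →
      just λ S → clash-absurd (matches S) (All.lookup (holds (matches S)) m) (All.lookup (holds (matches S)) m') p }

    -- Only the head of `mates` is examined. After a `mate` move this is the new pair seen from the
    -- chosen spouse, so a second partner for a vertex already matched is detected.
    mateAbsurd : ∀ s → Maybe (Absurd s)
    mateAbsurd s = clashing (mates (base s))
      where
      k = size (base s)
      clashing : (L : Pairs) → Maybe (Absurd s)
      clashing [] = nothing
      clashing ((i , j) ∷ _) = (search odd (mates (base s)) >>= λ { (q , m , p) → dec⇒maybe ((i , j) ∈²? mates (base s)) >>= λ m' →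
          just λ S → contra S (All.lookup (mated (matches S)) m') (All.lookup (mated (matches S)) m) p })
        where
        odd : (q : ℕ × ℕ) → Maybe (proj₁ q ≡ i × proj₂ q ≢ j × proj₂ q < k × j < k)
        odd (i' , j') = dec⇒maybe ((i' Nat.≟ i) ×-dec (¬? (j' Nat.≟ j) ×-dec ((j' <? k) ×-dec (j <? k))))
        contra : ∀ {ν₀} (S : Sem act s ν₀) {q} → M (σ S i) ≡ σ S j → M (σ S (proj₁ q)) ≡ σ S (proj₂ q) →
                 proj₁ q ≡ i × proj₂ q ≢ j × proj₂ q < k × j < k → ⊥
        contra S e e' (refl , j'≢j , p , p') = j'≢j (distinct (matches S) p p' (trans (≡-sym e') e))

    -- There are two ways to contradict a marked chain: an edge in its colours with just one end in
    -- it, and two further ends besides the tip, which a path cannot have.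
    zoneAbsurd : ∀ s → Maybe (Absurd s)
    zoneAbsurd s with zone s in zeq
    ... | nothing = nothing
    ... | just Z = crossing <∣> threeEnds (tip Z) refl
      where
      F = facts (base s)
      k = size (base s)
      B = known Z
      within' : ∀ {ν₀} → Sem act s ν₀ → Set
      within' S = Occupies Z (current S) (σ S)
      occ : ∀ {ν₀} (S : Sem act s ν₀) → within' S
      occ S = subst (λ z → Zoned z (current S) (σ S)) zeq (zoned S)
      crossing : Maybe (Absurd s)
      crossing = search cross F >>= λ { ((i , c , j) , m , h , (x , p) , (y , q) , x≢y) → just λ S →
        let open Occupies (occ S) in
        x≢y (trans (≡-sym (All.lookup sides p)) (trans (along S h) (trans (cong member (All.lookup (holds (matches S)) m)) (All.lookup sides q)))) }
        where
        cross : (f : Fact) → Maybe ((proj₁ (proj₂ f) ≡ hue₁ Z ⊎ proj₁ (proj₂ f) ≡ hue₂ Z) ×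
                  Σ[ x ∈ ∃[ x ] (proj₁ f , x) ∈ B ] Σ[ y ∈ ∃[ y ] (proj₂ (proj₂ f) , y) ∈ B ] (proj₁ x ≢ proj₁ y))
        cross (i , c , j) = dec⇒maybe (either c (hue₁ Z) (hue₂ Z)) >>= λ h → side B i >>= λ x → side B j >>= λ y →
          dec⇒maybe (¬? (proj₁ x Boolₚ.≟ proj₁ y)) >>= λ q → just (h , x , y , q)
        along : ∀ {ν₀} (S : Sem act s ν₀) {c} → c ≡ hue₁ Z ⊎ c ≡ hue₂ Z → ∀ {v} →
                Occupies.member (occ S) v ≡ Occupies.member (occ S) (current S c v)
        along S (inj₁ refl) {v} = ≡-sym (proj₁ (Occupies.closed (occ S) v))
        along S (inj₂ refl) {v} = ≡-sym (proj₂ (Occupies.closed (occ S) v))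
      EndAt : ℕ → List ℕ → Fact → Set
      EndAt e avoid (i , c , j) = i ≡ j × (c ≡ hue₁ Z ⊎ c ≡ hue₂ Z) × (i , true) ∈ B × i ≢ e × i ∉ avoid × i < k
      endAt? : ∀ e avoid f → Maybe (EndAt e avoid f)
      endAt? e avoid (i , c , j) = dec⇒maybe (i Nat.≟ j) >>= λ p → dec⇒maybe (either c (hue₁ Z) (hue₂ Z)) >>= λ h →
        dec⇒maybe (DecMem._∈?_ (≡-dec Nat._≟_ Boolₚ._≟_) (i , true) B) >>= λ m →
        dec⇒maybe (¬? (i Nat.≟ e) ×-dec (¬? (i ∈ℕ? avoid) ×-dec (i <? k))) >>= λ { (q , r , t) → just (p , h , m , q , r , t) }
      isEnd : ∀ {ν₀} (S : Sem act s ν₀) {i c} → c ≡ hue₁ Z ⊎ c ≡ hue₂ Z → current S c (σ S i) ≡ σ S i →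
              current S (hue₁ Z) (σ S i) ≡ σ S i ⊎ current S (hue₂ Z) (σ S i) ≡ σ S i
      isEnd S (inj₁ refl) e = inj₁ e
      isEnd S (inj₂ refl) e = inj₂ e
      threeEnds : (t : Maybe ℕ) → tip Z ≡ t → Maybe (Absurd s)
      threeEnds nothing _ = nothing
      threeEnds (just e) teq = search (endAt? e []) F >>= λ { ((i , c , .i) , m , (refl , h , p , i≢e , _ , i<k)) →
        search (endAt? e (i ∷ [])) F >>= λ { ((i' , c' , .i') , m' , (refl , h' , p' , i'≢e , i'∉ , i'<k)) →
        dec⇒maybe (e <? k) >>= λ e<k → just λ S →
          let open Occupies (occ S)
              hs = holds (matches S)
              dist = distinct (matches S)
              same = subst (Tip (hue₁ Z) (hue₂ Z) (current S) (σ S) member) teq unique (σ S i) (σ S i') (All.lookup sides p) (All.lookup sides p')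
                       (isEnd S h (All.lookup hs m)) (isEnd S h' (All.lookup hs m'))
                       (i≢e ∘ dist i<k e<k) (i'≢e ∘ dist i'<k e<k)
          in i'∉ (here (≡-sym (dist i<k i'<k same))) } }

    absurd : ∀ s → Maybe (Sound s)
    absurd s = (factAbsurd s <∣> (zoneAbsurd s <∣> mateAbsurd s)) >>= λ a → just λ S → ⊥-elim (a S)

    ugly? : ∀ s i j → Maybe (∀ {ν₀} (S : Sem act s ν₀) → M (σ S i) ≢ σ S j)
    ugly? s i j =
      (dec⇒maybe ((i , j) ∈²? uglies P) >>= λ m → just λ S → All.lookup (unmated (matches S)) m) <∣>
      ((dec⇒maybe ((j , i) ∈²? uglies P) >>= λ m → just λ S e → All.lookup (unmated (matches S)) m (turn e)) <∣>
      ((search (other i j) (mates P) >>= λ { ((.i , j') , m , (refl , q , l , l')) → just λ S e →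
          q (distinct (matches S) l l' (trans (≡-sym (All.lookup (mated (matches S)) m)) e)) }) <∣>
      (search (other j i) (mates P) >>= λ { ((.j , i') , m , (refl , q , l , l')) → just λ S e →
          q (distinct (matches S) l l' (trans (≡-sym (All.lookup (mated (matches S)) m)) (turn e))) })))
      where
      P = base s
      turn : ∀ {u v} → M u ≡ v → M v ≡ u
      turn {u} e = trans (cong M (≡-sym e)) (M-invol u)
      other : ∀ i j (q : ℕ × ℕ) → Maybe (proj₁ q ≡ i × proj₂ q ≢ j × proj₂ q < size P × j < size P)
      other i j (i' , j') = dec⇒maybe ((i' Nat.≟ i) ×-dec (¬? (j' Nat.≟ j) ×-dec ((j' <? size P) ×-dec (j <? size P))))

    upper : ∀ s i j → Σ[ u ∈ ℕ ] (∀ {ν₀} (S : Sem act s ν₀) → weight (σ S i) (σ S j) ≤ u)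
    upper s i j with i Nat.≟ j | (i , j) ∈²? mates (base s)
    ... | yes refl | _ = 1 , λ S → ℕₚ.≤-reflexive (weight-free (σ S i))
    ... | no _ | yes m = 0 , λ S → ℕₚ.≤-reflexive (trans (cong (weight (σ S i)) (≡-sym (All.lookup (mated (matches S)) m))) (weight-mate (σ S i)))
    ... | no _ | no _ = 2 , λ S → weight≤2 (σ S i) (σ S j)

    lower : ∀ s i j → Σ[ l ∈ ℕ ] (∀ {ν₀} (S : Sem act s ν₀) → l ≤ weight (σ S i) (σ S j))
    lower s i j with i Nat.≟ j | ugly? s i j | i <? size (base s) | j <? size (base s)
    ... | yes refl | _ | _ | _ = 1 , λ S → ℕₚ.≤-reflexive (≡-sym (weight-free (σ S i)))
    ... | no i≢j | just ugly | yes p | yes q = 2 , λ S →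
          ℕₚ.≤-reflexive (≡-sym (weight-ugly (ugly S) λ e → i≢j (distinct (matches S) p q (≡-sym e))))
    ... | no _ | _ | _ | _ = 0 , λ S → z≤n

    at : ∀ {s ν₀} (S : Sem act s ν₀) → Pairs → List V
    at S = map (σ S ∘ proj₁)

    -- The first number bounds the present contribution of the vertices in `O` to `Φ` from above,
    -- the second their original contribution from below. Comparing the two numbers then compares
    -- the potentials.
    Balance : State → Pairs → Set
    Balance s O = Σ[ ul ∈ ℕ × ℕ ] (∀ {ν₀} (S : Sem act s ν₀) → All (λ { (i , j) → ν₀ 0F (σ S i) ≡ σ S j }) O →
      total (map (λ v → weight v (current S 0F v)) (at S O)) ≤ proj₁ ul ×
      proj₂ ul ≤ total (map (λ v → weight v (ν₀ 0F v)) (at S O)))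

    balance : ∀ s O → Maybe (Balance s O)
    balance s [] = just ((0 , 0) , λ S _ → z≤n , z≤n)
    balance s ((i , j) ∷ O) = find (facts (base s)) i 0F >>= λ { (f , m) → balance s O >>= λ { ((u , l) , bal) →
      let u' , up = upper s i f
          l' , lo = lower s i j in
      just ((u' + u , l' + l) , λ { {ν₀} S (e ∷ es) →
        ℕₚ.+-mono-≤ (ℕₚ.≤-trans (ℕₚ.≤-reflexive (cong (weight (σ S i)) (All.lookup (holds (matches S)) m))) (up S)) (proj₁ (bal S es)) ,
        ℕₚ.+-mono-≤ (ℕₚ.≤-trans (lo S) (ℕₚ.≤-reflexive (cong (weight (σ S i)) (≡-sym e)))) (proj₂ (bal S es)) }) } }

    Keyed : State → Set
    Keyed s = AllPairs (λ p q → proj₁ p ≢ proj₁ q) (moved s) × All (λ p → proj₁ p < size (base s)) (moved s)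

    keyed? : ∀ s → Dec (Keyed s)
    keyed? s = AllPairs.allPairs? (λ p q → ¬? (proj₁ p Nat.≟ proj₁ q)) (moved s) ×-dec All.all? (λ p → proj₁ p <? size (base s)) (moved s)

    Φ-change : ∀ {s ν₀} (S : Sem act s ν₀) → Keyed s →
               Φ (current S 0F) + total (map (λ v → weight v (ν₀ 0F v)) (at S (moved s))) ≡
               Φ (ν₀ 0F) + total (map (λ v → weight v (current S 0F v)) (at S (moved s)))
    Φ-change {s} {ν₀} S (uniq , bound) = ∑-change (at S (moved s)) (AllPairsₚ.map⁺ (apart uniq bound)) λ v p →
      cong (weight v) (still S v (All.map (λ { {_ , _} q → q }) (Allₚ.map⁻ p)))
      where
      apart : ∀ {O} → AllPairs (λ p q → proj₁ p ≢ proj₁ q) O → All (λ p → proj₁ p < size (base s)) O →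
              AllPairs (λ p q → σ S (proj₁ p) ≢ σ S (proj₁ q)) O
      apart [] [] = []
      apart (p ∷ ps) (b ∷ bs) = All.zipWith (λ { (ne , l) e → ne (distinct (matches S) b l e) }) (p , bs) ∷ apart ps bs

    better : ∀ {s} → Keyed s → (bal : Balance s (moved s)) → proj₁ (proj₁ bal) < proj₂ (proj₁ bal) → Sound s
    better keyed (_ , bal) lt {ν₀} S = wins (reached S) (ℕₚ.+-cancelʳ-< _ _ _
      (ℕₚ.≤-<-trans (ℕₚ.≤-reflexive (Φ-change S keyed))
        (ℕₚ.+-monoʳ-< (Φ (ν₀ 0F)) (ℕₚ.≤-<-trans (proj₁ (bal S (before S))) (ℕₚ.<-≤-trans lt (proj₂ (bal S (before S))))))))

    no-worse : ∀ {s} → Keyed s → (bal : Balance s (moved s)) → proj₁ (proj₁ bal) ≤ proj₂ (proj₁ bal) →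
               ∀ {ν₀} (S : Sem act s ν₀) → Φ (current S 0F) ≤ Φ (ν₀ 0F)
    no-worse keyed (_ , bal) le {ν₀} S = ℕₚ.+-cancelʳ-≤ _ _ _
      (ℕₚ.≤-trans (ℕₚ.≤-reflexive (Φ-change S keyed))
        (ℕₚ.+-monoʳ-≤ (Φ (ν₀ 0F)) (ℕₚ.≤-trans (proj₁ (bal S (before S))) (ℕₚ.≤-trans le (proj₂ (bal S (before S)))))))

    learn : State → List Fact → State
    learn s fs = record s { base = record (base s) { facts = fs ++ facts (base s) } }

    learn-sem : ∀ {s ν₀} (S : Sem act s ν₀) {fs} → All (Holds (current S) (σ S)) fs → Sem act (learn s fs) ν₀
    learn-sem S hs = record
      { matches = record { regular = regular m ; missing = missing m ; distinct = distinct m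
                         ; holds = Allₚ.++⁺ hs (holds m) ; mated = mated m ; unmated = unmated m }
      ; reached = reached S ; before = before S ; still = still S ; zoned = zoned S }
      where m = matches S

    grow : State → List Fact → State
    grow s fs = record s { base = record (base s) { size = suc (size (base s)) ; facts = fs ++ facts (base s) } }

    InRange : ℕ → ℕ × ℕ → Set
    InRange k (i , j) = i < k × j < k

    TipBounded : ℕ → Maybe ℕ → Set
    TipBounded k nothing = ⊤
    TipBounded k (just e) = e < k

    ZoneBounded : ℕ → Maybe Region → Set
    ZoneBounded k nothing = ⊤
    ZoneBounded k (just Z) = All (λ { (i , _) → i < k }) (known Z) × TipBounded k (tip Z)

    -- A new vertex gets the index `k`, which overwrites `σ` there; what is already recorded keeps
    -- its meaning because it mentions smaller indices only.
    Bounded : State → Set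
    Bounded s = All (λ { (i , _ , j) → InRange k (i , j) }) (facts (base s)) × All (InRange k) (mates (base s)) ×
                All (InRange k) (uglies (base s)) × All (InRange k) (moved s) × ZoneBounded k (zone s)
      where k = size (base s)

    inRange? : ∀ k p → Dec (InRange k p)
    inRange? k (i , j) = (i <? k) ×-dec (j <? k)

    tipBounded? : ∀ k t → Dec (TipBounded k t)
    tipBounded? k nothing = yes tt
    tipBounded? k (just e) = e <? k

    zoneBounded? : ∀ k z → Dec (ZoneBounded k z)
    zoneBounded? k nothing = yes tt
    zoneBounded? k (just Z) = All.all? (λ { (i , _) → i <? k }) (known Z) ×-dec tipBounded? k (tip Z)

    bounded? : ∀ s → Dec (Bounded s)
    bounded? s = All.all? (λ { (i , _ , j) → inRange? k (i , j) }) (facts (base s)) ×-dec (All.all? (inRange? k) (mates (base s)) ×-dec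
                 (All.all? (inRange? k) (uglies (base s)) ×-dec (All.all? (inRange? k) (moved s) ×-dec zoneBounded? k (zone s))))
      where k = size (base s)

    extend : ℕ → (ℕ → V) → V → ℕ → V
    extend k σ u i with i Nat.≟ k
    ... | yes _ = u
    ... | no _ = σ i

    extend-new : ∀ k σ u → extend k σ u k ≡ u
    extend-new k σ u with k Nat.≟ k
    ... | yes _ = refl
    ... | no p = contradiction refl p

    extend-old : ∀ {k σ u i} → i < k → extend k σ u i ≡ σ i
    extend-old {k} {i = i} i<k with i Nat.≟ k
    ... | yes refl = contradiction i<k (ℕₚ.n≮n k)
    ... | no _ = refl

    grow-sem : ∀ {s ν₀} (S : Sem act s ν₀) → Bounded s → ∀ u → (∀ j → j < size (base s) → σ S j ≢ u) → ∀ {fs} →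
               All (Holds (current S) (extend (size (base s)) (σ S) u)) fs → Sem act (grow s fs) ν₀
    grow-sem {s} {ν₀} S (bf , bm , bu , bo , bz) u fresh hs = record
      { σ = σ'
      ; matches = record
        { regular = regular m ; missing = missing m ; distinct = distinct'
        ; holds = Allₚ.++⁺ hs (All.zipWith (λ { ((p , q) , h) → trans (cong (current S _) (old p)) (trans h (≡-sym (old q))) }) (bf , holds m))
        ; mated = All.zipWith (λ { ((p , q) , h) → trans (cong M (old p)) (trans h (≡-sym (old q))) }) (bm , mated m)
        ; unmated = All.zipWith (λ { ((p , q) , h) e → h (trans (≡-sym (cong M (old p))) (trans e (old q))) }) (bu , unmated m) }
      ; reached = reached S
      ; before = All.zipWith (λ { ((p , q) , h) → trans (cong (ν₀ 0F) (old p)) (trans h (≡-sym (old q))) }) (bo , before S)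
      ; still = λ v p → still S v (All.zipWith (λ { ((l , _) , ne) e → ne (trans (old l) e) }) (bo , p))
      ; zoned = zoned' (zone s) bz (zoned S) }
      where
      m = matches S
      k = size (base s)
      σ' = extend k (σ S) u
      old : ∀ {i} → i < k → σ' i ≡ σ S i
      old = extend-old
      distinct' : Distinct (suc k) σ'
      distinct' {i} {j} p q e with ℕₚ.m≤n⇒m<n∨m≡n (ℕₚ.≤-pred p) | ℕₚ.m≤n⇒m<n∨m≡n (ℕₚ.≤-pred q)
      ... | inj₁ p' | inj₁ q' = distinct m p' q' (trans (≡-sym (old p')) (trans e (old q')))
      ... | inj₁ p' | inj₂ refl = contradiction (trans (≡-sym (old p')) (trans e (extend-new k (σ S) u))) (fresh i p')
      ... | inj₂ refl | inj₁ q' = contradiction (trans (≡-sym (old q')) (trans (≡-sym e) (extend-new k (σ S) u))) (fresh j q')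
      ... | inj₂ refl | inj₂ refl = refl
      zoned' : ∀ z → ZoneBounded k z → Zoned z (current S) (σ S) → Zoned z (current S) σ'
      zoned' nothing _ _ = tt
      zoned' (just record { tip = nothing }) (bB , _) (occupies K cl sd un) =
        occupies K cl (All.zipWith (λ { (p , h) → trans (cong K (old p)) h }) (bB , sd)) tt
      zoned' (just record { tip = just e }) (bB , be) (occupies K cl sd un) =
        occupies K cl (All.zipWith (λ { (p , h) → trans (cong K (old p)) h }) (bB , sd))
          λ u w p q eu ew u≢ w≢ → un u w p q eu ew (λ x → u≢ (trans x (≡-sym (old be)))) (λ x → w≢ (trans x (≡-sym (old be))))

    Olds : State → ℕ → Color → ℕ → Set
    Olds s i c m = ∀ j → j < m → Sound (learn s ((i , c , j) ∷ (j , c , i) ∷ []))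

    News : State → ℕ → Color → Color → Set
    News s i c m = Sound (grow s ((i , c , k) ∷ (k , c , i) ∷ (k , m , k) ∷ []))
      where k = size (base s)

    colors : List Color
    colors = 0F ∷ 1F ∷ 2F ∷ 3F ∷ 4F ∷ []

    color∈ : ∀ (c : Color) → c ∈ colors
    color∈ 0F = here refl
    color∈ 1F = there (here refl)
    color∈ 2F = there (there (here refl))
    color∈ 3F = there (there (there (here refl)))
    color∈ 4F = there (there (there (there (here refl))))

    Possible : State → Color → Set
    Possible s c = T (mis (base s) c)

    name-sound : ∀ {s i c} → i < size (base s) → Bounded s → Olds s i c (size (base s)) →
                 All (λ m → Possible s m → News s i c m) colors → Sound s
    name-sound {s} {i} {c} i<k bd olds news S with ℕₚ.anyUpTo? (λ j → σ S j Fin.≟ current S c (σ S i)) (size (base s))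
    ... | yes (j , j<k , e) = olds j j<k (learn-sem S (≡-sym e ∷ trans (cong (current S c) e) (invol (regular (matches S)) c _) ∷ []))
    ... | no none = let d , e = full (regular m) (R-refl u) in
        All.lookup news (color∈ d) (missing m d u e) (grow-sem S bd u (λ j p q → none (j , p , q))
          ( trans (cong (current S c) (extend-old i<k)) (≡-sym (extend-new k (σ S) u))
          ∷ trans (cong (current S c) (extend-new k (σ S) u)) (trans (invol (regular m) c _) (≡-sym (extend-old i<k)))
          ∷ trans (cong (current S d) (extend-new k (σ S) u)) (trans e (≡-sym (extend-new k (σ S) u))) ∷ []))
      where
      m = matches S
      k = size (base s)
      u = current S c (σ S i)

    mark : State → Maybe Region → State
    mark s z = record s { zone = z }

    mark-sem : ∀ {s ν₀ z} (S : Sem act s ν₀) → Zoned z (current S) (σ S) → Sem act (mark s z) ν₀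
    mark-sem S z = record { matches = matches S ; reached = reached S ; before = before S ; still = still S ; zoned = z }

    trace-sound : ∀ {s a b e} → (e , a , e) ∈ facts (base s) ⊎ (e , b , e) ∈ facts (base s) →
                   Sound (mark s (just (region a b ((e , true) ∷ []) (just e)))) → Sound s
    trace-sound {s} {a} {b} {e} end next S = next (mark-sem S (occupies C.member C.closed (C.start ∷ []) C.unique))
      where
      hs = holds (matches S)
      module C = Component (component (current S) (invol (regular (matches S))) a b (σ S e)
                   ([ (λ p → inj₁ (All.lookup hs p)) , (λ p → inj₂ (All.lookup hs p)) ]′ end))

    ask-sound : ∀ {s i Z} → zone s ≡ just Z → Sound (mark s (just (record Z { known = (i , true) ∷ known Z }))) →
                Sound (mark s (just (record Z { known = (i , false) ∷ known Z }))) → Sound s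
    ask-sound {s} {i} {Z} eq yes' no' S with subst (λ z → Zoned z (current S) (σ S)) eq (zoned S)
    ... | occupies K cl sd un with K (σ S i) in e
    ...   | true = yes' (mark-sem S (occupies K cl (e ∷ sd) un))
    ...   | false = no' (mark-sem S (occupies K cl (e ∷ sd) un))

    flipZone : State → Region → State
    flipZone s Z = record s { base = withFacts (base s) (recolour (sideOf (known Z)) (hue₁ Z) (hue₂ Z) (facts (base s)))
                                              (widen (hue₁ Z) (hue₂ Z) (mis (base s))) ; zone = nothing }

    -- The extent of the region is unknown, so neither hue may be 0: all colour-0 edges stay, and
    -- nothing has to be added to `moved`.
    swapZone-sound : ∀ {s Z} → zone s ≡ just Z → T (act (hue₁ Z)) × T (act (hue₂ Z)) → hue₁ Z ≢ 0F → hue₂ Z ≢ 0F →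
                     Sound (flipZone s Z) → Sound s
    swapZone-sound {s} {Z} eq (p , q) a≢0 b≢0 next S with subst (λ z → Zoned z (current S) (σ S)) eq (zoned S)
    ... | occupies K cl sd un = next record
      { matches = flip-matches (matches S) cl (sideOf (known Z)) (sideOf-sound {K} sd)
      ; reached = reached S ◅◅ (flip-step p q cl ◅ ε) ; before = before S
      ; still = λ v r → trans (cong (λ c → current S c v) (pick-other (K v) (a≢0 ∘ ≡-sym) (b≢0 ∘ ≡-sym))) (still S v r)
      ; zoned = tt }

    keyOf : Pairs → List ℕ
    keyOf = map proj₁

    Source : State → ℕ × ℕ → Set
    Source s (i , j) = (i , 0F , j) ∈ facts (base s) × i ∉ keyOf (moved s) × i < size (base s)

    -- A vertex outside `moved` has kept its colour-0 neighbour since the start, so its present fact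
    -- tells the original neighbour. It has to be noted before an exchange that involves 0 destroys
    -- it.
    record Recorded (s : State) (L : List ℕ) : Set where
      field
        fresh : Pairs
        sourced : All (Source s) fresh
        covered : All (λ i → i ∈ keyOf (fresh ++ moved s)) L
        rangeO : All (λ p → proj₁ p < size (base s)) (moved s)

    sources : ∀ s → List ℕ → Maybe (Σ[ O ∈ Pairs ] All (Source s) O)
    sources s [] = just ([] , [])
    sources s (i ∷ L) with i ∈ℕ? keyOf (moved s)
    ... | yes _ = sources s L
    ... | no p = sources s L >>= λ { (O , src) → find (facts (base s)) i 0F >>= λ { (j , m) →
      dec⇒maybe (i <? size (base s)) >>= λ l → just ((i , j) ∷ O , _∷_ {P = Source s} (m , p , l) src) } }

    note : ∀ s L → Maybe (Recorded s L)
    note s L = sources s L >>= λ { (O , src) →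
      traverse (λ i → dec⇒maybe (i ∈ℕ? keyOf (O ++ moved s))) L >>= λ cov →
      dec⇒maybe (All.all? (λ p → proj₁ p <? size (base s)) (moved s)) >>= λ r →
      just (record { fresh = O ; sourced = src ; covered = cov ; rangeO = r }) }

    recorded-before : ∀ {s L ν₀} (S : Sem act s ν₀) (r : Recorded s L) →
                      All (λ { (i , j) → ν₀ 0F (σ S i) ≡ σ S j }) (Recorded.fresh r ++ moved s)
    recorded-before {s} {L} {ν₀} S r = Allₚ.++⁺ (All.map old (Recorded.sourced r)) (before S)
      where
      old : ∀ {p} → Source s p →
            ν₀ 0F (σ S (proj₁ p)) ≡ σ S (proj₂ p)
      old {i , j} (m , i∉ , l) = trans (≡-sym (still S (σ S i) (apart (moved s) (Recorded.rangeO r) i∉))) (All.lookup (holds (matches S)) m)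
        where
        apart : ∀ O → All (λ p → proj₁ p < size (base s)) O → i ∉ keyOf O → All (λ { (i' , _) → σ S i' ≢ σ S i }) O
        apart [] [] _ = []
        apart ((i' , _) ∷ O) (b ∷ bs) i∉ = (λ e → i∉ (here (≡-sym (distinct (matches S) b l e)))) ∷ apart O bs (i∉ ∘ there)

    recorded-avoid : ∀ {s L} (σ : ℕ → V) (r : Recorded s L) {v} → All (λ { (i , _) → σ i ≢ v }) (Recorded.fresh r ++ moved s) →
                     All (λ i → σ i ≢ v) L × All (λ { (i , _) → σ i ≢ v }) (moved s)
    recorded-avoid {s} σ r {v} p = All.map (λ m → All.lookup (keys _ p) m) (Recorded.covered r) , Allₚ.++⁻ʳ (Recorded.fresh r) p
      where
      keys : ∀ O → All (λ { (i , _) → σ i ≢ v }) O → All (λ i → σ i ≢ v) (keyOf O)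
      keys [] [] = []
      keys (_ ∷ O) (q ∷ qs) = q ∷ keys O qs

    -- The region stays closed at `i` along `c` if the exchange does not affect `c`, or if the edge
    -- that receives colour `c` joins two vertices known to lie on the same side.
    Fine : State → Color → Color → Region → ℕ → Color → Set
    Fine s a b Z i c = (c ≢ a × c ≢ b) ⊎
      (∃[ x ] ((i , x) ∈ known Z × ∃[ j ] ((i , swap a b c , j) ∈ facts (base s) × (j , x) ∈ known Z)))

    Survives : State → Color → Color → List ℕ → Region → Set
    Survives s a b L Z = All (λ i → Fine s a b Z i (hue₁ Z) × Fine s a b Z i (hue₂ Z)) L

    survives? : ∀ s a b L Z → Maybe (Survives s a b L Z)
    survives? s a b L Z = traverse (λ i → fine? i (hue₁ Z) >>= λ p → fine? i (hue₂ Z) >>= λ q → just (p , q)) L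
      where
      fine? : ∀ i c → Maybe (Fine s a b Z i c)
      fine? i c = (dec⇒maybe (¬? (c Fin.≟ a) ×-dec ¬? (c Fin.≟ b)) >>= λ p → just (inj₁ p)) <∣>
        (side (known Z) i >>= λ { (x , m) → find (facts (base s)) i (swap a b c) >>= λ { (j , f) →
         dec⇒maybe (DecMem._∈?_ (≡-dec Nat._≟_ Boolₚ._≟_) (j , x) (known Z)) >>= λ m' → just (inj₂ (x , m , j , f , m')) } })

    Disjoint : Region → Color → Color → Set
    Disjoint Z a b = (hue₁ Z ≢ a × hue₁ Z ≢ b) × (hue₂ Z ≢ a × hue₂ Z ≢ b)

    disjoint? : ∀ Z a b → Dec (Disjoint Z a b)
    disjoint? Z a b = (¬? (hue₁ Z Fin.≟ a) ×-dec ¬? (hue₁ Z Fin.≟ b)) ×-dec (¬? (hue₂ Z Fin.≟ a) ×-dec ¬? (hue₂ Z Fin.≟ b))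

    Carry : State → Color → Color → List ℕ → Maybe Region → Set
    Carry s a b L z = ∀ {ν₀} (S : Sem act s ν₀) → Zoned z (flip a b (within (σ S) L) (current S)) (σ S)

    -- If the exchanged colours differ from both hues, the region persists with its tip. Otherwise
    -- it may still be closed, but it need no longer be a single path, so the knowledge about its
    -- ends is given up.
    carry : ∀ s a b L → Σ[ z ∈ Maybe Region ] Carry s a b L z
    carry s a b L with zone s in eq
    ... | nothing = nothing , λ _ → tt
    ... | just Z with disjoint? Z a b | survives? s a b L Z
    ...   | yes ((p , q) , (p' , q')) | _ = just Z , kept
      where
      kept : Carry s a b L (just Z)
      kept S with subst (λ z → Zoned z (current S) (σ S)) eq (zoned S)
      ... | occupies K cl sd un = occupies K (λ v → trans (cong K (h₁ v)) (proj₁ (cl v)) , trans (cong K (h₂ v)) (proj₂ (cl v))) sd (keepTip (tip Z) un)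
        where
        W = within (σ S) L
        h₁ : ∀ v → flip a b W (current S) (hue₁ Z) v ≡ current S (hue₁ Z) v
        h₁ v = cong (λ c → current S c v) (pick-other (W v) p q)
        h₂ : ∀ v → flip a b W (current S) (hue₂ Z) v ≡ current S (hue₂ Z) v
        h₂ v = cong (λ c → current S c v) (pick-other (W v) p' q')
        back : ∀ {u} → flip a b W (current S) (hue₁ Z) u ≡ u ⊎ flip a b W (current S) (hue₂ Z) u ≡ u →
               current S (hue₁ Z) u ≡ u ⊎ current S (hue₂ Z) u ≡ u
        back {u} = Data.Sum.map (trans (≡-sym (h₁ u))) (trans (≡-sym (h₂ u)))
        keepTip : ∀ t → Tip (hue₁ Z) (hue₂ Z) (current S) (σ S) K t → Tip (hue₁ Z) (hue₂ Z) (flip a b W (current S)) (σ S) K t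
        keepTip nothing _ = tt
        keepTip (just e) un u w p q eu ew = un u w p q (back eu) (back ew)
    ...   | no _ | nothing = nothing , λ _ → tt
    ...   | no _ | just fine = just (record Z { tip = nothing }) , kept
      where
      kept : Carry s a b L (just (record Z { tip = nothing }))
      kept S with subst (λ z → Zoned z (current S) (σ S)) eq (zoned S)
      ... | occupies K cl sd un = occupies K (λ v → along v (proj₁ (cl v)) proj₁ , along v (proj₂ (cl v)) proj₂) sd tt
        where
        W = within (σ S) L
        along : ∀ v {c} → K (current S c v) ≡ K v → (∀ {i} → Fine s a b Z i (hue₁ Z) × Fine s a b Z i (hue₂ Z) → Fine s a b Z i c) →
                K (flip a b W (current S) c v) ≡ K v
        along v {c} e sel with within-split (σ S) L v
        ... | inj₂ (out , _) = trans (cong (λ w → K (current S (pick w a b c) v)) out) e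
        ... | inj₁ (i , m , refl) with sel (All.lookup fine m)
        ...   | inj₁ (p , q) = trans (cong (λ d → K (current S d v)) (pick-other (W v) p q)) e
        ...   | inj₂ (x , m₁ , j , f , m₂) = trans (cong (λ w → K (current S (pick w a b c) v)) (within-yes {σ S} m))
                  (trans (cong K (All.lookup (holds (matches S)) f)) (trans (All.lookup sd m₂) (≡-sym (All.lookup sd m₁))))

    exchanged : State → Color → Color → List ℕ → Pairs → State
    exchanged s a b L O = record
      { base = withFacts (base s) (recolour (among? (size (base s)) L) a b (facts (base s))) (widen a b (mis (base s)))
      ; moved = O ; zone = proj₁ (carry s a b L) }

    module _ {s : State} {a b : Color} {L : List ℕ} (ok : T (act a) × T (act b)) (shut : Shut (facts (base s)) a b L)
             (bound : All (_< size (base s)) L) where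

      module _ {ν₀} (S : Sem act s ν₀) where

        exchange-closed : Closed a b (within (σ S) L) (current S)
        exchange-closed = shut-closed (regular (matches S)) (holds (matches S)) shut

        exchange-sem : ∀ {O} → All (λ { (i , j) → ν₀ 0F (σ S i) ≡ σ S j }) O →
                       (∀ v → All (λ { (i , _) → σ S i ≢ v }) O → flip a b (within (σ S) L) (current S) 0F v ≡ ν₀ 0F v) →
                       Sem act (exchanged s a b L O) ν₀
        exchange-sem bef st = record
          { matches = flip-matches (matches S) exchange-closed (among? (size (base s)) L) (among?-sound (distinct (matches S)) bound)
          ; reached = reached S ◅◅ (flip-step (proj₁ ok) (proj₂ ok) exchange-closed ◅ ε)
          ; before = bef ; still = st ; zoned = proj₂ (carry s a b L) S }

      exchange-quiet : 0F ≢ a → 0F ≢ b → Sound (exchanged s a b L (moved s)) → Sound s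
      exchange-quiet p q next S = next (exchange-sem S (before S) λ v r →
        trans (cong (λ c → current S c v) (pick-other (within (σ S) L v) p q)) (still S v r))

      exchange-noted : (r : Recorded s L) → Sound (exchanged s a b L (Recorded.fresh r ++ moved s)) → Sound s
      exchange-noted r next S = next (exchange-sem S (recorded-before S r) λ v av →
        let avL , avO = recorded-avoid (σ S) r av in
        case within-split (σ S) L v of λ where
          (inj₁ (i , m , e)) → contradiction e (All.lookup avL m)
          (inj₂ (out , _)) → trans (cong (λ w → current S (pick w a b 0F) v) out) (still S v avO))

    marry : State → ℕ → ℕ → State
    marry s i j = record s { base = record (base s) { mates = (j , i) ∷ (i , j) ∷ mates (base s) } }

    Marriage : State → ℕ → Color → Set
    Marriage s i c = ∃[ j ] ((i , c , j) ∈ facts (base s) × (j ≡ i ⊎ Sound (marry s i j)))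

    -- An edge of `M` has some colour, so the mate is one of the five neighbours recorded at `i`;
    -- the one that is `i` itself is excluded since `M` has no fixed points.
    mate-sound : ∀ {s i} → All (Marriage s i) colors → Sound s
    mate-sound {s} {i} branches S with full (regular (matches S)) (M-near (σ S i))
    ... | c , e with All.lookup branches (color∈ c)
    ...   | j , m , inj₁ refl = contradiction (trans (≡-sym e) (All.lookup (holds (matches S)) m)) (M-free (σ S i))
    ...   | j , m , inj₂ next = next record
      { matches = record { regular = regular k ; missing = missing k ; distinct = distinct k ; holds = holds k
                         ; mated = trans (cong M (≡-sym wed)) (M-invol _) ∷ wed ∷ mated k ; unmated = unmated k }
      ; reached = reached S ; before = before S ; still = still S ; zoned = zoned S }
      where
      k = matches S
      wed : M (σ S i) ≡ σ S j
      wed = trans (≡-sym e) (All.lookup (holds k) m)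

    record Embeds (P : Pattern) (s : State) (e : ℕ → ℕ) (ρ : Renaming) : Set where
      field
        possible : ∀ c → T (mis (base s) (ren ρ c)) → T (mis P c)
        inside : ∀ {i} → i < size P → e i < size (base s)
        injective : ∀ {i} → i < size P → ∀ {j} → j < size P → e i ≡ e j → i ≡ j
        factual : All (λ { (i , c , j) → (e i , ren ρ c , e j) ∈ facts (base s) }) (facts P)
        mating : All (λ { (i , j) → (e i , e j) ∈ mates (base s) }) (mates P)
        unmating : All (λ { (i , j) → ∀ {ν₀} (S : Sem act s ν₀) → M (σ S (e i)) ≢ σ S (e j) }) (uglies P)

    embeds? : ∀ P s e ρ → Maybe (Embeds P s e ρ)
    embeds? P s e ρ =
      dec⇒maybe (Finₚ.all? λ c → T? (mis (base s) (ren ρ c)) →-dec T? (mis P c)) >>= λ p →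
      dec⇒maybe (ℕₚ.allUpTo? (λ i → e i <? size (base s)) (size P)) >>= λ q →
      dec⇒maybe (ℕₚ.allUpTo? (λ i → ℕₚ.allUpTo? (λ j → (e i Nat.≟ e j) →-dec (i Nat.≟ j)) (size P)) (size P)) >>= λ r →
      traverse fact? (facts P) >>= λ f → traverse (λ { (i , j) → dec⇒maybe ((e i , e j) ∈²? mates (base s)) }) (mates P) >>= λ m →
      traverse (λ { (i , j) → ugly? s (e i) (e j) }) (uglies P) >>= λ u →
      just (record { possible = p ; inside = q ; injective = r ; factual = f ; mating = m ; unmating = u })
      where
      fact? : (f : Fact) → Maybe ((e (proj₁ f) , ren ρ (proj₁ (proj₂ f)) , e (proj₂ (proj₂ f))) ∈ facts (base s))
      fact? (i , c , j) = find (facts (base s)) (e i) (ren ρ c) >>= λ { (j' , m) → dec⇒maybe (j' Nat.≟ e j) >>= λ { refl → just m } }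

    -- `A` lowers the potential below its present value, which must therefore not exceed the
    -- original one; hence the condition on the balance. The renaming fixes 0 because `Φ` belongs to
    -- that colour.
    lemma-sound : ∀ {s} (A : Strategy) e ρ → ren ρ 0F ≡ 0F → (∀ c → T (Strategy.act A c) → T (act (ren ρ c))) →
                  Embeds (plan A) s e ρ → Keyed s → (bal : Balance s (moved s)) → proj₁ (proj₁ bal) ≤ proj₂ (proj₁ bal) → Sound s
    lemma-sound {s} A e ρ zero↦zero lift emb keyed bal le {ν₀} S
      with subst (λ o → Win act o (current S)) zero↦zero (win-unrename ρ lift (winning A embedded))
      where
      open Embeds emb
      m = matches S
      embedded : Matches (plan A) (current S ∘ ren ρ) (σ S ∘ e)
      embedded = record
        { regular = rename-regular ρ (regular m)
        ; missing = λ c v p → possible c (missing m (ren ρ c) v p)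
        ; distinct = λ p q x → injective p q (distinct m (inside p) (inside q) x)
        ; holds = All.map (λ p → All.lookup (holds m) p) factual
        ; mated = All.map (λ p → All.lookup (mated m) p) mating
        ; unmated = All.map (λ p → p S) unmating }
    ... | wins reach less = wins (reached S ◅◅ reach) (ℕₚ.<-≤-trans less (no-worse keyed bal le S))

    -- Detours: a temporary exchange of 0 and b on the marked region, a few exchanges on named vertices,
    -- and the exchange of 0 and b undone.

    Cells : Set
    Cells = List (ℕ × Color)

    Clear : (ℕ → V) → Cells → Color → V → Set
    Clear σ tc c v = All (λ { (i , d) → ¬ (σ i ≡ v × d ≡ c) }) tc

    -- `tc` lists the entries `(i , c)` that may have been altered since the temporary exchange;
    -- `ν₁` is the colouring right after it.
    record Away (ν₁ : Colouring n) (σ : ℕ → V) (F : List Fact) (m : Color → Bool) (tc : Cells) : Set where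
      field
        {now} : Colouring n
        path : Star (Step act) ν₁ now
        isRegular : Regular5 R now
        isMissing : Missing m now
        hold : All (Holds now σ) F
        untouched : ∀ c v → Clear σ tc c v → now c v ≡ ν₁ c v
    open Away

    cells : Color → Color → List ℕ → Cells
    cells a b [] = []
    cells a b (i ∷ L) = (i , a) ∷ (i , b) ∷ cells a b L

    cells-clear : ∀ {σ a b L c v} → Clear σ (cells a b L) c v → All (λ i → σ i ≢ v) L ⊎ (c ≢ a × c ≢ b)
    cells-clear {L = []} [] = inj₁ []
    cells-clear {L = i ∷ L} {c} (p ∷ q ∷ ps) with cells-clear {L = L} ps
    ... | inj₂ ne = inj₂ ne
    ... | inj₁ rest with either c _ _
    ...   | no ne = inj₂ ((ne ∘ inj₁) , (ne ∘ inj₂))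
    ...   | yes (inj₁ refl) = inj₁ ((λ e → p (e , refl)) ∷ rest)
    ...   | yes (inj₂ refl) = inj₁ ((λ e → q (e , refl)) ∷ rest)

    Outcome : ℕ → List Fact → (Color → Bool) → Cells → Set
    Outcome k F m tc = Σ[ F' ∈ List Fact ] Σ[ m' ∈ (Color → Bool) ] Σ[ tc' ∈ Cells ]
      (∀ {ν₁ σ} → Distinct k σ → Away ν₁ σ F m tc → Away ν₁ σ F' m' tc')

    wander : ∀ k (ks : List (Color × Color × List ℕ)) F m tc → Maybe (Outcome k F m tc)
    wander k [] F m tc = just (F , m , tc , λ _ A → A)
    wander k ((a , b , L) ∷ ks) F m tc = acts? a b >>= λ ok → shut? F a b L >>= λ shut →
      dec⇒maybe (All.all? (_<? k) L) >>= λ bound →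
      wander k ks (recolour (among? k L) a b F) (widen a b m) (cells a b L ++ tc) >>= λ { (F' , m' , tc' , next) →
      just (F' , m' , tc' , λ {ν₁} {σ} dist A → next dist (record
        { path = path A ◅◅ (flip-step (proj₁ ok) (proj₂ ok) (closed dist A shut) ◅ ε)
        ; isRegular = flip-regular a b (within σ L) (closed dist A shut) (isRegular A)
        ; isMissing = flip-missing a b (within σ L) {mis = m} (isMissing A)
        ; hold = recolour-holds {now A} σ a b (within σ L) (among? k L) (among?-sound dist bound) (hold A)
        ; untouched = clear A })) }
      where
      closed : ∀ {ν₁ σ} → Distinct k σ → (A : Away ν₁ σ F m tc) → Shut F a b L → Closed a b (within σ L) (now A)
      closed _ A shut = shut-closed (isRegular A) (hold A) shut
      clear : ∀ {ν₁ σ} (A : Away ν₁ σ F m tc) c v → Clear σ (cells a b L ++ tc) c v → flip a b (within σ L) (now A) c v ≡ ν₁ c v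
      clear {σ = σ} A c v cl with cells-clear {σ} {a} {b} {L} {c} {v} (Allₚ.++⁻ˡ (cells a b L) cl)
      ... | inj₂ (p , q) = trans (cong (λ d → now A d v) (pick-other (within σ L v) p q)) (untouched A c v (Allₚ.++⁻ʳ (cells a b L) cl))
      ... | inj₁ out with within-split σ L v
      ...   | inj₁ (i , i∈L , e) = contradiction e (All.lookup out i∈L)
      ...   | inj₂ (e , _) = trans (cong (λ w → now A (pick w a b c) v) e) (untouched A c v (Allₚ.++⁻ʳ (cells a b L) cl))

    -- The set on which the temporary exchange is undone. Edges of colours 0 and `b` may have been
    -- rerouted at named vertices, whose sides are therefore prescribed anew; everywhere else the
    -- old side remains.
    override : (ℕ → V) → List (ℕ × Bool) → (V → Bool) → V → Bool
    override σ [] K v = K v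
    override σ ((i , x) ∷ bs) K v = if ⌊ σ i Fin.≟ v ⌋ then x else override σ bs K v

    override-other : ∀ σ bs K {v} → All (λ { (i , _) → σ i ≢ v }) bs → override σ bs K v ≡ K v
    override-other σ [] K [] = refl
    override-other σ ((i , x) ∷ bs) K {v} (p ∷ ps) with σ i Fin.≟ v
    ... | yes e = contradiction e p
    ... | no _ = override-other σ bs K ps

    merged : List (ℕ × Bool) → List (ℕ × Bool) → ℕ → Maybe Bool
    merged [] B i = sideOf B i
    merged ((i' , x) ∷ bs) B i with i Nat.≟ i'
    ... | yes _ = just x
    ... | no _ = merged bs B i

    mergedWithin : ℕ → List (ℕ × Bool) → List (ℕ × Bool) → ℕ → Maybe Bool
    mergedWithin k bs B i with i <? k
    ... | yes _ = merged bs B i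
    ... | no _ = nothing

    Decided : ℕ → List (ℕ × Bool) → List (ℕ × Bool) → ℕ → Bool → Set
    Decided k bs B i x = mergedWithin k bs B i ≡ just x

    merged-sound : ∀ {k σ K bs B} → Distinct k σ → All (λ { (i , _) → i < k }) bs → All (λ { (i , b) → K (σ i) ≡ b }) B →
                   ∀ {i x} → Decided k bs B i x → override σ bs K (σ i) ≡ x
    merged-sound {k} {σ} {K} {bs} {B} dist bound sd {i} {x} eq with i <? k
    ... | yes i<k = go bs bound eq
      where
      go : ∀ bs → All (λ { (i , _) → i < k }) bs → merged bs B i ≡ just x → override σ bs K (σ i) ≡ x
      go [] [] eq = sideOf-sound {K} sd eq
      go ((i' , y) ∷ bs) (l ∷ ls) eq with i Nat.≟ i' | σ i' Fin.≟ σ i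
      go ((i' , y) ∷ bs) (l ∷ ls) refl | yes _ | yes _ = refl
      ... | yes refl | no ne = contradiction refl ne
      ... | no ne | yes e = contradiction (≡-sym (dist l i<k e)) ne
      ... | no _ | no _ = go bs ls eq

    decide : ∀ k bs B i → Maybe (∃[ x ] Decided k bs B i x)
    decide k bs B i with mergedWithin k bs B i
    ... | just x = just (x , refl)
    ... | nothing = nothing

    _∈ᶜ?_ : (p : ℕ × Color) (L : Cells) → Dec (p ∈ L)
    _∈ᶜ?_ = DecMem._∈?_ (≡-dec Nat._≟_ Fin._≟_)

    module _ (k : ℕ) (bs B : List (ℕ × Bool)) (b : Color) (F : List Fact) (tc : Cells) where

      Kept : ℕ → Color → Set
      Kept i c = ∃[ x ] (Decided k bs B i x × (i , x) ∈ B × (i , c) ∉ tc × i < k)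

      kept? : ∀ i c → Maybe (Kept i c)
      kept? i c = decide k bs B i >>= λ { (x , d) → dec⇒maybe (DecMem._∈?_ (≡-dec Nat._≟_ Boolₚ._≟_) (i , x) B) >>= λ m →
        dec⇒maybe (¬? ((i , c) ∈ᶜ? tc) ×-dec (i <? k)) >>= λ { (p , q) → just (x , d , m , p , q) } }

      -- What makes the new set closed at a named vertex: either its neighbour is known and has the
      -- same new side, or neither its side nor the entry has changed.
      Matched : ℕ → Color → Set
      Matched i c = (∃[ x ] ∃[ j ] (Decided k bs B i x × (i , c , j) ∈ F × Decided k bs B j x)) ⊎ Kept i c

      matched? : ∀ i c → Maybe (Matched i c)
      matched? i c = (decide k bs B i >>= λ { (x , d) → find F i c >>= λ { (j , m) → decide k bs B j >>= λ { (y , d') →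
          dec⇒maybe (x Boolₚ.≟ y) >>= λ { refl → just (inj₁ (x , j , d , m , d')) } } } }) <∣>
        (kept? i c >>= λ p → just (inj₂ p))

      -- After the undoing, the colour-0 edge comes from colour `b` inside the region and from 0
      -- outside. If the side and this entry are unchanged, the original colour-0 neighbour is
      -- restored and need not be recorded.
      Quiet : ℕ → Set
      Quiet i = ∃[ x ] (Decided k bs B i x × (i , x) ∈ B × (i , pick x 0F b 0F) ∉ tc × i < k)

      quiet? : ∀ i → Maybe (Quiet i)
      quiet? i = decide k bs B i >>= λ { (x , d) → dec⇒maybe (DecMem._∈?_ (≡-dec Nat._≟_ Boolₚ._≟_) (i , x) B) >>= λ m →
        dec⇒maybe (¬? ((i , pick x 0F b 0F) ∈ᶜ? tc) ×-dec (i <? k)) >>= λ { (p , q) → just (x , d , m , p , q) } }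

      noisy : ∀ (ds : List (ℕ × Bool)) → Σ[ L ∈ List ℕ ] All (λ { (i , _) → Quiet i ⊎ i ∈ L }) ds
      noisy [] = [] , []
      noisy ((i , x) ∷ ds) with noisy ds | quiet? i
      ... | L , ps | just q = L , inj₁ q ∷ ps
      ... | L , ps | nothing = i ∷ L , inj₂ (here refl) ∷ All.map (λ { (inj₁ q) → inj₁ q ; (inj₂ m) → inj₂ (there m) }) ps

    returned : State → ℕ → List (ℕ × Bool) → List (ℕ × Bool) → Color → List Fact → (Color → Bool) → Pairs → State
    returned s k bs B b F m O = record
      { base = withFacts (base s) (recolour (mergedWithin k bs B) 0F b F) (widen 0F b m) ; moved = O ; zone = nothing }

    module _ {s : State} {Z : Region} (eq : zone s ≡ just Z) (zero : hue₁ Z ≡ 0F) (ok : T (act 0F) × T (act (hue₂ Z)))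
             (bs : List (ℕ × Bool)) (bound : All (λ { (i , _) → i < size (base s) }) bs) where

      private
        k = size (base s)
        B = known Z
        b = hue₂ Z

      entered : Σ[ F ∈ List Fact ] (Color → Bool)
      entered = recolour (sideOf B) 0F b (facts (base s)) , widen 0F b (mis (base s))

      detour-sound : ∀ {F m tc} → (∀ {ν₁ σ} → Distinct k σ → Away ν₁ σ (proj₁ entered) (proj₂ entered) [] → Away ν₁ σ F m tc) →
                     All (λ { (i , c) → c ≡ 0F ⊎ c ≡ b → i ∈ map proj₁ bs }) tc →
                     All (λ { (i , _) → Matched k bs B b F tc i 0F × Matched k bs B b F tc i b }) bs →
                     (r : Recorded s (proj₁ (noisy k bs B b F tc bs))) →
                     Sound (returned s k bs B b F m (Recorded.fresh r ++ moved s)) → Sound s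
      detour-sound {F} {m} {tc} go inside matched r next {ν₀} S with subst (λ z → Zoned z (current S) (σ S)) eq (zoned S)
      ... | occupies K cl' sd un = next record
        { matches = record
          { regular = flip-regular 0F b K' K'-closed (isRegular A) ; missing = flip-missing 0F b K' {mis = m} (isMissing A)
          ; distinct = dist ; holds = recolour-holds {ν'} σ' 0F b K' (mergedWithin k bs B) sound (hold A)
          ; mated = mated (matches S) ; unmated = unmated (matches S) }
        ; reached = reached S ◅◅ (flip-step (proj₁ ok) (proj₂ ok) cl ◅ path A) ◅◅ (flip-step (proj₁ ok) (proj₂ ok) K'-closed ◅ ε)
        ; before = recorded-before S r ; still = still' ; zoned = tt }
        where
        σ' = σ S
        dist = distinct (matches S)
        cl : Closed 0F b K (current S)
        cl = subst (λ a → Closed a b K (current S)) zero cl'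
        ν₁ = flip 0F b K (current S)
        A : Away ν₁ σ' F m tc
        A = go dist record
          { path = ε ; isRegular = flip-regular 0F b K cl (regular (matches S))
          ; isMissing = flip-missing 0F b K {mis = mis (base s)} (missing (matches S))
          ; hold = recolour-holds {current S} σ' 0F b K (sideOf B) (sideOf-sound {K} sd) (holds (matches S))
          ; untouched = λ _ _ _ → refl }
        ν' = now A
        K' = override σ' bs K
        sound : ∀ {i x} → Decided k bs B i x → K' (σ' i) ≡ x
        sound = merged-sound {K = K} dist bound sd
        ν₁-along : ∀ {c} → c ≡ 0F ⊎ c ≡ b → ∀ v → K (ν₁ c v) ≡ K v
        ν₁-along {c} h v = along (K v) h
          where
          along : ∀ x → c ≡ 0F ⊎ c ≡ b → K (current S (pick x 0F b c) v) ≡ K v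
          along true (inj₁ refl) = trans (cong (λ d → K (current S d v)) (swap-l 0F b)) (proj₂ (cl v))
          along true (inj₂ refl) = trans (cong (λ d → K (current S d v)) (swap-r 0F b)) (proj₁ (cl v))
          along false (inj₁ refl) = proj₁ (cl v)
          along false (inj₂ refl) = proj₂ (cl v)
        inDom : ∀ v → (∃[ p ] (p ∈ bs × σ' (proj₁ p) ≡ v)) ⊎ All (λ { (i , _) → σ' i ≢ v }) bs
        inDom v = split bs
          where
          split : ∀ ds → (∃[ p ] (p ∈ ds × σ' (proj₁ p) ≡ v)) ⊎ All (λ { (i , _) → σ' i ≢ v }) ds
          split [] = inj₂ []
          split ((i , x) ∷ ds) with σ' i Fin.≟ v | split ds
          ... | yes e | _ = inj₁ (_ , here refl , e)
          ... | no _ | inj₁ (p , q , e) = inj₁ (p , there q , e)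
          ... | no ne | inj₂ ps = inj₂ (ne ∷ ps)
        domBound : ∀ {i} → i ∈ map proj₁ bs → i < k
        domBound = find' bs bound
          where
          find' : ∀ ds → All (λ { (i , _) → i < k }) ds → ∀ {i} → i ∈ map proj₁ ds → i < k
          find' (_ ∷ ds) (l ∷ ls) (here refl) = l
          find' (_ ∷ ds) (l ∷ ls) (there p) = find' ds ls p
        clearOut : ∀ {v c} → c ≡ 0F ⊎ c ≡ b → All (λ { (i , _) → σ' i ≢ v }) bs → Clear σ' tc c v
        clearOut {v} h av = All.map (λ { p (e , refl) → keyed' bs av (p h) e }) inside
          where
          keyed' : ∀ ds → All (λ { (i , _) → σ' i ≢ v }) ds → ∀ {i} → i ∈ map proj₁ ds → σ' i ≢ v
          keyed' (_ ∷ ds) (p ∷ ps) (here refl) = p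
          keyed' (_ ∷ ds) (p ∷ ps) (there q) = keyed' ds ps q
        clearAt : ∀ {i c} → c ≡ 0F ⊎ c ≡ b → i < k → (i , c) ∉ tc → Clear σ' tc c (σ' i)
        clearAt {i} {c} h i<k ∉tc = All.tabulate λ { {i' , d} p (e , refl) →
          ∉tc (subst (λ x → (x , c) ∈ tc) (dist (domBound (All.lookup inside p h)) i<k e) p) }
        Status : Color → V → Set
        Status c v = K' (ν' c v) ≡ K' v ⊎ (K' v ≡ K v × ν' c v ≡ ν₁ c v)
        status : ∀ {c} → c ≡ 0F ⊎ c ≡ b → ∀ v → Status c v
        status {c} h v with inDom v
        ... | inj₂ av = inj₂ (override-other σ' bs K av , untouched A c v (clearOut h av))
        ... | inj₁ ((i , _) , p , refl) = use (sel h (All.lookup matched p))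
          where
          sel : ∀ {i c} → c ≡ 0F ⊎ c ≡ b → Matched k bs B b F tc i 0F × Matched k bs B b F tc i b → Matched k bs B b F tc i c
          sel (inj₁ refl) = proj₁
          sel (inj₂ refl) = proj₂
          use : Matched k bs B b F tc i c → Status c (σ' i)
          use (inj₁ (x , j , d , f , d')) = inj₁ (trans (cong K' (All.lookup (hold A) f)) (trans (sound d') (≡-sym (sound d))))
          use (inj₂ (x , d , q , ∉tc , i<k)) = inj₂ (trans (sound d) (≡-sym (All.lookup sd q)) , untouched A c _ (clearAt h i<k ∉tc))
        -- If `v` is merely unchanged, its neighbour decides: either closure is known there and the
        -- involution carries it back, or that vertex has kept its side as well and closure is
        -- inherited from `K`.
        along : ∀ {c} → c ≡ 0F ⊎ c ≡ b → ∀ v → K' (ν' c v) ≡ K' v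
        along {c} h v with status h v | status h (ν' c v)
        ... | inj₁ e | _ = e
        ... | inj₂ _ | inj₁ e = trans (≡-sym e) (cong K' (invol (isRegular A) c v))
        ... | inj₂ (e , e') | inj₂ (e'' , _) = trans e'' (trans (cong K e') (trans (ν₁-along h v) (≡-sym e)))
        K'-closed : Closed 0F b K' ν'
        K'-closed v = along (inj₁ refl) v , along (inj₂ refl) v
        pickIn : ∀ x → pick x 0F b 0F ≡ 0F ⊎ pick x 0F b 0F ≡ b
        pickIn true = inj₂ (swap-l 0F b)
        pickIn false = inj₁ refl
        -- At a vertex with the same side in `K` and `K'` the second exchange cancels the first.
        undo : ∀ v x → K' v ≡ x → K v ≡ x → ν' (pick x 0F b 0F) v ≡ ν₁ (pick x 0F b 0F) v → flip 0F b K' ν' 0F v ≡ current S 0F v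
        undo v x e e' e'' = trans (cong (λ y → ν' (pick y 0F b 0F) v) e) (trans e''
          (cong (λ c → current S c v) (trans (cong (λ y → pick y 0F b (pick x 0F b 0F)) e') (pick-pick x 0F b 0F))))
        still' : ∀ v → All (λ { (i , _) → σ' i ≢ v }) (Recorded.fresh r ++ moved s) → flip 0F b K' ν' 0F v ≡ ν₀ 0F v
        still' v av with recorded-avoid σ' r av | inDom v
        ... | avL , avO | inj₂ out = trans (undo v (K v) (override-other σ' bs K out) refl (untouched A _ v (clearOut (pickIn (K v)) out))) (still S v avO)
        ... | avL , avO | inj₁ ((i , _) , p , refl) with All.lookup (proj₂ (noisy k bs B b F tc bs)) p
        ...   | inj₂ l = contradiction refl (All.lookup avL l)
        ...   | inj₁ (x , d , q , ∉tc , i<k) = trans (undo v x (sound d) (All.lookup sd q) (untouched A _ v (clearAt (pickIn x) i<k ∉tc))) (still S v avO)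

    -- The certificate checker.

    mutual

      attempt : ∀ s → Cert → Maybe (Sound s)
      attempt s c = absurd s <∣> run s c

      run : ∀ s → Cert → Maybe (Sound s)
      run s skip = nothing
      run s win = dec⇒maybe (keyed? s) >>= λ keyed → balance s (moved s) >>= λ bal →
        dec⇒maybe (proj₁ (proj₁ bal) <? proj₂ (proj₁ bal)) >>= λ lt → just (better keyed bal lt)
      run s (lem i e ρ) = index library i >>= λ A → dec⇒maybe (ren ρ 0F Fin.≟ 0F) >>= λ z →
        dec⇒maybe (Finₚ.all? λ c → T? (Strategy.act A c) →-dec T? (act (ren ρ c))) >>= λ lift →
        embeds? (plan A) s (nth e) ρ >>= λ emb → dec⇒maybe (keyed? s) >>= λ keyed → balance s (moved s) >>= λ bal →
        dec⇒maybe (proj₁ (proj₁ bal) ≤? proj₂ (proj₁ bal)) >>= λ le → just (lemma-sound A (nth e) ρ z lift emb keyed bal le)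
        where
        index : ∀ {A : Set} → List A → ℕ → Maybe A
        index [] _ = nothing
        index (x ∷ _) zero = just x
        index (_ ∷ L) (suc i) = index L i
      run s (name i c olds news) = dec⇒maybe (i <? size (base s)) >>= λ i<k → dec⇒maybe (bounded? s) >>= λ bd →
        runOlds s i c (size (base s)) olds >>= λ os → runNews s i c colors news >>= λ ns → just (name-sound i<k bd os ns)
      run s (trace a b e cert) = endAt? >>= λ end →
        attempt (mark s (just (region a b ((e , true) ∷ []) (just e)))) cert >>= λ next → just (trace-sound end next)
        where
        endAt? : Maybe ((e , a , e) ∈ facts (base s) ⊎ (e , b , e) ∈ facts (base s))
        endAt? = (find (facts (base s)) e a >>= λ { (j , m) → dec⇒maybe (j Nat.≟ e) >>= λ { refl → just (inj₁ m) } }) <∣>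
                 (find (facts (base s)) e b >>= λ { (j , m) → dec⇒maybe (j Nat.≟ e) >>= λ { refl → just (inj₂ m) } })
      run s (ask i c d) with zone s in eq
      ... | nothing = nothing
      ... | just Z = attempt (mark s (just (record Z { known = (i , true) ∷ known Z }))) c >>= λ p →
        attempt (mark s (just (record Z { known = (i , false) ∷ known Z }))) d >>= λ q → just (ask-sound eq p q)
      run s (swapZone c) with zone s in eq
      ... | nothing = nothing
      ... | just Z = acts? (hue₁ Z) (hue₂ Z) >>= λ ok → dec⇒maybe (¬? (hue₁ Z Fin.≟ 0F) ×-dec ¬? (hue₂ Z Fin.≟ 0F)) >>= λ { (p , q) →
        attempt (flipZone s Z) c >>= λ next → just (swapZone-sound eq ok p q next) }
      run s (exchange a b L c) = acts? a b >>= λ ok → shut? (facts (base s)) a b L >>= λ shut →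
        dec⇒maybe (All.all? (_<? size (base s)) L) >>= λ bound → quietly ok shut bound (either 0F a b)
        where
        quietly : T (act a) × T (act b) → Shut (facts (base s)) a b L → All (_< size (base s)) L → Dec (0F ≡ a ⊎ 0F ≡ b) → Maybe (Sound s)
        quietly ok shut bound (no p) = attempt (exchanged s a b L (moved s)) c >>= λ next →
          just (exchange-quiet ok shut bound (p ∘ inj₁) (p ∘ inj₂) next)
        quietly ok shut bound (yes _) = note s L >>= λ r → attempt (exchanged s a b L (Recorded.fresh r ++ moved s)) c >>= λ next →
          just (exchange-noted ok shut bound r next)
      run s (detour ks bs c) with zone s in eq
      ... | nothing = nothing
      ... | just Z = dec⇒maybe (hue₁ Z Fin.≟ 0F) >>= λ z → acts? 0F (hue₂ Z) >>= λ ok →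
        dec⇒maybe (All.all? (λ { (i , _) → i <? size (base s) }) bs) >>= λ bound →
        wander (size (base s)) ks (proj₁ (entered {s} eq z ok bs bound)) (proj₂ (entered {s} eq z ok bs bound)) [] >>= λ { (F , m , tc , go) →
        dec⇒maybe (All.all? (λ { (i , c) → either c 0F (hue₂ Z) →-dec (i ∈ℕ? map proj₁ bs) }) tc) >>= λ inside →
        traverse (both F tc Z) bs >>= λ matched →
        note s (proj₁ (noisy (size (base s)) bs (known Z) (hue₂ Z) F tc bs)) >>= λ r →
        attempt (returned s (size (base s)) bs (known Z) (hue₂ Z) F m (Recorded.fresh r ++ moved s)) c >>= λ next →
        just (detour-sound {s} eq z ok bs bound go inside matched r next) }
        where
        both : ∀ F tc Z (p : ℕ × Bool) → Maybe (Matched (size (base s)) bs (known Z) (hue₂ Z) F tc (proj₁ p) 0F ×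
                                               Matched (size (base s)) bs (known Z) (hue₂ Z) F tc (proj₁ p) (hue₂ Z))
        both F tc Z (i , _) = matched? (size (base s)) bs (known Z) (hue₂ Z) F tc i 0F >>= λ p →
          matched? (size (base s)) bs (known Z) (hue₂ Z) F tc i (hue₂ Z) >>= λ q → just (p , q)
      run s (mate i branches) = runMate s i colors branches >>= λ bs → just (mate-sound bs)

      runOlds : ∀ s i c m → List Cert → Maybe (Olds s i c m)
      runOlds s i c zero _ = just λ _ ()
      runOlds s i c (suc m) [] = nothing
      runOlds s i c (suc m) (x ∷ xs) = attempt (learn s ((i , c , m) ∷ (m , c , i) ∷ [])) x >>= λ p →
        runOlds s i c m xs >>= λ ps → just λ j j<m → case ℕₚ.m≤n⇒m<n∨m≡n (ℕₚ.≤-pred j<m) of λ where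
          (inj₁ l) → ps j l
          (inj₂ refl) → p

      runNews : ∀ s i c (ms : List Color) → List Cert → Maybe (All (λ m → Possible s m → News s i c m) ms)
      runNews s i c [] _ = just []
      runNews s i c (m ∷ ms) [] = nothing
      runNews s i c (m ∷ ms) (x ∷ xs) with T? (mis (base s) m)
      ... | no ¬p = runNews s i c ms xs >>= λ ps → just ((λ p → contradiction p ¬p) ∷ ps)
      ... | yes _ = attempt (grow s ((i , c , size (base s)) ∷ (size (base s) , c , i) ∷ (size (base s) , m , size (base s)) ∷ [])) x >>= λ p →
        runNews s i c ms xs >>= λ ps → just ((λ _ → p) ∷ ps)

      runMate : ∀ s i (cs : List Color) → List Cert → Maybe (All (Marriage s i) cs)
      runMate s i [] _ = just []
      runMate s i (c ∷ cs) [] = nothing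
      runMate s i (c ∷ cs) (x ∷ xs) = find (facts (base s)) i c >>= λ { (j , m) → spouse j >>= λ p →
        runMate s i cs xs >>= λ ps → just ((j , m , p) ∷ ps) }
        where
        spouse : ∀ j → Maybe (j ≡ i ⊎ Sound (marry s i j))
        spouse j with j Nat.≟ i
        ... | yes e = just (inj₁ e)
        ... | no _ = attempt (marry s i j) x >>= λ next → just (inj₂ next)

    opening : Pattern → State
    opening P = state P [] nothing

    opened : ∀ {P ν σ} → Matches P ν σ → Sem act (opening P) ν
    opened m = record { matches = m ; reached = ε ; before = [] ; still = λ _ _ → refl ; zoned = tt }

  -- Strategies obtained by evaluating the checker.

  -- The implicit argument has the unit type exactly if the checker succeeds, so for a concrete
  -- certificate evaluation supplies it.
  strategy : ∀ (act : Color → Bool) (library : List Strategy) (P : Pattern) (cert : Cert) →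
             {p : T (is-just (Play.run act library (Play.opening act library P) cert))} → Strategy
  strategy act library P cert {p} = record { plan = P ; act = act ; winning = λ m → extract _ p (Play.opened act library m) }
    where
    extract : (r : Maybe (Play.Sound act library (Play.opening act library P))) → T (is-just r) → Play.Sound act library (Play.opening act library P)
    extract (just sound) _ = sound

  those : List Color → Color → Bool
  those L c = ⌊ DecMem._∈?_ Fin._≟_ c L ⌋

  every : Color → Bool
  every _ = true

  mirrored : List Fact → List Fact
  mirrored [] = []
  mirrored ((i , c , j) ∷ F) = if ⌊ i Nat.≟ j ⌋ then (i , c , j) ∷ mirrored F else (i , c , j) ∷ (j , c , i) ∷ mirrored F

  drawn : ℕ → Pairs → Pairs → (Color → Bool) → List Fact → Pattern
  drawn k mates uglies mis F = mkPattern k (mirrored F) mates uglies mis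

  around : ℕ → List Fact → Pattern
  around k F = drawn k ((0 , 1) ∷ (1 , 0) ∷ []) [] every F

  -- Colour 0 is to become the class M, and a vertex is free if it misses 0.
  -- In the strategies for a colouring without free vertices and for fans, 0 and 1 are the ends x and y of an edge
  -- of colour 0 outside M, and x misses 2, y misses 3. Otherwise 0, 1, 2 are z, x, y: M matches the free vertex
  -- z with x, the edge zx has colour 1, xy has colour 0, x misses 2 and y misses 3 (1 in shortPath).
  -- The names refer to the following neighbours: t, s and r are those of y along 1, 2 and 4, and u is that of x along 3.
  -- "triangle": s is z; "apart": r is free; "joined": r is z; "twins": x and y have the same neighbours.

  bothFree : Strategy
  bothFree = strategy (those (0F ∷ 1F ∷ [])) []
    (around 2 ((0 , 0F , 0) ∷ (0 , 1F , 1) ∷ (1 , 0F , 1) ∷ []))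
    (exchange 0F 1F (0 ∷ 1 ∷ []) win)

  -- Vizing fans.

  edgeFree : Strategy
  edgeFree = strategy (those (0F ∷ 2F ∷ [])) []
    (drawn 2 [] ((0 , 1) ∷ []) every ((0 , 0F , 1) ∷ (0 , 2F , 0) ∷ (1 , 2F , 1) ∷ []))
    (exchange 0F 2F (0 ∷ 1 ∷ []) win)

  -- Rotating the last fan edge to colour 2 lets `x` miss 3, like `y`. The longer fans are rotated
  -- one edge at a time from the far end.
  fan₁ : Strategy
  fan₁ = strategy (those (0F ∷ 2F ∷ 3F ∷ [])) (edgeFree ∷ [])
    (drawn 3 [] ((0 , 1) ∷ []) every ((0 , 0F , 1) ∷ (0 , 2F , 0) ∷ (0 , 3F , 2) ∷ (1 , 3F , 1) ∷ (2 , 2F , 2) ∷ []))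
    (exchange 2F 3F (0 ∷ 2 ∷ []) (lem 0 (0 ∷ 1 ∷ []) ((2F , 3F) ∷ [])))

  fan₂ : Strategy
  fan₂ = strategy (those (0F ∷ 1F ∷ 2F ∷ 3F ∷ [])) (fan₁ ∷ [])
    (drawn 4 [] ((0 , 1) ∷ []) every ((0 , 0F , 1) ∷ (0 , 1F , 3) ∷ (0 , 2F , 0) ∷ (0 , 3F , 2) ∷ (1 , 3F , 1) ∷ (2 ,
    1F , 2) ∷ (3 , 2F , 3) ∷ []))
    (exchange 1F 2F (0 ∷ 3 ∷ []) (lem 0 (0 ∷ 1 ∷ 2 ∷ []) ((1F , 2F) ∷ [])))

  -- The last leaf misses 3, as `y` does, while `x` misses 2. These three ends cannot share a 2-3
  -- chain: exchanging the chain of the leaf gives `x` and `y` a common missing colour, or makes the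
  -- leaf miss 2 and completes the fan.
  fan₂-repeat : Strategy
  fan₂-repeat = strategy (those (0F ∷ 1F ∷ 2F ∷ 3F ∷ [])) (edgeFree ∷ fan₂ ∷ [])
    (drawn 4 [] ((0 , 1) ∷ []) every ((0 , 0F , 1) ∷ (0 , 1F , 3) ∷ (0 , 2F , 0) ∷ (0 , 3F , 2) ∷ (1 , 3F , 1) ∷ (2 ,
    1F , 2) ∷ (3 , 3F , 3) ∷ []))
    (trace 2F 3F 3 (ask 0 (ask 2 (ask 1 skip (swapZone (lem 0 (0 ∷ 1 ∷ []) ((2F , 3F) ∷ [])))) skip) (ask 2 skip (ask
    1 (swapZone (lem 0 (0 ∷ 1 ∷ []) [])) (swapZone (lem 1 (0 ∷ 1 ∷ 2 ∷ 3 ∷ []) []))))))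

  fan₃ : Strategy
  fan₃ = strategy every (fan₂ ∷ [])
    (drawn 5 [] ((0 , 1) ∷ []) every ((0 , 0F , 1) ∷ (0 , 1F , 3) ∷ (0 , 2F , 0) ∷ (0 , 3F , 2) ∷ (0 , 4F , 4) ∷ (1 ,
    3F , 1) ∷ (2 , 1F , 2) ∷ (3 , 4F , 3) ∷ (4 , 2F , 4) ∷ []))
    (exchange 2F 4F (0 ∷ 4 ∷ []) (lem 0 (0 ∷ 1 ∷ 2 ∷ 3 ∷ []) ((2F , 4F) ∷ [])))

  fan₃-repeat : Strategy
  fan₃-repeat = strategy every (edgeFree ∷ fan₃ ∷ [])
    (drawn 5 [] ((0 , 1) ∷ []) every ((0 , 0F , 1) ∷ (0 , 1F , 3) ∷ (0 , 2F , 0) ∷ (0 , 3F , 2) ∷ (0 , 4F , 4) ∷ (1 ,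
    3F , 1) ∷ (2 , 1F , 2) ∷ (3 , 4F , 3) ∷ (4 , 3F , 4) ∷ []))
    (trace 2F 3F 4 (ask 0 (ask 2 (ask 1 skip (swapZone (lem 0 (0 ∷ 1 ∷ []) ((2F , 3F) ∷ [])))) skip) (ask 2 skip (ask
    1 (swapZone (lem 0 (0 ∷ 1 ∷ []) [])) (swapZone (lem 1 (0 ∷ 1 ∷ 2 ∷ 3 ∷ 4 ∷ []) []))))))

  -- The last leaf repeats the colour missed by the first leaf rather than that of `y`. Exchanging
  -- its 1-3 chain shortens the fan if `x` lies on it, and otherwise leads to a last leaf that
  -- repeats the colour missed by `y`.
  fan₃-repeat′ : Strategy
  fan₃-repeat′ = strategy every (fan₂-repeat ∷ fan₃-repeat ∷ [])
    (drawn 5 [] ((0 , 1) ∷ []) every ((0 , 0F , 1) ∷ (0 , 1F , 3) ∷ (0 , 2F , 0) ∷ (0 , 3F , 2) ∷ (0 , 4F , 4) ∷ (1 ,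
    3F , 1) ∷ (2 , 1F , 2) ∷ (3 , 4F , 3) ∷ (4 , 1F , 4) ∷ []))
    (trace 1F 3F 4 (ask 0 (ask 3 (ask 2 (ask 1 skip (swapZone (lem 0 (0 ∷ 1 ∷ 3 ∷ 4 ∷ []) ((1F , 4F) ∷ [])))) skip)
    skip) (ask 3 skip (ask 2 skip (ask 1 (swapZone (lem 1 (0 ∷ 1 ∷ 3 ∷ 4 ∷ 2 ∷ []) ((3F , 1F) ∷ (1F , 4F) ∷ [])))
    (swapZone (lem 1 (0 ∷ 1 ∷ 2 ∷ 3 ∷ 4 ∷ []) [])))))))

  -- A leaf missing 0 would lead the fan back to the edge `xy` itself; without free vertices this
  -- cannot occur. One plan serves five, four and three active colours, since branches with a leaf
  -- missing an inactive colour are ruled out by `mis`.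
  noFree-plan : Cert
  noFree-plan =
    name 0 3F (skip ∷ skip ∷ []) (skip ∷ name 0 1F (skip ∷ skip ∷ skip ∷ []) (skip ∷ skip ∷ lem 0 (0 ∷ 1 ∷ 2 ∷ 3 ∷ [])
    [] ∷ lem 1 (0 ∷ 1 ∷ 2 ∷ 3 ∷ []) [] ∷ name 0 4F (skip ∷ skip ∷ skip ∷ skip ∷ []) (skip ∷ lem 2 (0 ∷ 1 ∷ 2 ∷ 3 ∷ 4 ∷
    []) [] ∷ lem 3 (0 ∷ 1 ∷ 2 ∷ 3 ∷ 4 ∷ []) [] ∷ lem 4 (0 ∷ 1 ∷ 2 ∷ 3 ∷ 4 ∷ []) [] ∷ skip ∷ []) ∷ []) ∷ lem 5 (0 ∷ 1 ∷
    2 ∷ []) [] ∷ skip ∷ name 0 4F (skip ∷ skip ∷ skip ∷ []) (skip ∷ name 0 1F (skip ∷ skip ∷ skip ∷ skip ∷ []) (skip ∷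
    skip ∷ lem 3 (0 ∷ 1 ∷ 2 ∷ 3 ∷ 4 ∷ []) ((1F , 4F) ∷ []) ∷ lem 4 (0 ∷ 1 ∷ 2 ∷ 3 ∷ 4 ∷ []) ((1F , 4F) ∷ []) ∷ lem 2
    (0 ∷ 1 ∷ 2 ∷ 3 ∷ 4 ∷ []) ((1F , 4F) ∷ []) ∷ []) ∷ lem 0 (0 ∷ 1 ∷ 2 ∷ 3 ∷ []) ((1F , 4F) ∷ []) ∷ lem 1 (0 ∷ 1 ∷ 2 ∷
    3 ∷ []) ((1F , 4F) ∷ []) ∷ skip ∷ []) ∷ [])

  noFree : Strategy
  noFree = strategy every (fan₂ ∷ fan₂-repeat ∷ fan₃-repeat′ ∷ fan₃ ∷ fan₃-repeat ∷ fan₁ ∷ [])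
    (drawn 2 [] ((0 , 1) ∷ []) (those (1F ∷ 2F ∷ 3F ∷ 4F ∷ [])) ((0 , 0F , 1) ∷ (0 , 2F , 0) ∷ (1 , 3F , 1) ∷ []))
    noFree-plan

  noFree₄ : Strategy
  noFree₄ = strategy (those (0F ∷ 1F ∷ 2F ∷ 3F ∷ [])) (fan₂ ∷ fan₂-repeat ∷ fan₃-repeat′ ∷ fan₃ ∷ fan₃-repeat ∷ fan₁ ∷ [])
    (drawn 2 [] ((0 , 1) ∷ []) (those (1F ∷ 2F ∷ 3F ∷ [])) ((0 , 0F , 1) ∷ (0 , 2F , 0) ∷ (1 , 3F , 1) ∷ []))
    noFree-plan

  noFree₃ : Strategy
  noFree₃ = strategy (those (0F ∷ 2F ∷ 3F ∷ [])) (fan₂ ∷ fan₂-repeat ∷ fan₃-repeat′ ∷ fan₃ ∷ fan₃-repeat ∷ fan₁ ∷ [])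
    (drawn 2 [] ((0 , 1) ∷ []) (those (2F ∷ 3F ∷ [])) ((0 , 0F , 1) ∷ (0 , 2F , 0) ∷ (1 , 3F , 1) ∷ []))
    noFree-plan

  -- Short paths and chains near a free vertex.

  shortPath : Strategy
  shortPath = strategy (those (0F ∷ 1F ∷ [])) []
    (around 3 ((0 , 0F , 0) ∷ (0 , 1F , 1) ∷ (1 , 0F , 2) ∷ (1 , 2F , 1) ∷ (2 , 1F , 2) ∷ []))
    (exchange 0F 1F (0 ∷ 1 ∷ 2 ∷ []) win)

  t-free : Strategy
  t-free = strategy (those (0F ∷ 1F ∷ [])) []
    (around 4 ((0 , 0F , 0) ∷ (0 , 1F , 1) ∷ (1 , 0F , 2) ∷ (1 , 2F , 1) ∷ (2 , 1F , 3) ∷ (2 , 3F , 2) ∷ (3 , 0F , 3)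
    ∷ []))
    (exchange 0F 1F (0 ∷ 1 ∷ 2 ∷ 3 ∷ []) win)

  t-misses-3 : Strategy
  t-misses-3 = strategy (those (0F ∷ 1F ∷ 3F ∷ [])) (shortPath ∷ [])
    (around 4 ((0 , 0F , 0) ∷ (0 , 1F , 1) ∷ (1 , 0F , 2) ∷ (1 , 2F , 1) ∷ (2 , 1F , 3) ∷ (2 , 3F , 2) ∷ (3 , 3F , 3)
    ∷ []))
    (exchange 1F 3F (2 ∷ 3 ∷ []) (lem 0 (0 ∷ 1 ∷ 2 ∷ []) []))

  -- If the 2-3 chain of `t` contains `x` or `y`, its exchange gives `x` and `y` a common missing
  -- colour. Otherwise it makes `t` miss 3, like `y`.
  t-misses-2 : Strategy
  t-misses-2 = strategy (those (0F ∷ 1F ∷ 2F ∷ 3F ∷ [])) (edgeFree ∷ t-misses-3 ∷ [])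
    (around 4 ((0 , 0F , 0) ∷ (0 , 1F , 1) ∷ (1 , 0F , 2) ∷ (1 , 2F , 1) ∷ (2 , 1F , 3) ∷ (2 , 3F , 2) ∷ (3 , 2F , 3)
    ∷ []))
    (trace 2F 3F 3 (ask 1 (ask 2 skip (swapZone (lem 0 (1 ∷ 2 ∷ []) ((2F , 3F) ∷ [])))) (ask 2 (swapZone (lem 0 (1 ∷ 2
    ∷ []) [])) (swapZone (lem 1 (0 ∷ 1 ∷ 2 ∷ 3 ∷ []) [])))))

  -- The path `x y s` in colours 0 and 2 is a whole component, and its exchange frees `x` next to
  -- its free mate `z`. It does not raise `Φ`, even if `ys` is outside `M`.
  s-free : Strategy
  s-free = strategy (those (0F ∷ 1F ∷ 2F ∷ [])) (bothFree ∷ [])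
    (around 4 ((0 , 0F , 0) ∷ (0 , 1F , 1) ∷ (1 , 0F , 2) ∷ (1 , 2F , 1) ∷ (2 , 2F , 3) ∷ (2 , 3F , 2) ∷ (3 , 0F , 3)
    ∷ []))
    (exchange 0F 2F (1 ∷ 2 ∷ 3 ∷ []) (lem 0 (0 ∷ 1 ∷ []) []))

  -- When `t` misses 4, its 3-4 chain cannot contain both `y` and `s`. If it contains one of them,
  -- the exchange gives `y` and `s` a common missing colour and the fan at `y` closes; otherwise `t`
  -- comes to miss 3.
  s-misses-4 : Strategy
  s-misses-4 = strategy every (t-free ∷ t-misses-2 ∷ t-misses-3 ∷ fan₁ ∷ [])
    (around 4 ((0 , 0F , 0) ∷ (0 , 1F , 1) ∷ (1 , 0F , 2) ∷ (1 , 2F , 1) ∷ (2 , 2F , 3) ∷ (2 , 3F , 2) ∷ (3 , 4F , 3)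
    ∷ []))
    (name 2 1F (skip ∷ skip ∷ skip ∷ skip ∷ []) (lem 0 (0 ∷ 1 ∷ 2 ∷ 4 ∷ []) [] ∷ skip ∷ lem 1 (0 ∷ 1 ∷ 2 ∷ 4 ∷ []) []
    ∷ lem 2 (0 ∷ 1 ∷ 2 ∷ 4 ∷ []) [] ∷ trace 3F 4F 4 (ask 2 (ask 3 skip (swapZone (lem 3 (2 ∷ 1 ∷ 3 ∷ []) ((3F , 2F) ∷
    (2F , 4F) ∷ [])))) (ask 3 (swapZone (lem 3 (2 ∷ 1 ∷ 3 ∷ []) ((2F , 3F) ∷ []))) (swapZone (lem 2 (0 ∷ 1 ∷ 2 ∷ 4 ∷
    []) [])))) ∷ []))

  r-misses-3 : Strategy
  r-misses-3 = strategy every (t-free ∷ t-misses-2 ∷ t-misses-3 ∷ [])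
    (around 4 ((0 , 0F , 0) ∷ (0 , 1F , 1) ∷ (1 , 0F , 2) ∷ (1 , 2F , 1) ∷ (2 , 3F , 2) ∷ (2 , 4F , 3) ∷ (3 , 3F , 3)
    ∷ []))
    (name 2 1F (skip ∷ skip ∷ skip ∷ skip ∷ []) (lem 0 (0 ∷ 1 ∷ 2 ∷ 4 ∷ []) [] ∷ skip ∷ lem 1 (0 ∷ 1 ∷ 2 ∷ 4 ∷ []) []
    ∷ lem 2 (0 ∷ 1 ∷ 2 ∷ 4 ∷ []) [] ∷ exchange 3F 4F (2 ∷ 3 ∷ []) (lem 2 (0 ∷ 1 ∷ 2 ∷ 4 ∷ []) ((3F , 4F) ∷ [])) ∷ []))

  r-misses-2 : Strategy
  r-misses-2 = strategy every (t-free ∷ t-misses-2 ∷ t-misses-3 ∷ s-misses-4 ∷ [])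
    (around 4 ((0 , 0F , 0) ∷ (0 , 1F , 1) ∷ (1 , 0F , 2) ∷ (1 , 2F , 1) ∷ (2 , 3F , 2) ∷ (2 , 4F , 3) ∷ (3 , 2F , 3)
    ∷ []))
    (name 2 1F (skip ∷ skip ∷ skip ∷ skip ∷ []) (lem 0 (0 ∷ 1 ∷ 2 ∷ 4 ∷ []) [] ∷ skip ∷ lem 1 (0 ∷ 1 ∷ 2 ∷ 4 ∷ []) []
    ∷ lem 2 (0 ∷ 1 ∷ 2 ∷ 4 ∷ []) [] ∷ trace 2F 4F 4 (ask 1 (ask 3 skip (ask 2 skip (swapZone (lem 3 (0 ∷ 1 ∷ 2 ∷ 3 ∷
    []) ((2F , 4F) ∷ []))))) (ask 2 (ask 3 (swapZone (lem 1 (0 ∷ 1 ∷ 2 ∷ 4 ∷ []) [])) skip) (ask 3 skip (swapZone (lem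
    1 (0 ∷ 1 ∷ 2 ∷ 4 ∷ []) []))))) ∷ []))

  u-free-both : Strategy
  u-free-both = strategy every (t-misses-2 ∷ [])
    (around 6 ((0 , 0F , 0) ∷ (0 , 1F , 1) ∷ (1 , 0F , 2) ∷ (1 , 2F , 1) ∷ (1 , 3F , 3) ∷ (2 , 1F , 4) ∷ (2 , 3F , 2)
    ∷ (3 , 0F , 3) ∷ (3 , 1F , 5) ∷ (4 , 4F , 4) ∷ (5 , 4F , 5) ∷ []))
    (trace 2F 4F 5 (ask 4 (ask 1 skip (swapZone (lem 0 (0 ∷ 1 ∷ 2 ∷ 4 ∷ []) []))) (ask 1 (swapZone (lem 0 (0 ∷ 1 ∷ 2 ∷
    4 ∷ []) ((2F , 4F) ∷ []))) (exchange 0F 3F (1 ∷ 2 ∷ 3 ∷ []) (swapZone (lem 0 (0 ∷ 1 ∷ 3 ∷ 5 ∷ []) []))))))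

  -- Since `y` misses 3 and `u` misses 0, the path `y x u` is a component in colours 0 and 3. Its
  -- exchange hands the role of `y` to `u` without raising `Φ`, so the neighbour of `u` along 1
  -- becomes the new `t`.
  u-free-t : Strategy
  u-free-t = strategy every (t-free ∷ t-misses-2 ∷ t-misses-3 ∷ u-free-both ∷ [])
    (around 5 ((0 , 0F , 0) ∷ (0 , 1F , 1) ∷ (1 , 0F , 2) ∷ (1 , 2F , 1) ∷ (1 , 3F , 3) ∷ (2 , 1F , 4) ∷ (2 , 3F , 2)
    ∷ (3 , 0F , 3) ∷ (4 , 4F , 4) ∷ []))
    (exchange 0F 3F (1 ∷ 2 ∷ 3 ∷ []) (name 3 1F (skip ∷ skip ∷ skip ∷ skip ∷ skip ∷ []) (lem 0 (0 ∷ 1 ∷ 3 ∷ 5 ∷ []) []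
    ∷ skip ∷ lem 1 (0 ∷ 1 ∷ 3 ∷ 5 ∷ []) [] ∷ lem 2 (0 ∷ 1 ∷ 3 ∷ 5 ∷ []) [] ∷ lem 3 (0 ∷ 1 ∷ 3 ∷ 2 ∷ 5 ∷ 4 ∷ []) [] ∷
    [])))

  u-free : Strategy
  u-free = strategy every (t-free ∷ t-misses-2 ∷ t-misses-3 ∷ u-free-t ∷ [])
    (around 4 ((0 , 0F , 0) ∷ (0 , 1F , 1) ∷ (1 , 0F , 2) ∷ (1 , 2F , 1) ∷ (1 , 3F , 3) ∷ (2 , 3F , 2) ∷ (3 , 0F , 3)
    ∷ []))
    (name 2 1F (lem 0 (0 ∷ 1 ∷ 2 ∷ 3 ∷ []) [] ∷ skip ∷ skip ∷ skip ∷ []) (lem 0 (0 ∷ 1 ∷ 2 ∷ 4 ∷ []) [] ∷ skip ∷ lem 1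
    (0 ∷ 1 ∷ 2 ∷ 4 ∷ []) [] ∷ lem 2 (0 ∷ 1 ∷ 2 ∷ 4 ∷ []) [] ∷ lem 3 (0 ∷ 1 ∷ 2 ∷ 3 ∷ 4 ∷ []) [] ∷ []))

  -- If the 3-4 chain of `u` contains `y` or `t`, its exchange gives `y` and `t` a common missing
  -- colour. Otherwise it turns `xu` into colour 4, so that `x` gets another neighbour along 3.
  u-misses-4 : Strategy
  u-misses-4 = strategy every (t-misses-3 ∷ fan₂-repeat ∷ u-free-t ∷ fan₁ ∷ t-misses-2 ∷ [])
    (around 5 ((0 , 0F , 0) ∷ (0 , 1F , 1) ∷ (1 , 0F , 2) ∷ (1 , 2F , 1) ∷ (1 , 3F , 3) ∷ (2 , 1F , 4) ∷ (2 , 3F , 2)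
    ∷ (3 , 4F , 3) ∷ (4 , 4F , 4) ∷ []))
    (trace 3F 4F 3 (ask 1 (ask 2 (ask 4 skip (swapZone (lem 0 (0 ∷ 1 ∷ 2 ∷ 4 ∷ []) ((3F , 4F) ∷ [])))) (ask 4
    (swapZone (lem 0 (0 ∷ 1 ∷ 2 ∷ 4 ∷ []) [])) (swapZone (name 1 3F (lem 1 (1 ∷ 2 ∷ 4 ∷ 3 ∷ []) ((1F , 4F) ∷ []) ∷
    skip ∷ skip ∷ skip ∷ skip ∷ []) (lem 2 (0 ∷ 1 ∷ 2 ∷ 5 ∷ 4 ∷ []) [] ∷ trace 3F 4F 3 (ask 1 (ask 5 (ask 2 (ask 4
    skip (swapZone (lem 0 (0 ∷ 1 ∷ 2 ∷ 4 ∷ []) ((3F , 4F) ∷ [])))) (ask 4 (swapZone (lem 0 (0 ∷ 1 ∷ 2 ∷ 4 ∷ []) []))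
    (swapZone (trace 2F 4F 4 (ask 1 (ask 5 (ask 3 skip (swapZone (lem 3 (1 ∷ 2 ∷ 3 ∷ []) ((2F , 4F) ∷ [])))) skip)
    (ask 5 skip (ask 3 (swapZone (lem 3 (1 ∷ 2 ∷ 3 ∷ []) [])) (swapZone (lem 4 (0 ∷ 1 ∷ 2 ∷ 4 ∷ []) []))))))))) skip)
    skip) ∷ lem 3 (1 ∷ 2 ∷ 5 ∷ []) [] ∷ skip ∷ lem 1 (1 ∷ 2 ∷ 5 ∷ 3 ∷ []) ((1F , 4F) ∷ []) ∷ []))))) skip))

  -- The case in which `z`, `x`, `y` form a triangle in colours 0, 1, 2.

  -- The path `z y x` is a component in colours 0 and 2, so the chain of the free vertex 4 avoids it
  -- and may be exchanged temporarily. The net effect is that the colour-0 edge at `x` moves from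
  -- `y` to vertex 4, which takes over the role of `y` with 3 and 4 interchanged.
  triangle-t-free : Strategy
  triangle-t-free = strategy every (t-free ∷ t-misses-2 ∷ u-misses-4 ∷ t-misses-3 ∷ [])
    (around 5 ((0 , 0F , 0) ∷ (0 , 1F , 1) ∷ (0 , 2F , 2) ∷ (1 , 0F , 2) ∷ (1 , 2F , 1) ∷ (1 , 3F , 3) ∷ (1 , 4F , 4)
    ∷ (2 , 1F , 3) ∷ (2 , 3F , 2) ∷ (3 , 4F , 3) ∷ (4 , 0F , 4) ∷ []))
    (trace 0F 2F 4 (ask 0 (ask 2 (ask 1 skip skip) skip) (ask 2 skip (ask 1 skip (detour ((2F , 4F , (1 ∷ 4 ∷ [])) ∷
    (3F , 4F , (1 ∷ 3 ∷ [])) ∷ (0F , 3F , (1 ∷ 2 ∷ [])) ∷ []) ((1 , true) ∷ (2 , false) ∷ (4 , true) ∷ []) (name 4 1F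
    (skip ∷ skip ∷ skip ∷ skip ∷ skip ∷ []) (lem 0 (0 ∷ 1 ∷ 4 ∷ 5 ∷ []) ((3F , 4F) ∷ []) ∷ skip ∷ lem 1 (0 ∷ 1 ∷ 4 ∷ 5
    ∷ []) ((3F , 4F) ∷ []) ∷ lem 2 (0 ∷ 1 ∷ 4 ∷ 3 ∷ 5 ∷ []) ((3F , 4F) ∷ []) ∷ lem 3 (0 ∷ 1 ∷ 4 ∷ 5 ∷ []) ((3F , 4F) ∷
    []) ∷ [])))))))

  triangle-t-shared : Strategy
  triangle-t-shared = strategy every (r-misses-3 ∷ r-misses-2 ∷ t-misses-3 ∷ t-misses-2 ∷ [])
    (around 5 ((0 , 0F , 0) ∷ (0 , 1F , 1) ∷ (0 , 2F , 2) ∷ (0 , 3F , 4) ∷ (1 , 0F , 2) ∷ (1 , 2F , 1) ∷ (1 , 3F , 3)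
    ∷ (1 , 4F , 4) ∷ (2 , 1F , 3) ∷ (2 , 3F , 2) ∷ (3 , 4F , 3) ∷ (4 , 1F , 4) ∷ []))
    (exchange 0F 2F (0 ∷ 1 ∷ 2 ∷ []) (trace 3F 4F 2 (ask 0 (ask 4 (ask 1 (ask 3 (name 0 4F (skip ∷ skip ∷ skip ∷ skip
    ∷ skip ∷ []) (ask 5 (exchange 0F 2F (0 ∷ 1 ∷ 2 ∷ []) (trace 0F 2F 5 (ask 0 (ask 2 (ask 1 skip skip) skip) (ask 2
    skip (ask 1 skip (name 2 4F (skip ∷ skip ∷ skip ∷ skip ∷ skip ∷ skip ∷ []) (exchange 0F 4F (0 ∷ 5 ∷ []) (exchange
    1F 4F (0 ∷ 1 ∷ 4 ∷ []) (exchange 0F 4F (0 ∷ 1 ∷ 2 ∷ 5 ∷ 6 ∷ []) win)) ∷ exchange 1F 3F (0 ∷ 1 ∷ 2 ∷ 3 ∷ 4 ∷ [])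
    (lem 0 (0 ∷ 1 ∷ 2 ∷ 6 ∷ []) ((1F , 3F) ∷ [])) ∷ lem 1 (0 ∷ 1 ∷ 2 ∷ 6 ∷ []) [] ∷ lem 0 (0 ∷ 1 ∷ 2 ∷ 6 ∷ []) [] ∷
    skip ∷ []))))))) skip ∷ ask 5 (exchange 1F 3F (0 ∷ 1 ∷ 2 ∷ 3 ∷ 4 ∷ []) (exchange 1F 4F (0 ∷ 1 ∷ 3 ∷ 4 ∷ 5 ∷ [])
    (lem 2 (1 ∷ 0 ∷ 2 ∷ 3 ∷ []) ((1F , 3F) ∷ [])))) skip ∷ ask 5 (exchange 2F 4F (0 ∷ 5 ∷ []) (lem 3 (1 ∷ 0 ∷ 2 ∷ 3 ∷
    []) ((2F , 4F) ∷ []))) skip ∷ ask 5 skip skip ∷ skip ∷ [])) skip) skip) skip) (ask 4 skip (ask 1 skip (ask 3 skip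
    (swapZone (lem 2 (1 ∷ 0 ∷ 2 ∷ 3 ∷ []) ((3F , 4F) ∷ [])))))))))

  triangle-t-twin : Strategy
  triangle-t-twin = strategy every (fan₂-repeat ∷ [])
    (around 6 ((0 , 0F , 0) ∷ (0 , 1F , 1) ∷ (0 , 2F , 2) ∷ (0 , 3F , 5) ∷ (1 , 0F , 2) ∷ (1 , 2F , 1) ∷ (1 , 3F , 3)
    ∷ (1 , 4F , 4) ∷ (2 , 1F , 3) ∷ (2 , 3F , 2) ∷ (3 , 4F , 3) ∷ (4 , 1F , 4) ∷ (5 , 1F , 5) ∷ []))
    (exchange 1F 3F (0 ∷ 1 ∷ 2 ∷ 3 ∷ 5 ∷ []) (lem 0 (1 ∷ 2 ∷ 3 ∷ 4 ∷ []) ((3F , 1F) ∷ (1F , 4F) ∷ [])))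

  -- Exchanging 0 and 2 on the path `z y x` frees `x` and covers `z`: the two swap roles at equal
  -- potential. So what is known about neighbours of `x` can also be applied to those of `z`.
  triangle-t-1 : Strategy
  triangle-t-1 = strategy every (triangle-t-shared ∷ u-free-t ∷ triangle-t-twin ∷ fan₁ ∷ u-misses-4 ∷ [])
    (around 5 ((0 , 0F , 0) ∷ (0 , 1F , 1) ∷ (0 , 2F , 2) ∷ (1 , 0F , 2) ∷ (1 , 2F , 1) ∷ (1 , 3F , 3) ∷ (1 , 4F , 4)
    ∷ (2 , 1F , 3) ∷ (2 , 3F , 2) ∷ (3 , 4F , 3) ∷ (4 , 1F , 4) ∷ []))
    (exchange 0F 2F (0 ∷ 1 ∷ 2 ∷ []) (name 0 3F (exchange 0F 2F (0 ∷ 1 ∷ 2 ∷ []) (lem 0 (0 ∷ 1 ∷ 2 ∷ 3 ∷ 4 ∷ []) []) ∷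
    skip ∷ skip ∷ skip ∷ skip ∷ []) (lem 1 (1 ∷ 0 ∷ 2 ∷ 5 ∷ 3 ∷ []) [] ∷ exchange 0F 2F (0 ∷ 1 ∷ 2 ∷ []) (lem 2 (0 ∷ 1
    ∷ 2 ∷ 3 ∷ 4 ∷ 5 ∷ []) []) ∷ lem 3 (0 ∷ 2 ∷ 5 ∷ []) [] ∷ skip ∷ lem 4 (1 ∷ 0 ∷ 2 ∷ 5 ∷ 3 ∷ []) [] ∷ [])))

  triangle-t : Strategy
  triangle-t = strategy every (triangle-t-free ∷ triangle-t-1 ∷ fan₂ ∷ fan₂-repeat ∷ [])
    (around 4 ((0 , 0F , 0) ∷ (0 , 1F , 1) ∷ (0 , 2F , 2) ∷ (1 , 0F , 2) ∷ (1 , 2F , 1) ∷ (1 , 3F , 3) ∷ (2 , 1F , 3)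
    ∷ (2 , 3F , 2) ∷ (3 , 4F , 3) ∷ []))
    (name 1 4F (skip ∷ skip ∷ skip ∷ skip ∷ []) (lem 0 (0 ∷ 1 ∷ 2 ∷ 3 ∷ 4 ∷ []) [] ∷ lem 1 (0 ∷ 1 ∷ 2 ∷ 3 ∷ 4 ∷ []) []
    ∷ lem 2 (1 ∷ 2 ∷ 3 ∷ 4 ∷ []) ((1F , 4F) ∷ []) ∷ lem 3 (1 ∷ 2 ∷ 3 ∷ 4 ∷ []) ((1F , 4F) ∷ []) ∷ skip ∷ []))

  -- The 3-neighbours of `x` and `z` both miss 1 and close a 1-3 path through `zx`. Its exchange
  -- gives `zx` colour 3, which `y` misses.
  triangle-1-twin : Strategy
  triangle-1-twin = strategy (those (0F ∷ 1F ∷ 3F ∷ [])) (shortPath ∷ [])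
    (around 5 ((0 , 0F , 0) ∷ (0 , 1F , 1) ∷ (0 , 2F , 2) ∷ (0 , 3F , 4) ∷ (1 , 0F , 2) ∷ (1 , 2F , 1) ∷ (1 , 3F , 3)
    ∷ (2 , 3F , 2) ∷ (3 , 1F , 3) ∷ (4 , 1F , 4) ∷ []))
    (exchange 1F 3F (0 ∷ 1 ∷ 3 ∷ 4 ∷ []) (lem 0 (0 ∷ 1 ∷ 2 ∷ []) ((1F , 3F) ∷ [])))

  triangle-1 : Strategy
  triangle-1 = strategy every (t-free ∷ t-misses-2 ∷ t-misses-3 ∷ triangle-t ∷ u-free-t ∷ triangle-1-twin ∷ fan₁ ∷ u-misses-4 ∷ [])
    (around 4 ((0 , 0F , 0) ∷ (0 , 1F , 1) ∷ (0 , 2F , 2) ∷ (1 , 0F , 2) ∷ (1 , 2F , 1) ∷ (1 , 3F , 3) ∷ (2 , 3F , 2)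
    ∷ (3 , 1F , 3) ∷ []))
    (name 2 1F (skip ∷ skip ∷ skip ∷ skip ∷ []) (lem 0 (0 ∷ 1 ∷ 2 ∷ 4 ∷ []) [] ∷ skip ∷ lem 1 (0 ∷ 1 ∷ 2 ∷ 4 ∷ []) []
    ∷ lem 2 (0 ∷ 1 ∷ 2 ∷ 4 ∷ []) [] ∷ exchange 0F 2F (0 ∷ 1 ∷ 2 ∷ []) (name 0 3F (lem 3 (1 ∷ 0 ∷ 2 ∷ 4 ∷ []) [] ∷ skip
    ∷ skip ∷ skip ∷ skip ∷ []) (lem 4 (1 ∷ 0 ∷ 2 ∷ 5 ∷ 4 ∷ []) [] ∷ lem 5 (1 ∷ 0 ∷ 2 ∷ 5 ∷ 3 ∷ []) [] ∷ lem 6 (0 ∷ 2 ∷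
    5 ∷ []) [] ∷ skip ∷ lem 7 (1 ∷ 0 ∷ 2 ∷ 5 ∷ 4 ∷ []) [] ∷ [])) ∷ []))

  triangle-4 : Strategy
  triangle-4 = strategy every (triangle-t ∷ t-free ∷ t-misses-2 ∷ t-misses-3 ∷ u-misses-4 ∷ [])
    (around 4 ((0 , 0F , 0) ∷ (0 , 1F , 1) ∷ (0 , 2F , 2) ∷ (1 , 0F , 2) ∷ (1 , 2F , 1) ∷ (1 , 3F , 3) ∷ (2 , 3F , 2)
    ∷ (3 , 4F , 3) ∷ []))
    (name 2 1F (lem 0 (0 ∷ 1 ∷ 2 ∷ 3 ∷ []) [] ∷ skip ∷ skip ∷ skip ∷ []) (lem 1 (0 ∷ 1 ∷ 2 ∷ 4 ∷ []) [] ∷ skip ∷ lem 2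
    (0 ∷ 1 ∷ 2 ∷ 4 ∷ []) [] ∷ lem 3 (0 ∷ 1 ∷ 2 ∷ 4 ∷ []) [] ∷ lem 4 (0 ∷ 1 ∷ 2 ∷ 3 ∷ 4 ∷ []) [] ∷ []))

  triangle : Strategy
  triangle = strategy every (u-free ∷ triangle-1 ∷ fan₁ ∷ triangle-4 ∷ [])
    (around 3 ((0 , 0F , 0) ∷ (0 , 1F , 1) ∷ (0 , 2F , 2) ∷ (1 , 0F , 2) ∷ (1 , 2F , 1) ∷ (2 , 3F , 2) ∷ []))
    (name 1 3F (skip ∷ skip ∷ skip ∷ []) (lem 0 (0 ∷ 1 ∷ 2 ∷ 3 ∷ []) [] ∷ lem 1 (0 ∷ 1 ∷ 2 ∷ 3 ∷ []) [] ∷ lem 2 (1 ∷ 2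
    ∷ 3 ∷ []) [] ∷ skip ∷ lem 3 (0 ∷ 1 ∷ 2 ∷ 3 ∷ []) [] ∷ []))

  -- The case in which `r` is free.

  -- If the 0-3 chain of `z` avoids `x`, then `x` is first made to miss 3; the temporary exchange
  -- lets `z` miss 3 too. Then `zx` takes colour 3, a rotation at `x` removes colour 0 from `xy`,
  -- and undoing the exchange on `z` and `x` turns `zx` into colour 0.
  apart-s : Strategy
  apart-s = strategy every (bothFree ∷ [])
    (around 6 ((0 , 0F , 0) ∷ (0 , 1F , 1) ∷ (1 , 0F , 2) ∷ (1 , 2F , 1) ∷ (1 , 3F , 3) ∷ (2 , 1F , 4) ∷ (2 , 2F , 3)
    ∷ (2 , 3F , 2) ∷ (2 , 4F , 5) ∷ (3 , 1F , 3) ∷ (4 , 4F , 4) ∷ (5 , 0F , 5) ∷ []))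
    (trace 0F 3F 0 (ask 1 (ask 2 (ask 3 (ask 5 skip (detour ((0F , 4F , (2 ∷ 5 ∷ [])) ∷ (1F , 4F , (2 ∷ 4 ∷ [])) ∷ (1F
    , 2F , (2 ∷ 3 ∷ [])) ∷ (2F , 3F , (1 ∷ 2 ∷ [])) ∷ []) ((1 , true) ∷ (2 , false) ∷ (5 , false) ∷ []) (lem 0 (0 ∷ 1
    ∷ []) []))) skip) skip) (ask 2 skip (ask 3 skip (exchange 2F 3F (1 ∷ 2 ∷ 3 ∷ []) (detour ((1F , 3F , (0 ∷ 1 ∷ []))
    ∷ (1F , 2F , (1 ∷ 3 ∷ [])) ∷ (0F , 2F , (1 ∷ 2 ∷ [])) ∷ []) ((0 , true) ∷ (1 , true) ∷ (2 , false) ∷ []) win))))))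

  -- Three exchanges on named paths move the colour-0 edge of `x` from `y` to its 4-neighbour and
  -- leave `y` and `r` free. The 4-neighbour becomes the new `y`, with 3 and 4 interchanged.
  apart-t-free : Strategy
  apart-t-free = strategy every (t-free ∷ t-misses-2 ∷ u-misses-4 ∷ t-misses-3 ∷ [])
    (around 7 ((0 , 0F , 0) ∷ (0 , 1F , 1) ∷ (1 , 0F , 2) ∷ (1 , 2F , 1) ∷ (1 , 3F , 4) ∷ (1 , 4F , 6) ∷ (2 , 1F , 4)
    ∷ (2 , 2F , 3) ∷ (2 , 3F , 2) ∷ (2 , 4F , 5) ∷ (3 , 1F , 3) ∷ (4 , 4F , 4) ∷ (5 , 0F , 5) ∷ (6 , 0F , 6) ∷ []))
    (exchange 0F 4F (1 ∷ 2 ∷ 5 ∷ 6 ∷ []) (exchange 3F 4F (1 ∷ 2 ∷ 4 ∷ []) (exchange 0F 4F (2 ∷ 5 ∷ []) (name 6 1F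
    (skip ∷ lem 0 (0 ∷ 1 ∷ 6 ∷ 5 ∷ []) ((3F , 4F) ∷ []) ∷ skip ∷ skip ∷ skip ∷ skip ∷ skip ∷ []) (lem 0 (0 ∷ 1 ∷ 6 ∷ 7
    ∷ []) ((3F , 4F) ∷ []) ∷ skip ∷ lem 1 (0 ∷ 1 ∷ 6 ∷ 7 ∷ []) ((3F , 4F) ∷ []) ∷ lem 2 (0 ∷ 1 ∷ 6 ∷ 4 ∷ 7 ∷ []) ((3F
    , 4F) ∷ []) ∷ lem 3 (0 ∷ 1 ∷ 6 ∷ 7 ∷ []) ((3F , 4F) ∷ []) ∷ [])))))

  apart-t-1 : Strategy
  apart-t-1 = strategy every (t-free ∷ s-misses-4 ∷ [])
    (around 7 ((0 , 0F , 0) ∷ (0 , 1F , 1) ∷ (1 , 0F , 2) ∷ (1 , 2F , 1) ∷ (1 , 3F , 4) ∷ (1 , 4F , 6) ∷ (2 , 1F , 4)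
    ∷ (2 , 2F , 3) ∷ (2 , 3F , 2) ∷ (2 , 4F , 5) ∷ (3 , 1F , 3) ∷ (4 , 4F , 4) ∷ (5 , 0F , 5) ∷ (6 , 1F , 6) ∷ []))
    (trace 1F 4F 3 (ask 0 (ask 1 (ask 6 (ask 4 skip (ask 2 skip (ask 5 skip (swapZone (lem 0 (0 ∷ 1 ∷ 2 ∷ 5 ∷ []) ((1F
    , 4F) ∷ [])))))) skip) skip) (ask 1 skip (ask 6 skip (ask 2 (ask 4 (ask 5 (swapZone (lem 0 (0 ∷ 1 ∷ 2 ∷ 5 ∷ [])
    [])) skip) skip) (ask 4 skip (ask 5 skip (swapZone (lem 1 (0 ∷ 1 ∷ 2 ∷ 3 ∷ []) [])))))))))

  apart-t-s : Strategy
  apart-t-s = strategy every (fan₁ ∷ t-free ∷ fan₂ ∷ [])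
    (around 6 ((0 , 0F , 0) ∷ (0 , 1F , 1) ∷ (1 , 0F , 2) ∷ (1 , 2F , 1) ∷ (1 , 3F , 4) ∷ (1 , 4F , 3) ∷ (2 , 1F , 4)
    ∷ (2 , 2F , 3) ∷ (2 , 3F , 2) ∷ (2 , 4F , 5) ∷ (3 , 1F , 3) ∷ (4 , 4F , 4) ∷ (5 , 0F , 5) ∷ []))
    (trace 1F 4F 4 (ask 2 (ask 5 (ask 0 (ask 1 (ask 3 (name 5 1F (skip ∷ skip ∷ skip ∷ skip ∷ skip ∷ skip ∷ []) (ask 6
    (exchange 0F 1F (5 ∷ 6 ∷ []) (exchange 1F 4F (2 ∷ 4 ∷ 5 ∷ []) (exchange 0F 1F (0 ∷ 1 ∷ 2 ∷ 5 ∷ 6 ∷ []) win))) skip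
    ∷ skip ∷ ask 6 (trace 2F 4F 6 (ask 1 (ask 3 (ask 2 (ask 5 (ask 4 skip (swapZone (lem 0 (1 ∷ 2 ∷ 4 ∷ []) ((2F , 4F)
    ∷ [])))) skip) skip) skip) (ask 3 skip (ask 2 skip (ask 5 skip (ask 4 (swapZone (lem 0 (1 ∷ 2 ∷ 4 ∷ []) []))
    (swapZone (exchange 1F 4F (2 ∷ 4 ∷ 5 ∷ 6 ∷ []) (lem 1 (0 ∷ 1 ∷ 2 ∷ 5 ∷ []) []))))))))) skip ∷ ask 6 (trace 3F 4F 6
    (ask 1 (ask 4 (ask 3 (ask 2 skip (ask 5 skip (swapZone (lem 2 (2 ∷ 1 ∷ 3 ∷ 4 ∷ []) ((2F , 3F) ∷ []))))) skip)
    skip) (ask 4 skip (ask 3 skip (ask 2 (ask 5 (swapZone (lem 2 (2 ∷ 1 ∷ 3 ∷ 4 ∷ []) ((3F , 2F) ∷ (2F , 4F) ∷ [])))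
    skip) (ask 5 skip (swapZone (exchange 1F 4F (2 ∷ 4 ∷ 5 ∷ 6 ∷ []) (lem 1 (0 ∷ 1 ∷ 2 ∷ 5 ∷ []) []))))))))) skip ∷
    ask 6 skip skip ∷ [])) skip) skip) (ask 1 skip (ask 3 skip (swapZone (lem 1 (0 ∷ 1 ∷ 2 ∷ 5 ∷ []) []))))) skip)
    skip))

  apart-t : Strategy
  apart-t = strategy every (apart-t-s ∷ apart-t-free ∷ apart-t-1 ∷ fan₂ ∷ fan₂-repeat ∷ [])
    (around 6 ((0 , 0F , 0) ∷ (0 , 1F , 1) ∷ (1 , 0F , 2) ∷ (1 , 2F , 1) ∷ (1 , 3F , 4) ∷ (2 , 1F , 4) ∷ (2 , 2F , 3)
    ∷ (2 , 3F , 2) ∷ (2 , 4F , 5) ∷ (3 , 1F , 3) ∷ (4 , 4F , 4) ∷ (5 , 0F , 5) ∷ []))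
    (name 1 4F (skip ∷ skip ∷ lem 0 (0 ∷ 1 ∷ 2 ∷ 3 ∷ 4 ∷ 5 ∷ []) [] ∷ skip ∷ skip ∷ skip ∷ []) (lem 1 (0 ∷ 1 ∷ 2 ∷ 3 ∷
    4 ∷ 5 ∷ 6 ∷ []) [] ∷ lem 2 (0 ∷ 1 ∷ 2 ∷ 3 ∷ 4 ∷ 5 ∷ 6 ∷ []) [] ∷ lem 3 (1 ∷ 2 ∷ 4 ∷ 6 ∷ []) ((1F , 4F) ∷ []) ∷ lem
    4 (1 ∷ 2 ∷ 4 ∷ 6 ∷ []) ((1F , 4F) ∷ []) ∷ skip ∷ []))

  -- The case in which `r` is `z`.

  joined-s : Strategy
  joined-s = strategy every (shortPath ∷ t-misses-2 ∷ s-misses-4 ∷ [])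
    (around 5 ((0 , 0F , 0) ∷ (0 , 1F , 1) ∷ (0 , 4F , 2) ∷ (1 , 0F , 2) ∷ (1 , 2F , 1) ∷ (1 , 3F , 3) ∷ (2 , 1F , 4)
    ∷ (2 , 2F , 3) ∷ (2 , 3F , 2) ∷ (3 , 1F , 3) ∷ (4 , 4F , 4) ∷ []))
    (trace 1F 4F 3 (ask 0 (ask 1 (ask 2 (ask 4 (name 1 4F (skip ∷ skip ∷ skip ∷ skip ∷ skip ∷ []) (ask 5 (exchange 0F
    4F (0 ∷ 1 ∷ 2 ∷ 5 ∷ []) (exchange 1F 4F (0 ∷ 1 ∷ 2 ∷ 4 ∷ []) (exchange 1F 3F (1 ∷ 2 ∷ 3 ∷ []) (exchange 0F 1F (0 ∷
    2 ∷ []) (lem 0 (0 ∷ 1 ∷ 5 ∷ []) ((3F , 1F) ∷ (1F , 4F) ∷ [])))))) skip ∷ ask 5 skip skip ∷ ask 5 (exchange 2F 4F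
    (1 ∷ 5 ∷ []) (lem 1 (0 ∷ 1 ∷ 2 ∷ 4 ∷ []) ((2F , 4F) ∷ []))) skip ∷ ask 5 (exchange 2F 3F (1 ∷ 2 ∷ 3 ∷ [])
    (exchange 3F 4F (1 ∷ 5 ∷ []) (lem 1 (0 ∷ 1 ∷ 2 ∷ 4 ∷ []) ((3F , 2F) ∷ (2F , 4F) ∷ [])))) skip ∷ skip ∷ [])) skip)
    skip) skip) (ask 1 skip (ask 2 skip (ask 4 skip (swapZone (lem 2 (0 ∷ 1 ∷ 2 ∷ 3 ∷ []) [])))))))

  joined-t-free : Strategy
  joined-t-free = strategy (those (0F ∷ 1F ∷ 3F ∷ 4F ∷ [])) (shortPath ∷ [])
    (around 6 ((0 , 0F , 0) ∷ (0 , 1F , 1) ∷ (0 , 4F , 2) ∷ (1 , 0F , 2) ∷ (1 , 2F , 1) ∷ (1 , 3F , 4) ∷ (1 , 4F , 5)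
    ∷ (2 , 1F , 4) ∷ (2 , 2F , 3) ∷ (2 , 3F , 2) ∷ (3 , 1F , 3) ∷ (4 , 4F , 4) ∷ (5 , 0F , 5) ∷ []))
    (exchange 0F 4F (0 ∷ 1 ∷ 2 ∷ 5 ∷ []) (exchange 3F 4F (1 ∷ 2 ∷ 4 ∷ []) (exchange 0F 4F (0 ∷ 2 ∷ []) (exchange 1F 4F
    (0 ∷ 1 ∷ 2 ∷ 4 ∷ []) (lem 0 (0 ∷ 1 ∷ 5 ∷ []) ((3F , 1F) ∷ (1F , 4F) ∷ []))))))

  joined-t-1 : Strategy
  joined-t-1 = strategy every (s-misses-4 ∷ [])
    (around 6 ((0 , 0F , 0) ∷ (0 , 1F , 1) ∷ (0 , 4F , 2) ∷ (1 , 0F , 2) ∷ (1 , 2F , 1) ∷ (1 , 3F , 4) ∷ (1 , 4F , 5)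
    ∷ (2 , 1F , 4) ∷ (2 , 2F , 3) ∷ (2 , 3F , 2) ∷ (3 , 1F , 3) ∷ (4 , 4F , 4) ∷ (5 , 1F , 5) ∷ []))
    (exchange 1F 4F (0 ∷ 1 ∷ 2 ∷ 4 ∷ 5 ∷ []) (lem 0 (0 ∷ 1 ∷ 2 ∷ 3 ∷ []) ((1F , 4F) ∷ [])))

  -- The 0-1 path `z x y t s` is exchanged. If `ts` were in `M`, this might gain nothing; but all
  -- neighbours of `y` are named, and as `x` and `z` are matched with each other, `y` is matched
  -- with `s` or `t`, so `ts` is outside `M`.
  twins-closed : Strategy
  twins-closed = strategy (those (0F ∷ 1F ∷ [])) []
    (around 5 ((0 , 0F , 0) ∷ (0 , 1F , 1) ∷ (0 , 4F , 2) ∷ (1 , 0F , 2) ∷ (1 , 2F , 1) ∷ (1 , 3F , 4) ∷ (1 , 4F , 3)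
    ∷ (2 , 1F , 4) ∷ (2 , 2F , 3) ∷ (2 , 3F , 2) ∷ (3 , 0F , 4) ∷ (3 , 1F , 3) ∷ (4 , 4F , 4) ∷ []))
    (exchange 0F 1F (0 ∷ 1 ∷ 2 ∷ 3 ∷ 4 ∷ []) (mate 2 (win ∷ skip ∷ win ∷ skip ∷ skip ∷ [])))

  -- The 0-2 path from `x` runs through `y` and `s` and ends at vertex 5, so the chain of `z` avoids
  -- it. After its temporary exchange `z` misses 2 like `x`; `zx` takes colour 2, a rotation at `x`
  -- recolours `xy` to 3, and undoing the exchange turns `zx` into colour 0.
  twins-2 : Strategy
  twins-2 = strategy every []
    (around 6 ((0 , 0F , 0) ∷ (0 , 1F , 1) ∷ (0 , 4F , 2) ∷ (1 , 0F , 2) ∷ (1 , 2F , 1) ∷ (1 , 3F , 4) ∷ (1 , 4F , 3)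
    ∷ (2 , 1F , 4) ∷ (2 , 2F , 3) ∷ (2 , 3F , 2) ∷ (3 , 0F , 5) ∷ (3 , 1F , 3) ∷ (4 , 4F , 4) ∷ (5 , 2F , 5) ∷ []))
    (trace 0F 2F 0 (ask 1 (ask 2 (ask 3 (ask 5 skip skip) skip) skip) (ask 2 skip (ask 3 skip (ask 5 skip (detour ((1F
    , 2F , (0 ∷ 1 ∷ [])) ∷ (1F , 4F , (1 ∷ 3 ∷ [])) ∷ (3F , 4F , (1 ∷ 4 ∷ [])) ∷ (0F , 3F , (1 ∷ 2 ∷ [])) ∷ []) ((0 ,
    true) ∷ (1 , true) ∷ (2 , false) ∷ []) win))))))

  twins-3 : Strategy
  twins-3 = strategy every (edgeFree ∷ twins-2 ∷ [])
    (around 6 ((0 , 0F , 0) ∷ (0 , 1F , 1) ∷ (0 , 4F , 2) ∷ (1 , 0F , 2) ∷ (1 , 2F , 1) ∷ (1 , 3F , 4) ∷ (1 , 4F , 3)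
    ∷ (2 , 1F , 4) ∷ (2 , 2F , 3) ∷ (2 , 3F , 2) ∷ (3 , 0F , 5) ∷ (3 , 1F , 3) ∷ (4 , 4F , 4) ∷ (5 , 3F , 5) ∷ []))
    (trace 2F 3F 5 (ask 1 (ask 4 (ask 2 skip (ask 3 skip (swapZone (lem 0 (1 ∷ 2 ∷ []) ((2F , 3F) ∷ []))))) skip) (ask
    4 skip (ask 2 (ask 3 (swapZone (lem 0 (1 ∷ 2 ∷ []) [])) skip) (ask 3 skip (swapZone (lem 1 (0 ∷ 1 ∷ 2 ∷ 3 ∷ 4 ∷ 5
    ∷ []) [])))))))

  twins-4 : Strategy
  twins-4 = strategy every (twins-3 ∷ fan₂ ∷ [])
    (around 6 ((0 , 0F , 0) ∷ (0 , 1F , 1) ∷ (0 , 4F , 2) ∷ (1 , 0F , 2) ∷ (1 , 2F , 1) ∷ (1 , 3F , 4) ∷ (1 , 4F , 3)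
    ∷ (2 , 1F , 4) ∷ (2 , 2F , 3) ∷ (2 , 3F , 2) ∷ (3 , 0F , 5) ∷ (3 , 1F , 3) ∷ (4 , 4F , 4) ∷ (5 , 4F , 5) ∷ []))
    (trace 3F 4F 4 (ask 1 (ask 3 (ask 0 (ask 2 (ask 5 skip (swapZone (lem 0 (0 ∷ 1 ∷ 2 ∷ 3 ∷ 4 ∷ 5 ∷ []) ((3F , 4F) ∷
    [])))) skip) (ask 2 skip (ask 5 (swapZone (lem 1 (2 ∷ 1 ∷ 3 ∷ 4 ∷ []) ((2F , 3F) ∷ []))) (swapZone (lem 1 (2 ∷ 1 ∷
    3 ∷ 4 ∷ []) ((2F , 3F) ∷ [])))))) skip) skip))

  twins-1 : Strategy
  twins-1 = strategy every (twins-4 ∷ [])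
    (around 6 ((0 , 0F , 0) ∷ (0 , 1F , 1) ∷ (0 , 4F , 2) ∷ (1 , 0F , 2) ∷ (1 , 2F , 1) ∷ (1 , 3F , 4) ∷ (1 , 4F , 3)
    ∷ (2 , 1F , 4) ∷ (2 , 2F , 3) ∷ (2 , 3F , 2) ∷ (3 , 0F , 5) ∷ (3 , 1F , 3) ∷ (4 , 4F , 4) ∷ (5 , 1F , 5) ∷ []))
    (exchange 1F 4F (0 ∷ 1 ∷ 2 ∷ 3 ∷ 4 ∷ []) (lem 0 (0 ∷ 1 ∷ 2 ∷ 3 ∷ 4 ∷ 5 ∷ []) ((1F , 4F) ∷ [])))

  twins : Strategy
  twins = strategy every (twins-closed ∷ twins-1 ∷ twins-2 ∷ twins-3 ∷ twins-4 ∷ [])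
    (around 5 ((0 , 0F , 0) ∷ (0 , 1F , 1) ∷ (0 , 4F , 2) ∷ (1 , 0F , 2) ∷ (1 , 2F , 1) ∷ (1 , 3F , 4) ∷ (1 , 4F , 3)
    ∷ (2 , 1F , 4) ∷ (2 , 2F , 3) ∷ (2 , 3F , 2) ∷ (3 , 1F , 3) ∷ (4 , 4F , 4) ∷ []))
    (name 3 0F (lem 0 (0 ∷ 1 ∷ 2 ∷ 3 ∷ 4 ∷ []) [] ∷ skip ∷ skip ∷ skip ∷ skip ∷ []) (skip ∷ lem 1 (0 ∷ 1 ∷ 2 ∷ 3 ∷ 4 ∷
    5 ∷ []) [] ∷ lem 2 (0 ∷ 1 ∷ 2 ∷ 3 ∷ 4 ∷ 5 ∷ []) [] ∷ lem 3 (0 ∷ 1 ∷ 2 ∷ 3 ∷ 4 ∷ 5 ∷ []) [] ∷ lem 4 (0 ∷ 1 ∷ 2 ∷ 3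
    ∷ 4 ∷ 5 ∷ []) [] ∷ []))

  joined-t : Strategy
  joined-t = strategy every (twins ∷ joined-t-free ∷ joined-t-1 ∷ fan₂ ∷ fan₂-repeat ∷ [])
    (around 5 ((0 , 0F , 0) ∷ (0 , 1F , 1) ∷ (0 , 4F , 2) ∷ (1 , 0F , 2) ∷ (1 , 2F , 1) ∷ (1 , 3F , 4) ∷ (2 , 1F , 4)
    ∷ (2 , 2F , 3) ∷ (2 , 3F , 2) ∷ (3 , 1F , 3) ∷ (4 , 4F , 4) ∷ []))
    (name 1 4F (skip ∷ lem 0 (0 ∷ 1 ∷ 2 ∷ 3 ∷ 4 ∷ []) [] ∷ skip ∷ skip ∷ skip ∷ []) (lem 1 (0 ∷ 1 ∷ 2 ∷ 3 ∷ 4 ∷ 5 ∷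
    []) [] ∷ lem 2 (0 ∷ 1 ∷ 2 ∷ 3 ∷ 4 ∷ 5 ∷ []) [] ∷ lem 3 (1 ∷ 2 ∷ 4 ∷ 5 ∷ []) ((1F , 4F) ∷ []) ∷ lem 4 (1 ∷ 2 ∷ 4 ∷
    5 ∷ []) ((1F , 4F) ∷ []) ∷ skip ∷ []))

  -- Assembling the cases around a free vertex.

  joined : Strategy
  joined = strategy every (t-free ∷ fan₂-repeat ∷ fan₂ ∷ joined-s ∷ joined-t ∷ u-free-t ∷ s-misses-4 ∷ u-misses-4 ∷ fan₁ ∷ [])
    (around 4 ((0 , 0F , 0) ∷ (0 , 1F , 1) ∷ (0 , 4F , 2) ∷ (1 , 0F , 2) ∷ (1 , 2F , 1) ∷ (2 , 2F , 3) ∷ (2 , 3F , 2)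
    ∷ (3 , 1F , 3) ∷ []))
    (name 2 1F (skip ∷ skip ∷ skip ∷ skip ∷ []) (lem 0 (0 ∷ 1 ∷ 2 ∷ 4 ∷ []) [] ∷ skip ∷ lem 1 (2 ∷ 1 ∷ 3 ∷ 4 ∷ [])
    ((2F , 3F) ∷ []) ∷ lem 2 (2 ∷ 1 ∷ 3 ∷ 4 ∷ []) ((2F , 3F) ∷ []) ∷ name 1 3F (lem 4 (0 ∷ 1 ∷ 2 ∷ 3 ∷ 4 ∷ []) [] ∷
    lem 3 (0 ∷ 1 ∷ 2 ∷ 3 ∷ 4 ∷ []) [] ∷ skip ∷ skip ∷ skip ∷ []) (lem 5 (0 ∷ 1 ∷ 2 ∷ 5 ∷ 4 ∷ []) [] ∷ trace 1F 4F 5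
    (ask 0 (ask 1 (ask 2 (ask 4 (ask 3 skip (swapZone (lem 6 (0 ∷ 1 ∷ 2 ∷ 3 ∷ []) ((1F , 4F) ∷ [])))) skip) skip)
    skip) (ask 1 skip (ask 2 skip (ask 4 skip (ask 3 (swapZone (lem 6 (0 ∷ 1 ∷ 2 ∷ 3 ∷ []) [])) (swapZone (lem 7 (0 ∷
    1 ∷ 2 ∷ 5 ∷ 4 ∷ []) []))))))) ∷ lem 8 (1 ∷ 2 ∷ 5 ∷ []) [] ∷ skip ∷ lem 7 (0 ∷ 1 ∷ 2 ∷ 5 ∷ 4 ∷ []) [] ∷ []) ∷ []))

  apart : Strategy
  apart = strategy every (t-free ∷ fan₂-repeat ∷ fan₂ ∷ apart-s ∷ u-free-t ∷ apart-t ∷ fan₁ ∷ shortPath ∷ u-misses-4 ∷ [])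
    (around 5 ((0 , 0F , 0) ∷ (0 , 1F , 1) ∷ (1 , 0F , 2) ∷ (1 , 2F , 1) ∷ (2 , 2F , 3) ∷ (2 , 3F , 2) ∷ (2 , 4F , 4)
    ∷ (3 , 1F , 3) ∷ (4 , 0F , 4) ∷ []))
    (name 2 1F (skip ∷ skip ∷ skip ∷ skip ∷ skip ∷ []) (lem 0 (0 ∷ 1 ∷ 2 ∷ 5 ∷ []) [] ∷ skip ∷ lem 1 (2 ∷ 1 ∷ 3 ∷ 5 ∷
    []) ((2F , 3F) ∷ []) ∷ lem 2 (2 ∷ 1 ∷ 3 ∷ 5 ∷ []) ((2F , 3F) ∷ []) ∷ name 1 3F (lem 5 (0 ∷ 1 ∷ 2 ∷ 3 ∷ 5 ∷ 4 ∷ [])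
    [] ∷ lem 4 (0 ∷ 1 ∷ 2 ∷ 4 ∷ 5 ∷ []) [] ∷ lem 3 (0 ∷ 1 ∷ 2 ∷ 3 ∷ 5 ∷ 4 ∷ []) [] ∷ skip ∷ skip ∷ skip ∷ []) (lem 4
    (0 ∷ 1 ∷ 2 ∷ 6 ∷ 5 ∷ []) [] ∷ trace 1F 3F 3 (ask 0 (ask 1 (ask 6 (ask 2 skip (ask 5 skip (swapZone (lem 6 (2 ∷ 1 ∷
    3 ∷ []) ((2F , 3F) ∷ []))))) skip) skip) (ask 1 skip (ask 6 skip (ask 2 (ask 5 (swapZone (lem 7 (0 ∷ 1 ∷ 2 ∷ [])
    [])) skip) (ask 5 skip (swapZone (lem 6 (2 ∷ 1 ∷ 3 ∷ []) ((2F , 3F) ∷ [])))))))) ∷ lem 6 (1 ∷ 2 ∷ 6 ∷ []) [] ∷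
    skip ∷ lem 8 (0 ∷ 1 ∷ 2 ∷ 6 ∷ 5 ∷ []) [] ∷ []) ∷ []))

  -- As `s` misses 1, the edges `yx`, `ys`, `yt`, `yr` tend to form a fan at `y`. Unless `t` is
  -- free, which is settled directly, the fan lemmas apply except when `r` is free or equal to `z`.
  open-s : Strategy
  open-s = strategy every (t-free ∷ fan₂-repeat ∷ fan₂ ∷ joined ∷ apart ∷ fan₃-repeat′ ∷ fan₃-repeat ∷ fan₃ ∷ [])
    (around 4 ((0 , 0F , 0) ∷ (0 , 1F , 1) ∷ (1 , 0F , 2) ∷ (1 , 2F , 1) ∷ (2 , 2F , 3) ∷ (2 , 3F , 2) ∷ (3 , 1F , 3)
    ∷ []))
    (name 2 1F (skip ∷ skip ∷ skip ∷ skip ∷ []) (lem 0 (0 ∷ 1 ∷ 2 ∷ 4 ∷ []) [] ∷ skip ∷ lem 1 (2 ∷ 1 ∷ 3 ∷ 4 ∷ [])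
    ((2F , 3F) ∷ []) ∷ lem 2 (2 ∷ 1 ∷ 3 ∷ 4 ∷ []) ((2F , 3F) ∷ []) ∷ name 2 4F (skip ∷ skip ∷ skip ∷ skip ∷ lem 3 (0 ∷
    1 ∷ 2 ∷ 3 ∷ []) [] ∷ []) (lem 4 (0 ∷ 1 ∷ 2 ∷ 3 ∷ 5 ∷ []) [] ∷ lem 5 (2 ∷ 1 ∷ 3 ∷ 4 ∷ 5 ∷ []) ((2F , 3F) ∷ []) ∷
    lem 6 (2 ∷ 1 ∷ 3 ∷ 4 ∷ 5 ∷ []) ((2F , 3F) ∷ []) ∷ lem 7 (2 ∷ 1 ∷ 3 ∷ 4 ∷ 5 ∷ []) ((2F , 3F) ∷ []) ∷ skip ∷ []) ∷
    []))

  free : Strategy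
  free = strategy every (triangle ∷ s-free ∷ open-s ∷ fan₁ ∷ s-misses-4 ∷ [])
    (around 3 ((0 , 0F , 0) ∷ (0 , 1F , 1) ∷ (1 , 0F , 2) ∷ (1 , 2F , 1) ∷ (2 , 3F , 2) ∷ []))
    (name 2 2F (skip ∷ skip ∷ lem 0 (0 ∷ 1 ∷ 2 ∷ []) [] ∷ []) (lem 1 (0 ∷ 1 ∷ 2 ∷ 3 ∷ []) [] ∷ lem 2 (0 ∷ 1 ∷ 2 ∷ 3 ∷
    []) [] ∷ skip ∷ lem 3 (2 ∷ 1 ∷ 3 ∷ []) ((2F , 3F) ∷ []) ∷ lem 4 (0 ∷ 1 ∷ 2 ∷ 3 ∷ []) [] ∷ []))

  free₄ : Strategy
  free₄ = strategy (those (0F ∷ 1F ∷ 2F ∷ 3F ∷ [])) (t-free ∷ t-misses-2 ∷ t-misses-3 ∷ [])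
    (drawn 3 ((0 , 1) ∷ (1 , 0) ∷ []) [] (those (0F ∷ 1F ∷ 2F ∷ 3F ∷ [])) ((0 , 0F , 0) ∷ (0 , 1F , 1) ∷ (1 , 0F , 2)
    ∷ (1 , 2F , 1) ∷ (2 , 3F , 2) ∷ []))
    (name 2 1F (skip ∷ skip ∷ skip ∷ []) (lem 0 (0 ∷ 1 ∷ 2 ∷ 3 ∷ []) [] ∷ skip ∷ lem 1 (0 ∷ 1 ∷ 2 ∷ 3 ∷ []) [] ∷ lem 2
    (0 ∷ 1 ∷ 2 ∷ 3 ∷ []) [] ∷ skip ∷ []))

  -- From a colouring to the pattern of a strategy.

  -- The renaming is built one colour at a time; as the targets are distinct, a later transposition
  -- keeps the earlier ones in place.
  aim : Renaming → Color → Color → Renaming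
  aim ρ k x = (ren ρ k , x) ∷ ρ

  record Sends (ρ : Renaming) (i y : Color) : Set where
    constructor sends
    field sent : ren ρ i ≡ y
  open Sends

  aim-hit : ∀ ρ k x → Sends (aim ρ k x) k x
  aim-hit ρ k x = sends (swap-l (ren ρ k) x)

  aim-keep : ∀ ρ k x {i y} → Sends ρ i y → i ≢ k → y ≢ x → Sends (aim ρ k x) i y
  aim-keep ρ k x {i} (sends refl) i≢k y≢x = sends (swap-other (ren ρ k) x (ren ρ i) (i≢k ∘ ren-injective ρ) y≢x)

  naming : List V → V → ℕ → V
  naming [] d _ = d
  naming (v ∷ vs) d zero = v
  naming (v ∷ vs) d (suc i) = naming vs d i

  module Improve (act : Color → Bool) (one : Color) (active : T (act one))
                 {ν : Colouring n} (reg : Regular5 R ν) (miss : Missing act ν)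
                 (mate-active : ∀ c v → ν c v ≡ M v → T (act c)) where

    missingAt : ∀ v → ∃[ c ] ν c v ≡ v
    missingAt v = full reg (R-refl v)

    apply : (A : Strategy) (ρ : Renaming) → Sends ρ 0F one → (∀ c → T (Strategy.act A c) → T (act (ren ρ c))) → ∀ σ →
            Missing (mis (plan A)) (ν ∘ ren ρ) → Distinct (size (plan A)) σ → All (Holds (ν ∘ ren ρ) σ) (facts (plan A)) →
            All (Mates σ) (mates (plan A)) → All (Uglies σ) (uglies (plan A)) → Win act one ν
    apply A ρ (sends refl) lift named missing' dist hs ms us = win-unrename ρ lift (winning A record
      { regular = rename-regular ρ reg ; missing = missing' ; distinct = dist ; holds = hs ; mated = ms ; unmated = us })

    back : ∀ c {u v} → ν c u ≡ v → ν c v ≡ u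
    back c {u} e = trans (cong (ν c) (≡-sym e)) (invol reg c u)

    M-back : ∀ {u v} → M u ≡ v → M v ≡ u
    M-back {u} e = trans (cong M (≡-sym e)) (M-invol u)

    distinct₂ : ∀ {u v w} → u ≢ v → Distinct 2 (naming (u ∷ v ∷ []) w)
    distinct₂ p {0} {0} _ _ _ = refl
    distinct₂ p {0} {1} _ _ e = contradiction e p
    distinct₂ p {1} {0} _ _ e = contradiction (≡-sym e) p
    distinct₂ p {1} {1} _ _ _ = refl
    distinct₂ p {suc (suc _)} (s≤s (s≤s ())) _ _
    distinct₂ p {0} {suc (suc _)} _ (s≤s (s≤s ())) _
    distinct₂ p {1} {suc (suc _)} _ (s≤s (s≤s ())) _

    distinct₃ : ∀ {u v w} → u ≢ v → u ≢ w → v ≢ w → Distinct 3 (naming (u ∷ v ∷ w ∷ []) w)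
    distinct₃ p q r {0} {0} _ _ _ = refl
    distinct₃ p q r {0} {1} _ _ e = contradiction e p
    distinct₃ p q r {0} {2} _ _ e = contradiction e q
    distinct₃ p q r {1} {0} _ _ e = contradiction (≡-sym e) p
    distinct₃ p q r {1} {1} _ _ _ = refl
    distinct₃ p q r {1} {2} _ _ e = contradiction e r
    distinct₃ p q r {2} {0} _ _ e = contradiction (≡-sym e) q
    distinct₃ p q r {2} {1} _ _ e = contradiction (≡-sym e) r
    distinct₃ p q r {2} {2} _ _ _ = refl
    distinct₃ p q r {suc (suc (suc _))} (s≤s (s≤s (s≤s ()))) _ _
    distinct₃ p q r {0} {suc (suc (suc _))} _ (s≤s (s≤s (s≤s ()))) _
    distinct₃ p q r {1} {suc (suc (suc _))} _ (s≤s (s≤s (s≤s ()))) _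
    distinct₃ p q r {2} {suc (suc (suc _))} _ (s≤s (s≤s (s≤s ()))) _

    holds-at : ∀ {ρ c d} → Sends ρ c d → ∀ {u v} → ν d u ≡ v → ν (ren ρ c) u ≡ v
    holds-at (sends refl) e = e

    active-at : ∀ {ρ c d} → Sends ρ c d → T (act d) → T (act (ren ρ c))
    active-at (sends refl) p = p

    module _ {x y : V} (x-y : ν one x ≡ y) (x≢y : x ≢ y) (Mx≢y : M x ≢ y) {d a : Color} (x-d : ν d x ≡ x) (y-a : ν a y ≡ y) where

      private
        one≢d : one ≢ d
        one≢d refl = x≢y (trans (≡-sym x-d) x-y)
        one≢a : one ≢ a
        one≢a refl = x≢y (trans (≡-sym (back one x-y)) y-a)

      equal-missing : a ≡ d → Win act one ν
      equal-missing refl = apply edgeFree ρ at0 lift (naming (x ∷ y ∷ []) y) (λ _ _ _ → tt) (distinct₂ x≢y)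
        (holds-at {ρ} at0 x-y ∷ holds-at {ρ} at0 (back one x-y) ∷ holds-at {ρ} at2 x-d ∷ holds-at {ρ} at2 y-a ∷ []) [] (Mx≢y ∷ [])
        where
        ρ = aim (aim [] 0F one) 2F d
        at0 = aim-keep (aim [] 0F one) 2F d (aim-hit [] 0F one) (λ ()) one≢d
        at2 = aim-hit (aim [] 0F one) 2F d
        lift : ∀ c → T (Strategy.act edgeFree c) → T (act (ren ρ c))
        lift 0F _ = active-at {ρ} at0 active
        lift 2F _ = active-at {ρ} at2 (miss d x x-d)

      module _ (a≢d : a ≢ d) where

        private
          ρ₃ = aim (aim (aim [] 0F one) 2F d) 3F a
          at0 = aim-keep (aim (aim [] 0F one) 2F d) 3F a (aim-keep (aim [] 0F one) 2F d (aim-hit [] 0F one) (λ ()) one≢d) (λ ()) one≢a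
          at2 = aim-keep (aim (aim [] 0F one) 2F d) 3F a (aim-hit (aim [] 0F one) 2F d) (λ ()) (a≢d ∘ ≡-sym)
          at3 = aim-hit (aim (aim [] 0F one) 2F d) 3F a

        all-active? : Dec (∀ c → T (act c))
        all-active? = Finₚ.all? λ c → T? (act c)

        fifth : ∀ ρ → ¬ (∀ c → T (act c)) → T (act (ren ρ 0F)) → T (act (ren ρ 1F)) → T (act (ren ρ 2F)) → T (act (ren ρ 3F)) → ¬ T (act (ren ρ 4F))
        fifth ρ some p₀ p₁ p₂ p₃ p₄ = some λ c → subst (T ∘ act) (ren-unren ρ c) (at (unren ρ c))
          where
          at : ∀ c → T (act (ren ρ c))
          at 0F = p₀
          at 1F = p₁
          at 2F = p₂
          at 3F = p₃
          at 4F = p₄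

        -- `one`, `d` and `a` are three distinct active colours; the three strategies used are for
        -- exactly three, four and five active colours.
        no-free : (∀ v → ν one v ≢ v) → Win act one ν
        no-free none with Finₚ.any? (λ e → T? (act e) ×-dec (¬? (e Fin.≟ one) ×-dec (¬? (e Fin.≟ d) ×-dec ¬? (e Fin.≟ a))))
        ... | no ¬fourth = apply noFree₃ ρ₃ at0 lift (naming (x ∷ y ∷ []) y) missing' (distinct₂ x≢y) hs [] (Mx≢y ∷ [])
          where
          hs = holds-at {ρ₃} at0 x-y ∷ holds-at {ρ₃} at0 (back one x-y) ∷ holds-at {ρ₃} at2 x-d ∷ holds-at {ρ₃} at3 y-a ∷ []
          lift : ∀ c → T (Strategy.act noFree₃ c) → T (act (ren ρ₃ c))
          lift 0F _ = active-at {ρ₃} at0 active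
          lift 2F _ = active-at {ρ₃} at2 (miss d x x-d)
          lift 3F _ = active-at {ρ₃} at3 (miss a y y-a)
          other : ∀ c → c ≢ 0F → c ≢ 2F → c ≢ 3F → ¬ T (act (ren ρ₃ c))
          other c p q r act-c = ¬fourth (ren ρ₃ c , act-c , avoid p at0 , avoid q at2 , avoid r at3)
            where
            avoid : ∀ {i z} → c ≢ i → Sends ρ₃ i z → ren ρ₃ c ≢ z
            avoid ne e e' = ne (ren-injective ρ₃ (trans e' (≡-sym (sent e))))
          missing' : Missing (mis (plan noFree₃)) (ν ∘ ren ρ₃)
          missing' 0F v e = none v (trans (cong (λ c → ν c v) (≡-sym (sent at0))) e)
          missing' 1F v e = other 1F (λ ()) (λ ()) (λ ()) (miss _ v e)
          missing' 2F v e = tt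
          missing' 3F v e = tt
          missing' 4F v e = other 4F (λ ()) (λ ()) (λ ()) (miss _ v e)
        ... | yes (e , act-e , e≢one , e≢d , e≢a) = go all-active?
          where
          ρ = aim ρ₃ 1F e
          at0' = aim-keep ρ₃ 1F e at0 (λ ()) (e≢one ∘ ≡-sym)
          at1' = aim-hit ρ₃ 1F e
          at2' = aim-keep ρ₃ 1F e at2 (λ ()) (e≢d ∘ ≡-sym)
          at3' = aim-keep ρ₃ 1F e at3 (λ ()) (e≢a ∘ ≡-sym)
          hs = holds-at {ρ} at0' x-y ∷ holds-at {ρ} at0' (back one x-y) ∷ holds-at {ρ} at2' x-d ∷ holds-at {ρ} at3' y-a ∷ []
          p₀ = active-at {ρ} at0' active
          p₁ = active-at {ρ} at1' act-e
          p₂ = active-at {ρ} at2' (miss d x x-d)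
          p₃ = active-at {ρ} at3' (miss a y y-a)
          lift : ∀ c → T (Strategy.act noFree₄ c) → T (act (ren ρ c))
          lift 0F _ = p₀
          lift 1F _ = p₁
          lift 2F _ = p₂
          lift 3F _ = p₃
          go : Dec (∀ c → T (act c)) → Win act one ν
          go (yes every') = apply noFree ρ at0' (λ c _ → every' (ren ρ c)) (naming (x ∷ y ∷ []) y) missing' (distinct₂ x≢y) hs [] (Mx≢y ∷ [])
            where
            missing' : Missing (mis (plan noFree)) (ν ∘ ren ρ)
            missing' 0F v e = none v (trans (cong (λ c → ν c v) (≡-sym (sent at0'))) e)
            missing' 1F v e = tt
            missing' 2F v e = tt
            missing' 3F v e = tt
            missing' 4F v e = tt
          go (no some) = apply noFree₄ ρ at0' lift (naming (x ∷ y ∷ []) y) missing' (distinct₂ x≢y) hs [] (Mx≢y ∷ [])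
            where
            missing' : Missing (mis (plan noFree₄)) (ν ∘ ren ρ)
            missing' 0F v e = none v (trans (cong (λ c → ν c v) (≡-sym (sent at0'))) e)
            missing' 1F v e = tt
            missing' 2F v e = tt
            missing' 3F v e = tt
            missing' 4F v e = fifth ρ some p₀ p₁ p₂ p₃ (miss _ v e)

        free-neighbour : ∀ {z c} → M z ≡ x → ν one z ≡ z → ν c z ≡ x → Win act one ν
        free-neighbour {z} {c} Mz z-one z-c = go (a Fin.≟ c)
          where
          z≢x : z ≢ x
          z≢x refl = M-free z Mz
          y≢z : y ≢ z
          y≢z refl = Mx≢y (M-back Mz)
          one≢c : one ≢ c
          one≢c refl = z≢x (trans (≡-sym z-one) z-c)
          d≢c : d ≢ c
          d≢c refl = z≢x (trans (≡-sym (back c z-c)) x-d)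
          act-c : T (act c)
          act-c = mate-active c z (trans z-c (≡-sym Mz))
          named = naming (z ∷ x ∷ y ∷ []) y
          dist = distinct₃ z≢x (y≢z ∘ ≡-sym) x≢y
          ms = Mz ∷ M-back Mz ∷ []
          go : Dec (a ≡ c) → Win act one ν
          go (yes refl) = apply shortPath ρ b0 lift named (λ _ _ _ → tt) dist
            (holds-at {ρ} b0 z-one ∷ holds-at {ρ} b1 z-c ∷ holds-at {ρ} b1 (back c z-c) ∷ holds-at {ρ} b0 x-y ∷ holds-at {ρ} b0 (back one x-y) ∷
             holds-at {ρ} b2 x-d ∷ holds-at {ρ} b1 y-a ∷ []) ms []
            where
            ρ₂ = aim (aim [] 0F one) 2F d
            ρ = aim ρ₂ 1F c
            b0 = aim-keep ρ₂ 1F c (aim-keep (aim [] 0F one) 2F d (aim-hit [] 0F one) (λ ()) one≢d) (λ ()) one≢c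
            b2 = aim-keep ρ₂ 1F c (aim-hit (aim [] 0F one) 2F d) (λ ()) d≢c
            b1 = aim-hit ρ₂ 1F c
            lift : ∀ e → T (Strategy.act shortPath e) → T (act (ren ρ e))
            lift 0F _ = active-at {ρ} b0 active
            lift 1F _ = active-at {ρ} b1 act-c
          go (no a≢c) = go' all-active?
            where
            ρ = aim ρ₃ 1F c
            b0 = aim-keep ρ₃ 1F c at0 (λ ()) one≢c
            b1 = aim-hit ρ₃ 1F c
            b2 = aim-keep ρ₃ 1F c at2 (λ ()) d≢c
            b3 = aim-keep ρ₃ 1F c at3 (λ ()) a≢c
            hs = holds-at {ρ} b0 z-one ∷ holds-at {ρ} b1 z-c ∷ holds-at {ρ} b1 (back c z-c) ∷ holds-at {ρ} b0 x-y ∷ holds-at {ρ} b0 (back one x-y) ∷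
                 holds-at {ρ} b2 x-d ∷ holds-at {ρ} b3 y-a ∷ []
            p₀ = active-at {ρ} b0 active
            p₁ = active-at {ρ} b1 act-c
            p₂ = active-at {ρ} b2 (miss d x x-d)
            p₃ = active-at {ρ} b3 (miss a y y-a)
            lift : ∀ e → T (Strategy.act free₄ e) → T (act (ren ρ e))
            lift 0F _ = p₀
            lift 1F _ = p₁
            lift 2F _ = p₂
            lift 3F _ = p₃
            go' : Dec (∀ e → T (act e)) → Win act one ν
            go' (yes every') = apply free ρ b0 (λ e _ → every' (ren ρ e)) named (λ _ _ _ → tt) dist hs ms []
            go' (no some) = apply free₄ ρ b0 lift named missing' dist hs ms []
              where
              missing' : Missing (mis (plan free₄)) (ν ∘ ren ρ)
              missing' 0F v e = tt
              missing' 1F v e = tt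
              missing' 2F v e = tt
              missing' 3F v e = tt
              missing' 4F v e = fifth ρ some p₀ p₁ p₂ p₃ (miss _ v e)

    both-free : ∀ {z x c} → M z ≡ x → ν one z ≡ z → ν one x ≡ x → ν c z ≡ x → Win act one ν
    both-free {z} {x} {c} Mz z-one x-one z-c = apply bothFree ρ b0 lift (naming (z ∷ x ∷ []) x) (λ _ _ _ → tt) (distinct₂ z≢x)
      (holds-at {ρ} b0 z-one ∷ holds-at {ρ} b1 z-c ∷ holds-at {ρ} b1 (back c z-c) ∷ holds-at {ρ} b0 x-one ∷ []) (Mz ∷ M-back Mz ∷ []) []
      where
      z≢x : z ≢ x
      z≢x refl = M-free z Mz
      one≢c : one ≢ c
      one≢c refl = z≢x (trans (≡-sym z-one) z-c)
      ρ = aim (aim [] 0F one) 1F c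
      b0 = aim-keep (aim [] 0F one) 1F c (aim-hit [] 0F one) (λ ()) one≢c
      b1 = aim-hit (aim [] 0F one) 1F c
      lift : ∀ e → T (Strategy.act bothFree e) → T (act (ren ρ e))
      lift 0F _ = active-at {ρ} b0 active
      lift 1F _ = active-at {ρ} b1 (mate-active c z (trans z-c (≡-sym Mz)))

    -- A free vertex `z` supplies the start through its edge of `M`: its mate is free too or has a
    -- wrong edge, because `z` has no edge of colour `one`. Without free vertices the wrong edge at
    -- `v` itself is the start.
    improve : ∀ v → ν one v ≢ M v → Win act one ν
    improve v v≢ with Finₚ.any? (λ z → ν one z Fin.≟ z)
    ... | no none = let d , x-d = missingAt v
                        a , y-a = missingAt (ν one v) in
      case a Fin.≟ d of λ where
        (yes e) → equal-missing refl (none' v) (v≢ ∘ ≡-sym) x-d y-a e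
        (no ne) → no-free refl (none' v) (v≢ ∘ ≡-sym) x-d y-a ne (λ u e → none (u , e))
      where
      none' : ∀ u → u ≢ ν one u
      none' u e = none (u , ≡-sym e)
    ... | yes (z , z-one) = go (ν one (M z) Fin.≟ M z)
      where
      c,z-c = full reg (M-near z)
      go : Dec (ν one (M z) ≡ M z) → Win act one ν
      go (yes x-one) = both-free refl z-one x-one (proj₂ c,z-c)
      go (no x-one) = let d , x-d = missingAt (M z)
                          a , y-a = missingAt (ν one (M z)) in
        case a Fin.≟ d of λ where
          (yes e) → equal-missing refl (x-one ∘ ≡-sym) M≢ x-d y-a e
          (no ne) → free-neighbour refl (x-one ∘ ≡-sym) M≢ x-d y-a ne refl z-one (proj₂ c,z-c)
        where
        M≢ : M (M z) ≢ ν one (M z)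
        M≢ e = M-free z (trans (≡-sym (back one (trans (≡-sym e) (M-invol z)))) z-one)

  -- The recursion is on a bound `k` for `Φ`, since a win only promises that `Φ` drops.
  settle : ∀ act one → T (act one) → ∀ k {ν} → Φ (ν one) < k → Regular5 R ν → Missing act ν → (∀ c v → ν c v ≡ M v → T (act c)) →
           ∃[ ν' ] (Star (Step act) ν ν' × (∀ v → ν' one v ≡ M v))
  settle act one active (suc k) {ν} Φ<k reg miss near with Finₚ.all? (λ v → ν one v Fin.≟ M v)
  ... | yes done = ν , ε , done
  ... | no ¬done = case Finₚ.¬∀⟶∃¬ n (λ v → ν one v ≡ M v) (λ v → ν one v Fin.≟ M v) ¬done of λ where
    (v , v≢) → case Improve.improve act one active reg miss near v v≢ of λ where
      (wins {ξ} reach less) →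
        let ξ' , reach' , done = settle act one active k {ξ} (ℕₚ.<-≤-trans less (ℕₚ.≤-pred Φ<k)) (steps-regular reach reg) (steps-missing reach miss)
              (λ c v e → case T? (act c) of λ where
                (yes p) → p
                (no ¬p) → near c v (trans (≡-sym (steps-fix reach c v ¬p)) e))
        in ξ' , reach ◅◅ reach' , done

-- Producing the colour classes in turn.

anything : Color → Bool
anything _ = true

step-weaken : ∀ {n act} {ν ν' : Colouring n} → Step act ν ν' → Step anything ν ν'
step-weaken (a , b , K , _ , _ , closed , e) = a , b , K , tt , tt , closed , e

module Stages {n : ℕ} (R : Fin n → Fin n → Set) (R-refl : ∀ v → R v v)
              {γ : Colouring n} (γ-reg : Regular5 R γ) (γ-4 : ∀ v → γ 4F v ≡ v) where

  from : ℕ → Color → Bool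
  from j c = ⌊ j ≤? toℕ c ⌋

  Agree : ℕ → Colouring n → Set
  Agree j ν = ∀ c → ¬ T (from j c) → ∀ v → ν c v ≡ γ c v

  from-yes : ∀ {j} c → j ≤ toℕ c → T (from j c)
  from-yes {j} c p with j ≤? toℕ c
  ... | yes _ = tt
  ... | no ¬p = ¬p p

  from-no : ∀ {j} c → T (from j c) → j ≤ toℕ c
  from-no {j} c t with j ≤? toℕ c
  ... | yes p = p

  γ-moves : ∀ {c} → c ≢ 4F → ∀ v → γ c v ≢ v
  γ-moves c≢4 v e = c≢4 (inject γ-reg v (trans e (≡-sym (γ-4 v))))

  -- The settled classes are perfect matchings of `γ`. Hence no vertex misses a settled colour, and
  -- no edge of the next class can carry one.
  stage : ∀ j → j ≢ 4F → ∀ {ν} → Regular5 R ν → Agree (toℕ j) ν →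
          ∃[ ν' ] (Star (Step anything) ν ν' × Regular5 R ν' × Agree (suc (toℕ j)) ν')
  stage j j≢4 {ν} reg agree =
    let ν' , steps , done = settle (from (toℕ j)) j (from-yes j ℕₚ.≤-refl) (suc (Φ (ν j))) ℕₚ.≤-refl reg miss near' in
    ν' , Star.map step-weaken steps , steps-regular steps reg , λ c ¬c v → case T? (from (toℕ j) c) of λ where
      (no ¬act) → trans (steps-fix steps c v ¬act) (agree c ¬act v)
      (yes act) → case Finₚ.toℕ-injective (ℕₚ.≤-antisym (from-no c act) (ℕₚ.≤-pred (ℕₚ.≰⇒> (¬c ∘ from-yes c)))) of λ where
        refl → done v
    where
    open Recolouring R R-refl (γ j) (invol γ-reg j) (γ-moves j≢4) (near γ-reg j)
    miss : Missing (from (toℕ j)) ν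
    miss c v e = case T? (from (toℕ j) c) of λ where
      (yes p) → p
      (no ¬p) → case c Fin.≟ 4F of λ where
        (yes refl) → from-yes 4F (Finₚ.toℕ≤pred[n] j)
        (no c≢4) → contradiction (trans (≡-sym (agree c ¬p v)) e) (γ-moves c≢4 v)
    near' : ∀ c v → ν c v ≡ γ j v → T (from (toℕ j) c)
    near' c v e = case T? (from (toℕ j) c) of λ where
      (yes p) → p
      (no ¬p) → case inject γ-reg v (trans (≡-sym (agree c ¬p v)) e) of λ where
        refl → from-yes j ℕₚ.≤-refl

  -- Once four classes coincide, colour 4 must lead to the one member of the closed neighbourhood
  -- that is left.
  agree-all : ∀ {ν} → Regular5 R ν → Agree 4 ν → ∀ c v → ν c v ≡ γ c v
  agree-all {ν} reg agree c v with T? (from 4 c)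
  ... | no ¬p = agree c ¬p v
  ... | yes p with full γ-reg (near reg c v)
  ...   | d , e with T? (from 4 d)
  ...     | yes q = trans (≡-sym e) (cong (λ x → γ x v) (Finₚ.toℕ-injective (trans (top d q) (≡-sym (top c p)))))
    where
    top : ∀ c → T (from 4 c) → toℕ c ≡ 4
    top c p = ℕₚ.≤-antisym (Finₚ.toℕ≤pred[n] c) (from-no c p)
  ...     | no ¬q = contradiction (subst (T ∘ from 4) (inject reg v (trans (≡-sym e) (≡-sym (agree d ¬q v)))) p) ¬q

  abstract
    transform : ∀ {ν} → Regular5 R ν → ∃[ ν' ] (Star (Step anything) ν ν' × (∀ c v → ν' c v ≡ γ c v))
    transform reg =
      let _ , s₀ , r₀ , a₀ = stage 0F (λ ()) reg (λ c ¬p _ → contradiction (from-yes c z≤n) ¬p)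
          _ , s₁ , r₁ , a₁ = stage 1F (λ ()) r₀ a₀
          _ , s₂ , r₂ , a₂ = stage 2F (λ ()) r₁ a₁
          _ , s₃ , r₃ , a₃ = stage 3F (λ ()) r₂ a₂
      in _ , s₀ ◅◅ s₁ ◅◅ s₂ ◅◅ s₃ , agree-all r₃ a₃

-- Edge colourings as families of involutions.

module EdgeColourings {n : ℕ} (G : Graph n) where

  V : Set
  V = Fin n

  R : V → V → Set
  R v u = v ≡ u ⊎ adj G v u ≡ true

  R-refl : ∀ v → R v v
  R-refl v = inj₁ refl

  edge-ext : ∀ {e e' : Edge G} → tail e ≡ tail e' → head e ≡ head e' → e ≡ e'
  edge-ext {edge t h l p} {edge .t .h l' p'} refl refl =
    cong₂ (edge t h) (ℕₚ.≤-irrelevant l l') (Decidable⇒UIP.≡-irrelevant Boolₚ._≟_ p p')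

  -- Edges are stored with the smaller end first; this view lets either end come first.
  record Joins (v u : V) : Set where
    constructor joins
    field
      link : Edge G
      ends : (tail link ≡ v × head link ≡ u) ⊎ (tail link ≡ u × head link ≡ v)
  open Joins

  joining : ∀ {v u} → adj G v u ≡ true → Joins v u
  joining {v} {u} p with Finₚ.<-cmp v u
  ... | tri< v<u _ _ = joins (edge v u v<u p) (inj₁ (refl , refl))
  ... | tri≈ _ refl _ = contradiction (trans (≡-sym p) (irrefl G v)) λ ()
  ... | tri> _ _ u<v = joins (edge u v u<v (trans (Graph.sym G u v) p)) (inj₂ (refl , refl))

  apart : (e : Edge G) → tail e ≢ head e
  apart e eq = ℕₚ.<-irrefl (cong toℕ eq) (lt e)

  adjacent : ∀ {v u} → Joins v u → adj G v u ≡ true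
  adjacent (joins e (inj₁ (refl , refl))) = isEdge e
  adjacent (joins e (inj₂ (refl , refl))) = trans (Graph.sym G _ _) (isEdge e)

  reverse : ∀ {v u} → Joins v u → Joins u v
  reverse (joins e (inj₁ p)) = joins e (inj₂ p)
  reverse (joins e (inj₂ p)) = joins e (inj₁ p)

  incidentˡ : ∀ {v u} (j : Joins v u) → Incident (link j) v
  incidentˡ (joins e (inj₁ (p , _))) = inj₁ p
  incidentˡ (joins e (inj₂ (_ , p))) = inj₂ p

  joins-unique : ∀ {v u} (j k : Joins v u) → link j ≡ link k
  joins-unique (joins e (inj₁ (refl , refl))) (joins e' (inj₁ (p , q))) = edge-ext (≡-sym p) (≡-sym q)
  joins-unique (joins e (inj₂ (refl , refl))) (joins e' (inj₂ (p , q))) = edge-ext (≡-sym p) (≡-sym q)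
  joins-unique (joins e (inj₁ (refl , refl))) (joins e' (inj₂ (p , q))) =
    contradiction (lt e) (ℕₚ.<-asym (subst (λ w → toℕ w < toℕ (tail e)) p (subst (λ w → toℕ (tail e') < toℕ w) q (lt e'))))
  joins-unique (joins e (inj₂ (refl , refl))) (joins e' (inj₁ (p , q))) = contradiction (lt e) (ℕₚ.<-asym (subst (λ w → toℕ w < toℕ (tail e)) p (subst (λ w → toℕ (tail e') < toℕ w) q (lt e'))))

  joins-target : ∀ {v u u'} (j : Joins v u) (k : Joins v u') → link j ≡ link k → u ≡ u'
  joins-target (joins e (inj₁ (refl , refl))) (joins .e (inj₁ (p , q))) refl = q
  joins-target (joins e (inj₂ (refl , refl))) (joins .e (inj₂ (p , q))) refl = p
  joins-target (joins e (inj₁ (refl , refl))) (joins .e (inj₂ (p , q))) refl = contradiction (≡-sym q) (apart e)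
  joins-target (joins e (inj₂ (refl , refl))) (joins .e (inj₁ (p , q))) refl = contradiction p (apart e)

  lookup-unique : ∀ {A : Set} {L : List A} → Unique L → ∀ i j → lookup L i ≡ lookup L j → i ≡ j
  lookup-unique (_ ∷ _) zero zero _ = refl
  lookup-unique {L = x ∷ L} (p ∷ _) zero (suc j) e = contradiction e (All.lookup p (Memₚ.∈-lookup j))
  lookup-unique {L = x ∷ L} (p ∷ _) (suc i) zero e = contradiction (≡-sym e) (All.lookup p (Memₚ.∈-lookup i))
  lookup-unique (_ ∷ q) (suc i) (suc j) e = cong suc (lookup-unique q i j e)

  T⇒≡ : ∀ {x} → T x → x ≡ true
  T⇒≡ {true} _ = refl

  neighbours : V → List V
  neighbours v = filterᵇ (adj G v) (allFin n)

  neighbours-unique : ∀ v → Unique (neighbours v)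
  neighbours-unique v = Uniqueₚ.filter⁺ (T? ∘ adj G v) (Uniqueₚ.allFin⁺ n)

  neighbour-adj : ∀ {v u} → u ∈ neighbours v → adj G v u ≡ true
  neighbour-adj {v} p = T⇒≡ (proj₂ (Memₚ.∈-filter⁻ (T? ∘ adj G v) {xs = allFin n} p))

  adj-neighbour : ∀ {v u} → adj G v u ≡ true → u ∈ neighbours v
  adj-neighbour {v} {u} p = Memₚ.∈-filter⁺ (T? ∘ adj G v) (Memₚ.∈-allFin u) (subst T (≡-sym p) tt)

  Realises : EdgeColoring G 5 → Colouring n → Set
  Realises f ν = ∀ {v u} (j : Joins v u) → ν (f (link j)) v ≡ u

  module Involutions (regular4 : Regular 4 G) (f : EdgeColoring G 5) (proper : Proper {G = G} f) where

    hue : ∀ {v u} → Joins v u → Color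
    hue j = f (link j)

    hue-unique : ∀ {v u u'} (j : Joins v u) (k : Joins v u') → hue j ≡ hue k → u ≡ u'
    hue-unique {v} j k e with (tail (link j) Fin.≟ tail (link k)) ×-dec (head (link j) Fin.≟ head (link k))
    ... | yes (p , q) = joins-target j k (edge-ext p q)
    ... | no different = contradiction e (proper _ _ ((v , incidentˡ j , incidentˡ k) , different))

    Coloured : Color → V → V → Set
    Coloured c v u = Σ[ j ∈ Joins v u ] hue j ≡ c

    coloured? : ∀ c v u → Dec (Coloured c v u)
    coloured? c v u with adj G v u Boolₚ.≟ true
    ... | no ¬p = no λ { (j , _) → ¬p (adjacent j) }
    ... | yes p with hue (joining p) Fin.≟ c
    ...   | yes e = yes (joining p , e)
    ...   | no ne = no λ { (j , e) → ne (trans (cong f (joins-unique (joining p) j)) e) }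

    coloured-reverse : ∀ {c v u} → Coloured c v u → Coloured c u v
    coloured-reverse (j , e) = reverse j , trans (cong f (joins-unique (reverse j) (reverse j))) (trans (same j) e)
      where
      same : ∀ {v u} (j : Joins v u) → hue (reverse j) ≡ hue j
      same (joins _ (inj₁ _)) = refl
      same (joins _ (inj₂ _)) = refl

    Sees : Color → V → Set
    Sees c v = ∃[ u ] Coloured c v u

    sees? : ∀ c v → Dec (Sees c v)
    sees? c v = Finₚ.any? (coloured? c v)

    ν : Colouring n
    ν c v with sees? c v
    ... | yes (u , _) = u
    ... | no _ = v

    ν-hit : ∀ {c v u} → Coloured c v u → ν c v ≡ u
    ν-hit {c} {v} (j , e) with sees? c v
    ... | yes (_ , k , e') = hue-unique k j (trans e' (≡-sym e))
    ... | no none = contradiction (_ , j , e) none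

    ν-miss : ∀ {c v} → ¬ Sees c v → ν c v ≡ v
    ν-miss {c} {v} none with sees? c v
    ... | yes s = contradiction s none
    ... | no _ = refl

    ν-cases : ∀ c v → Coloured c v (ν c v) ⊎ (¬ Sees c v × ν c v ≡ v)
    ν-cases c v with sees? c v
    ... | yes (_ , s) = inj₁ s
    ... | no none = inj₂ (none , refl)

    not-self : ∀ {c v} → ¬ Coloured c v v
    not-self {v = v} (j , _) = contradiction (trans (≡-sym (adjacent j)) (irrefl G v)) λ ()

    -- Otherwise the five colours would occupy different positions in a list of four neighbours.
    misses : ∀ v → ∃[ c ] ¬ Sees c v
    misses v with Finₚ.all? (λ c → sees? c v)
    ... | no ¬all = Finₚ.¬∀⟶∃¬ 5 (λ c → Sees c v) (λ c → sees? c v) ¬all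
    ... | yes all with Finₚ.pigeonhole (ℕₚ.≤-reflexive (cong suc (regular4 v))) (λ c → Any.index (spot c))
      where
      spot : ∀ c → proj₁ (all c) ∈ neighbours v
      spot c = adj-neighbour (adjacent (proj₁ (proj₂ (all c))))
    ...   | c , d , c<d , e = contradiction (clash (all c) (all d) e) (λ { refl → ℕₚ.<-irrefl refl c<d })
      where
      same-index : ∀ {L : List V} {u w} (p : u ∈ L) (q : w ∈ L) → Any.index p ≡ Any.index q → u ≡ w
      same-index (here refl) (here refl) _ = refl
      same-index (there p) (there q) e = same-index p q (Finₚ.suc-injective e)
      clash : ∀ {c d} (s : Sees c v) (t : Sees d v) →
              Any.index (adj-neighbour (adjacent (proj₁ (proj₂ s)))) ≡ Any.index (adj-neighbour (adjacent (proj₁ (proj₂ t)))) → c ≡ d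
      clash (u , j , p) (w , k , q) e with same-index (adj-neighbour (adjacent j)) (adj-neighbour (adjacent k)) e
      ... | refl = trans (≡-sym p) (trans (cong f (joins-unique j k)) q)

    -- The four edges at `v` have different colours. If both `c` and `d` were absent, removing them
    -- by `punchOut` would leave only three colours for these edges.
    misses-unique : ∀ v {c d} → ¬ Sees c v → ¬ Sees d v → c ≡ d
    misses-unique v {c} {d} ¬c ¬d with c Fin.≟ d
    ... | yes e = e
    ... | no c≢d = let i , j , i<j , e = Finₚ.pigeonhole (ℕₚ.≤-reflexive (≡-sym (regular4 v))) seat in
      contradiction i<j (ℕₚ.<-irrefl (cong toℕ (seat-injective i j e)))
      where
      joint : ∀ i → Joins v (lookup (neighbours v) i)
      joint i = joining (neighbour-adj (Memₚ.∈-lookup i))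
      c≢ : ∀ i → c ≢ hue (joint i)
      c≢ i e = ¬c (_ , joint i , ≡-sym e)
      d≢ : ∀ i → Fin.punchOut c≢d ≢ Fin.punchOut (c≢ i)
      d≢ i e = ¬d (_ , joint i , ≡-sym (Finₚ.punchOut-injective c≢d (c≢ i) e))
      seat : Fin (degree G v) → Fin 3
      seat i = Fin.punchOut (d≢ i)
      seat-injective : ∀ i j → seat i ≡ seat j → i ≡ j
      seat-injective i j e = lookup-unique (neighbours-unique v) i j (hue-unique (joint i) (joint j)
        (Finₚ.punchOut-injective (c≢ i) (c≢ j) (Finₚ.punchOut-injective (d≢ i) (d≢ j) e)))

    ν-regular : Regular5 R ν
    ν-regular = record { invol = invol' ; inject = inject' ; near = near' ; full = full' }
      where
      invol' : ∀ c v → ν c (ν c v) ≡ v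
      invol' c v with ν-cases c v
      ... | inj₁ s = ν-hit (coloured-reverse s)
      ... | inj₂ (_ , e) = trans (cong (ν c) e) e
      inject' : ∀ {c d} v → ν c v ≡ ν d v → c ≡ d
      inject' {c} {d} v e with ν-cases c v | ν-cases d v
      ... | inj₁ (j , p) | inj₁ (k , q) = trans (≡-sym p) (trans (cong f (joins-unique' j k e)) q)
        where
        joins-unique' : ∀ {u w} (j : Joins v u) (k : Joins v w) → u ≡ w → link j ≡ link k
        joins-unique' j k refl = joins-unique j k
      ... | inj₁ s | inj₂ (_ , q) = contradiction (subst (Coloured c v) (trans e q) s) not-self
      ... | inj₂ (_ , p) | inj₁ s = contradiction (subst (Coloured d v) (trans (≡-sym e) p) s) not-self
      ... | inj₂ (p , _) | inj₂ (q , _) = misses-unique v p q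
      near' : ∀ c v → R v (ν c v)
      near' c v with ν-cases c v
      ... | inj₁ (j , _) = inj₂ (adjacent j)
      ... | inj₂ (_ , e) = inj₁ (≡-sym e)
      full' : ∀ {v u} → R v u → ∃[ c ] ν c v ≡ u
      full' {v} (inj₁ refl) = let c , none = misses v in c , ν-miss none
      full' (inj₂ p) = hue (joining p) , ν-hit (joining p , refl)

    ν-realised : Realises f ν
    ν-realised j = ν-hit (j , refl)

  edge-ends : (e : Edge G) → Joins (tail e) (head e)
  edge-ends e = joins e (inj₁ (refl , refl))

  -- Interchanges realise exchanges.

  module _ {ν : Colouring n} (reg : Regular5 R ν) {f : EdgeColoring G 5} (real : Realises f ν) {a b : Color} (a≢b : a ≢ b) (v : V) where

    open Chains ν (invol reg) a b

    recolouring : EdgeColoring G 5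
    recolouring e = pick (chain v (tail e)) a b (f e)

    edgeAt : ∀ c u → ν c u ≢ u → Σ[ j ∈ Joins u (ν c u) ] f (link j) ≡ c
    edgeAt c u moves with near reg c u
    ... | inj₁ e = contradiction (≡-sym e) moves
    ... | inj₂ p = joining p , inject reg u (real (joining p))

    -- An interchange is anchored at an edge, a chain at a vertex. Since `v` misses only one colour,
    -- one of `a` and `b` provides the edge.
    starting : ∃[ e ] (InAB f a b e × Incident e v)
    starting with ν a v Fin.≟ v | ν b v Fin.≟ v
    ... | no moves | _ = let j , e = edgeAt a v moves in link j , inj₁ e , incidentˡ j
    ... | yes _ | no moves = let j , e = edgeAt b v moves in link j , inj₂ e , incidentˡ j
    ... | yes p | yes q = contradiction (inject reg v (trans p (≡-sym q))) a≢b

    e₀ : Edge G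
    e₀ = proj₁ starting

    along : ∀ {c} → c ≡ a ⊎ c ≡ b → ∀ u → chain v (ν c u) ≡ chain v u
    along (inj₁ refl) u = proj₁ (chain-closed v u)
    along (inj₂ refl) u = proj₂ (chain-closed v u)

    side-at : ∀ {e u} → InAB f a b e → Incident e u → chain v u ≡ chain v (tail e)
    side-at ab (inj₁ refl) = refl
    side-at {e} ab (inj₂ refl) = trans (cong (chain v) (≡-sym (real (edge-ends e)))) (along ab (tail e))

    same-side : ∀ {e e'} → SameComp f a b e e' → chain v (tail e) ≡ chain v (tail e')
    same-side ε = refl
    same-side ((p , q , w , i , i') ◅ ss) = trans (≡-sym (side-at p i)) (trans (side-at q i') (same-side ss))

    -- The invariant that carries vertex chains into edge components; `same-side` gives the opposite
    -- inclusion.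
    Reached : V → Set
    Reached u = ∀ e → InAB f a b e → Incident e u → SameComp f a b e₀ e

    reached-start : Reached v
    reached-start e p i = (proj₁ (proj₂ starting) , p , v , proj₂ (proj₂ starting) , i) ◅ ε

    reached-step : ∀ c → c ≡ a ⊎ c ≡ b → ∀ {u} → Reached u → Reached (ν c u)
    reached-step c h {u} r with ν c u Fin.≟ u
    ... | yes e = subst Reached (≡-sym e) r
    ... | no moves = let j , q = edgeAt c u moves
                         ab = subst (λ d → d ≡ a ⊎ d ≡ b) (≡-sym q) h in
      λ e p i → r (link j) ab (incidentˡ j) ◅◅ ((ab , p , ν c u , incidentʳ j , i) ◅ ε)
      where
      incidentʳ : ∀ {v u} (j : Joins v u) → Incident (link j) u
      incidentʳ (joins e (inj₁ (_ , p))) = inj₂ p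
      incidentʳ (joins e (inj₂ (p , _))) = inj₁ p

    interchange : Interchange {G = G} f recolouring
    interchange = a , b , e₀ , proj₁ (proj₂ starting) , λ e → inside e , outside e
      where
      inside : ∀ e → SameComp f a b e₀ e → recolouring e ≡ swap a b (f e)
      inside e s = cong (λ k → pick k a b (f e))
        (trans (≡-sym (same-side s)) (trans (≡-sym (side-at (proj₁ (proj₂ starting)) (proj₂ (proj₂ starting)))) (chain-start v)))
      outside : ∀ e → ¬ SameComp f a b e₀ e → recolouring e ≡ f e
      outside e ¬s with chain v (tail e) in eq | either (f e) a b
      ... | false | _ = refl
      ... | true | no other = swap-other a b (f e) (other ∘ inj₁) (other ∘ inj₂)
      ... | true | yes ab = contradiction (onChain-minimal Reached reached-start (reached-step a (inj₁ refl)) (reached-step b (inj₂ refl))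
                              (chain-sound eq) e ab (inj₁ refl)) ¬s

    recolouring-realises : Realises recolouring (flip a b (chain v) ν)
    recolouring-realises {u} j with real j | joins-side j
      where
      joins-side : ∀ {u w} (j : Joins u w) → pick (chain v (tail (link j))) a b (f (link j)) ≡ pick (chain v u) a b (f (link j))
      joins-side {u} j with either (f (link j)) a b
      ... | yes ab = cong (λ k → pick k a b (f (link j))) (≡-sym (side-at ab (incidentˡ j)))
      ... | no other = trans (pick-other (chain v (tail (link j))) (other ∘ inj₁) (other ∘ inj₂))
                             (≡-sym (pick-other (chain v u) (other ∘ inj₁) (other ∘ inj₂)))
    ... | e | q = trans (cong (λ c → ν (pick (chain v u) a b c) u) q) (trans (cong (λ c → ν c u) (pick-pick (chain v u) a b (f (link j)))) e)

  realises-≗ : ∀ {f} {ν ν' : Colouring n} → (∀ c v → ν' c v ≡ ν c v) → Realises f ν → Realises f ν'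
  realises-≗ eq real {v} j = trans (eq _ v) (real j)

  Carried : EdgeColoring G 5 → Colouring n → Set
  Carried f ν = ∃[ h ] (Star (Interchange {G = G}) f h × Realises h ν)

  -- A closed set is a union of chains, which are interchanged one at a time.
  exchangeAll : ∀ {a b} → a ≢ b → (L : List V) (K : V → Bool) → (∀ v → K v ≡ true → v ∈ L) →
             ∀ {ν f} → Regular5 R ν → Closed a b K ν → Realises f ν → Carried f (flip a b K ν)
  exchangeAll a≢b [] K only {ν} {f} reg closed real = f , ε , realises-≗ {f} (λ c v → cong (λ k → ν (pick k _ _ c) v) (none v)) real
    where
    none : ∀ v → K v ≡ false
    none v with K v in eq
    ... | false = refl
    ... | true = case only v eq of λ ()
  exchangeAll {a} {b} a≢b (x ∷ L) K only {ν} {f} reg closed real with K x in Kx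
  ... | false = exchangeAll a≢b L K only' reg closed real
    where
    only' : ∀ v → K v ≡ true → v ∈ L
    only' v e with only v e
    ... | here refl = contradiction (trans (≡-sym Kx) e) λ ()
    ... | there p = p
  ... | true with exchangeAll a≢b L K' only' (flip-regular a b C (chain-closed x) reg) closed' (recolouring-realises reg real a≢b x)
    where
    open Chains ν (invol reg) a b
    C = chain x
    K' : V → Bool
    K' v = K v ∧ not (C v)
    only' : ∀ v → K' v ≡ true → v ∈ L
    only' v e with K v in Kv | C v in Cv
    ... | true | false with only v Kv
    ...   | there p = p
    ...   | here refl = contradiction (trans (≡-sym Cv) (chain-start x)) λ ()
    closed₀ : ∀ c → c ≡ a ⊎ c ≡ b → ∀ v → K' (ν c v) ≡ K' v
    closed₀ c (inj₁ refl) v = cong₂ (λ p q → p ∧ not q) (proj₁ (closed v)) (proj₁ (chain-closed x v))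
    closed₀ c (inj₂ refl) v = cong₂ (λ p q → p ∧ not q) (proj₂ (closed v)) (proj₂ (chain-closed x v))
    pick-in : ∀ k c → c ≡ a ⊎ c ≡ b → pick k a b c ≡ a ⊎ pick k a b c ≡ b
    pick-in false c h = h
    pick-in true c (inj₁ refl) = inj₂ (swap-l a b)
    pick-in true c (inj₂ refl) = inj₁ (swap-r a b)
    closed' : Closed a b K' (flip a b C ν)
    closed' v = closed₀ _ (pick-in (C v) a (inj₁ refl)) v , closed₀ _ (pick-in (C v) b (inj₂ refl)) v
  ...   | h , steps , real' = h , interchange reg real a≢b x ◅ steps , realises-≗ {h} together real'
    where
    open Chains ν (invol reg) a b
    subset : ∀ v → chain x v ≡ true → K v ≡ true
    subset v e = onChain-minimal (λ u → K u ≡ true) Kx (λ {u} p → trans (proj₁ (closed u)) p) (λ {u} p → trans (proj₂ (closed u)) p) (chain-sound e)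
    together : ∀ c v → flip a b K ν c v ≡ flip a b (λ u → K u ∧ not (chain x u)) (flip a b (chain x) ν) c v
    together c v with K v in Kv | chain x v in Cv
    ... | true | true = refl
    ... | true | false = refl
    ... | false | false = refl
    ... | false | true = contradiction (trans (≡-sym Kv) (subset v Cv)) λ ()

  carry-step : ∀ {ν ν' f} → Regular5 R ν → Step anything ν ν' → Realises f ν → Carried f ν'
  carry-step {ν} {ν'} {f} reg (a , b , K , _ , _ , closed , eq) real with a Fin.≟ b
  -- A step may name the same colour twice; it is then the identity and takes no interchange.
  ... | yes refl = f , ε , realises-≗ {f} (λ c v → trans (eq c v) (cong (λ d → ν d v) (idle (K v) c))) real
    where
    idle : ∀ k c → pick k a a c ≡ c
    idle false c = refl
    idle true c with among a a c
    ... | isˡ = swap-l a a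
    ... | isʳ = swap-l a a
    ... | isₒ p q = swap-other a a c p q
  ... | no a≢b = let h , steps , real' = exchangeAll a≢b (allFin n) K (λ v _ → Memₚ.∈-allFin v) reg closed real in h , steps , realises-≗ {h} eq real'

  carry-steps : ∀ {ν ν' f} → Regular5 R ν → Star (Step anything) ν ν' → Realises f ν → Carried f ν'
  carry-steps {f = f} reg ε real = f , ε , real
  carry-steps reg (s ◅ ss) real =
    let h , steps , real' = carry-step reg s real
        h' , steps' , real'' = carry-steps (step-regular s reg) ss real'
    in h' , steps ◅◅ steps' , real''

theorem4p1 : ∀ {n : ℕ} (G : Graph n) → Regular 4 G → ChromaticIndexIs G 4 →
    ∀ (f : EdgeColoring G 5) → Proper f →
    ∀ (g : EdgeColoring G 4) → Proper g →
    Transformable f (as5 g)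
theorem4p1 G regular4 _ f f-proper g g-proper =
  let _ , steps , done = Stages.transform R R-refl (T.ν-regular) γ-4 S.ν-regular
      h , interchanges , real = carry-steps S.ν-regular steps S.ν-realised
  -- In the family of `g` both `h e` and the colour of `e` under `g` lead from `tail e` to `head e`,
  -- and a neighbour determines its colour.
  in h , interchanges , λ e → inject T.ν-regular (tail e)
       (trans (≡-sym (done (h e) (tail e))) (trans (real (edge-ends e)) (≡-sym (T.ν-realised (edge-ends e)))))
  where
  open EdgeColourings G
  module S = Involutions regular4 f f-proper
  module T = Involutions regular4 (as5 g) (λ e e' adjacent' eq → g-proper e e' adjacent' (Finₚ.inject₁-injective eq))
  γ-4 : ∀ v → T.ν 4F v ≡ v
  γ-4 v = T.ν-miss λ { (_ , j , e) → Finₚ.fromℕ≢inject₁ (≡-sym e) }
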